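{- Let $p$ be a prime and $t$ an integer, and suppose that either $p\geq 5$ and $t\geq 2$, or $p=3$ and $t\geq 3$. Let $\mathcal S(\mathbb Z_{p^t})$ denote the set of determinants of $p^t\times p^t$ circulant matrices with integer entries. Then $p^{2t}\mathbb Z\subset \mathcal S(\mathbb Z_{p^t})$, but $p^j\notin \mathcal S(\mathbb Z_{p^t})$ for every integer $j$ with $t+1\leq j\leq 2t-1$. Moreover, suppose that $p^j m\in \mathcal S(\mathbb Z_{p^t})$ where $m$ is an integer with $p\nmid m$ and $t+1\leq j\leq 2t-1$. (a) If $p\geq 5$, or $p=3$ and $j>t+1$, then there exist $2t-j$ prime powers $q_1^{a_1},\dots,q_{2t-j}^{a_{2t-j}}$ ($q_i$ prime, each $a_i$ a positive odd integer) with $q_i^{a_i}\equiv 1 \pmod{p^i}$ for each $i$, such that $\prod_{i=1}^{2t-j} q_i^{a_i}$ divides $m$. (b) If $p=3$ and $j=t+1$, then there exist $t-2$ prime powers $q_2^{a_2},\dots,q_{t-1}^{a_{t-1}}$ ($q_i$ prime, each $a_i$ a positive odd integer) with $q_i^{a_i}\equiv 1\pmod{3^i}$ for each $i$, such that $\prod_{i=2}^{t-1} q_i^{a_i}$ divides $m$.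
   Context: An $n\times n$ circulant matrix is one whose first row is $(a_0,a_1,\dots,a_{n-1})$ and each subsequent row is the cyclic shift of the previous one one place to the right. $\mathcal S(\mathbb Z_n)$ is the set of determinants of such matrices with all $a_i\in\mathbb Z$; equivalently $\mathcal S(\mathbb Z_n)=\{\prod_{z^n=1}F(z) : F\in\mathbb Z[x]\}$. -}

module Defs where

open import Data.Nat as ℕ using (ℕ; zero; suc)
open import Data.Nat.DivMod using (_mod_)
open import Data.Fin using (Fin; zero; suc; toℕ; punchIn)
open import Data.Integer using (ℤ; +_; -_; _+_; _*_)
open import Data.Integer as ℤ using (_^_)
open import Data.Product using (∃)
open import Data.Empty using (⊥)
open import Relation.Binary.PropositionalEquality using (_≡_)

sumFin : (n : ℕ) → (Fin n → ℤ) → ℤ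
sumFin zero f = + 0
sumFin (suc n) f = f zero + sumFin n (λ i → f (suc i))

prodFinℕ : (n : ℕ) → (Fin n → ℕ) → ℕ
prodFinℕ zero f = 1
prodFinℕ (suc n) f = f zero ℕ.* prodFinℕ n (λ i → f (suc i))

det : (n : ℕ) → (Fin n → Fin n → ℤ) → ℤ
det zero M = + 1
det (suc n) M =
  sumFin (suc n) (λ j → ((- + 1) ^ toℕ j) * (M zero j * det n (λ i k → M (suc i) (punchIn j k))))

-- Circulant matrix of size (suc k) with first row a:
-- entry (i , j) = a ((j - i) mod (suc k)).
circulant : (k : ℕ) → (Fin (suc k) → ℤ) → Fin (suc k) → Fin (suc k) → ℤ
circulant k a i j = a ((toℕ j ℕ.+ (suc k ℕ.∸ toℕ i)) mod (suc k))

-- d ∈ 𝒮(ℤ_n): d is the determinant of some n × n integer circulant matrix.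
-- (n = 0 is never used; there 𝒮 is taken empty.)
InS : ℕ → ℤ → Set
InS zero d = ⊥
InS (suc k) d = ∃ λ (a : Fin (suc k) → ℤ) → det (suc k) (circulant k a) ≡ d

{-# OPTIONS --safe #-}
-- Write ω for a primitive p^i-th root of unity and N for the norm of ℤ[ω]. The circulant determinant
-- of F is F(1) times the product of the norms N(F(ω)), 1 ≤ i ≤ t. If p divides it, then p ∣ F(1) and
-- F(ω) = (1 - ω) u(ω) with N(1 - ω) = p; as p^(2t) does not divide the determinant p^j m, each N(u) is
-- prime to p, so F(1) has p-adic valuation exactly j - t and the product of the N(u) divides m.
--
-- A prime q ∣ N(u) of odd order f modulo p^i contributes q^f ∣ N(u) with q^f ≡ 1 (mod p^i). If there is
-- none, complex conjugation fixes every prime ideal dividing u, so u / ū is a unit of absolute value 1,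
-- hence ± a root of unity (compare trace forms), and F(ω) = - ω^r F(1/ω). The exponents r of two such
-- levels are compatible, as otherwise p would divide some (1 - ω^d)(1 - ω); the only exception is
-- p = 3, i = 1, where 3 but not 9 divides (1 - ω)². Thus one polynomial F(X) + X^r F(1/X) vanishes at all
-- these levels, and each of them contributes a factor p to its value 2 F(1) at 1. So, up to
-- that exception, there are at most j - t of them, and the other levels supply the prime powers.
--
-- Conversely (1 - X) + c (1 + X + ... + X^(n-1)) has determinant c n².
module Submission where

open import Defs
open import Level using (0ℓ)
open import Algebra.Bundles using (CommutativeMonoid; CommutativeRing)
open import Algebra.Solver.Ring.AlmostCommutativeRing using (fromCommutativeRing; _-Raw-AlmostCommutative⟶_)
open import Data.Empty using (⊥)
open import Data.Fin as Fin using (Fin; zero; suc; toℕ; punchIn)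
import Data.Fin.Properties as Finₚ
open import Data.Integer as ℤ using (ℤ; +_; -[1+_]; +≤+; -≤+; ∣_∣)
import Data.Integer.DivMod as ℤM
open import Data.Integer.Divisibility as ℤD using ()
import Data.Integer.Divisibility.Signed as ℤS
import Data.Integer.Properties as ℤₚ
open import Data.List using (List; []; _∷_; _++_; applyUpTo; upTo; length; map; concat)
open import Data.List.Membership.Propositional using (_∈_)
open import Data.List.Properties using (length-upTo)
open import Data.List.Relation.Binary.Permutation.Propositional using (_↭_)
open import Data.List.Relation.Unary.All using ([]; _∷_)
open import Data.List.Relation.Unary.Any using (here; there)
open import Data.Maybe using (Maybe; just; nothing)
open import Data.Nat as ℕ using (ℕ; zero; suc; NonZero)
open import Data.Nat.Combinatorics using (nCn≡1; nCk≡nC[n∸k]; k>n⇒nCk≡0; nCk+nC[k+1]≡[n+1]C[k+1]) renaming (_C_ to _binom_)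
open import Data.Nat.DivMod
open import Data.Nat.Divisibility as ℕD using ()
open import Data.Nat.GCD using (gcd; gcd[m,n]∣m; gcd[m,n]∣n; gcd-GCD; module Bézout)
open import Data.Nat.Induction using (<-rec)
open import Data.Nat.Primality using (Prime; euclidsLemma; prime⇒nonZero)
open import Data.Nat.Primality.Factorisation using (factorise)
import Data.Nat.Properties as ℕₚ
open import Data.Nat.Solver using (module +-*-Solver)
open import Data.Product using (∃; ∃₂; _,_; _×_; proj₁; proj₂)
open import Data.Sum using (_⊎_; inj₁; inj₂)
open import Data.Unit using (⊤; tt)
open import Data.Vec using (Vec; []; _∷_; tabulate; replicate) renaming (map to mapV)
import Data.Vec.Properties as Vecₚ
open import Data.Vec.Relation.Binary.Pointwise.Inductive using (Pointwise; []; _∷_)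
open import Function using (_∘_)
open import Relation.Binary using (tri<; tri≈; tri>)
open import Relation.Binary.PropositionalEquality as ≡ using (_≡_; _≢_; cong; cong₂)
open import Relation.Nullary using (¬_; Dec; yes; no; contradiction)

module BigOp (M : CommutativeMonoid 0ℓ 0ℓ) where
  open import Data.List.Relation.Binary.Permutation.Propositional using (refl; prep; swap; trans)
  open CommutativeMonoid M
  open import Algebra.Properties.CommutativeMonoid.Sum M
  open import Algebra.Properties.CommutativeSemigroup commutativeSemigroup using (interchange; x∙yz≈y∙xz)
  open import Relation.Binary.Reasoning.Setoid setoid

  big : ℕ → (ℕ → Carrier) → Carrier
  big n f = sum {n} (λ i → f (toℕ i))

  big-cong : ∀ n {f g} → (∀ k → k ℕ.< n → f k ≈ g k) → big n f ≈ big n g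
  big-cong n h = sum-cong-≋ {n} (λ i → h (toℕ i) (Finₚ.toℕ<n i))

  big-∙ : ∀ n f g → big n (λ k → f k ∙ g k) ≈ big n f ∙ big n g
  big-∙ n f g = ∑-distrib-+ {n} (λ i → f (toℕ i)) (λ i → g (toℕ i))

  big-ε : ∀ n → big n (λ _ → ε) ≈ ε
  big-ε = sum-replicate-zero

  big-comm : ∀ m n (f : ℕ → ℕ → Carrier) →
    big m (λ i → big n (f i)) ≈ big n (λ j → big m (λ i → f i j))
  big-comm m n f = ∑-comm {m} {n} (λ i j → f (toℕ i) (toℕ j))

  big-last : ∀ n f → big (suc n) f ≈ big n f ∙ f n
  big-last zero    f = comm _ _
  big-last (suc n) f = CommutativeMonoid.trans M (∙-congˡ (big-last n (f ∘ suc))) (sym (assoc _ _ _))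

  big-+ : ∀ m n f → big (m ℕ.+ n) f ≈ big m f ∙ big n (λ k → f (m ℕ.+ k))
  big-+ zero    n f = sym (identityˡ _)
  big-+ (suc m) n f = begin
    f 0 ∙ big (m ℕ.+ n) (f ∘ suc)  ≈⟨ ∙-congˡ (big-+ m n (f ∘ suc)) ⟩
    f 0 ∙ (big m (f ∘ suc) ∙ _)    ≈⟨ assoc _ _ _ ⟨
    _                              ∎

  big-* : ∀ p m f → big (p ℕ.* m) f ≈ big p (λ c → big m (λ u → f (c ℕ.* m ℕ.+ u)))
  big-* zero    m f = CommutativeMonoid.refl M
  big-* (suc p) m f = begin
    big (m ℕ.+ p ℕ.* m) f
      ≈⟨ big-+ m (p ℕ.* m) f ⟩
    big m f ∙ big (p ℕ.* m) (λ k → f (m ℕ.+ k))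
      ≈⟨ ∙-congˡ (big-* p m (λ k → f (m ℕ.+ k))) ⟩
    big m f ∙ big p (λ c → big m (λ u → f (m ℕ.+ (c ℕ.* m ℕ.+ u))))
      ≈⟨ ∙-congˡ (big-cong p λ c _ → big-cong m λ u _ →
           reflexive (≡.cong f (≡.sym (ℕₚ.+-assoc m (c ℕ.* m) u)))) ⟩
    _ ∎

  big-shift : ∀ n f → (∀ k → f (k ℕ.+ n) ≈ f k) → ∀ s → big n (λ k → f (k ℕ.+ s)) ≈ big n f
  big-shift n f per zero    = big-cong n λ k _ → reflexive (≡.cong f (ℕₚ.+-identityʳ k))
  big-shift zero f per (suc s) = CommutativeMonoid.refl M
  big-shift n@(suc m) f per (suc s) = begin
    big n (λ k → f (k ℕ.+ suc s))
      ≈⟨ big-cong n (λ k _ → reflexive (≡.cong f (ℕₚ.+-suc k s))) ⟩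
    big n (λ k → g (suc k))              ≈⟨ big-last m (λ k → g (suc k)) ⟩
    big m (λ k → g (suc k)) ∙ g n        ≈⟨ ∙-congˡ gn≈g0 ⟩
    big m (λ k → g (suc k)) ∙ g 0        ≈⟨ comm _ _ ⟩
    big n g                              ≈⟨ big-shift n f per s ⟩
    big n f                              ∎
    where
    g : ℕ → Carrier
    g k = f (k ℕ.+ s)
    gn≈g0 : g n ≈ g 0
    gn≈g0 = CommutativeMonoid.trans M (reflexive (≡.cong f (ℕₚ.+-comm n s))) (per s)

  fold : List ℕ → (ℕ → Carrier) → Carrier
  fold []       f = ε
  fold (x ∷ xs) f = f x ∙ fold xs f

  fold-cong : ∀ xs {f g} → (∀ {x} → x ∈ xs → f x ≈ g x) → fold xs f ≈ fold xs g
  fold-cong []       h = CommutativeMonoid.refl M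
  fold-cong (x ∷ xs) h = ∙-cong (h (here ≡.refl)) (fold-cong xs (h ∘ there))

  fold-↭ : ∀ {xs ys} → xs ↭ ys → ∀ f → fold xs f ≈ fold ys f
  fold-↭ refl         f = CommutativeMonoid.refl M
  fold-↭ (prep x π)   f = ∙-congˡ (fold-↭ π f)
  fold-↭ (swap x y π) f =
    CommutativeMonoid.trans M (∙-congˡ (∙-congˡ (fold-↭ π f))) (x∙yz≈y∙xz _ _ _)
  fold-↭ (trans π ρ)  f = CommutativeMonoid.trans M (fold-↭ π f) (fold-↭ ρ f)

  fold-++ : ∀ xs ys f → fold (xs ++ ys) f ≈ fold xs f ∙ fold ys f
  fold-++ []       ys f = sym (identityˡ _)
  fold-++ (x ∷ xs) ys f =
    CommutativeMonoid.trans M (∙-congˡ (fold-++ xs ys f)) (sym (assoc _ _ _))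

  fold-map : ∀ h xs f → fold (map h xs) f ≡ fold xs (f ∘ h)
  fold-map h []       f = ≡.refl
  fold-map h (x ∷ xs) f = ≡.cong (f (h x) ∙_) (fold-map h xs f)

  fold-applyUpTo : ∀ h n f → fold (applyUpTo h n) f ≡ big n (f ∘ h)
  fold-applyUpTo h zero    f = ≡.refl
  fold-applyUpTo h (suc n) f = ≡.cong (f (h 0) ∙_) (fold-applyUpTo (h ∘ suc) n f)

  fold-upTo : ∀ n f → fold (upTo n) f ≡ big n f
  fold-upTo n f = fold-applyUpTo (λ k → k) n f

  fold-∙ : ∀ xs f g → fold xs (λ k → f k ∙ g k) ≈ fold xs f ∙ fold xs g
  fold-∙ []       f g = sym (identityˡ _)
  fold-∙ (x ∷ xs) f g =
    CommutativeMonoid.trans M (∙-congˡ (fold-∙ xs f g)) (interchange _ _ _ _)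

  fold-big : ∀ xs n (f : ℕ → ℕ → Carrier) →
    fold xs (λ i → big n (f i)) ≈ big n (λ j → fold xs (λ i → f i j))
  fold-big []       n f = sym (big-ε n)
  fold-big (x ∷ xs) n f =
    CommutativeMonoid.trans M (∙-congˡ (fold-big xs n f)) (sym (big-∙ n (f x) (λ j → fold xs (λ i → f i j))))

binom-absorption : ∀ n k → suc k ℕ.* (suc n binom suc k) ≡ suc n ℕ.* (n binom k)
binom-absorption zero zero    = ≡.refl
binom-absorption zero (suc k) = ≡.trans (≡.cong (suc (suc k) ℕ.*_) (k>n⇒nCk≡0 {1} {suc (suc k)} (ℕ.s<s ℕ.z<s)))
  (≡.trans (ℕₚ.*-zeroʳ (suc (suc k))) (≡.sym (≡.trans (ℕₚ.+-identityʳ _) (k>n⇒nCk≡0 {0} {suc k} ℕ.z<s))))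
binom-absorption n@(suc m) k = begin
  suc k ℕ.* (suc n binom suc k)                       ≡⟨ ≡.cong (suc k ℕ.*_) (nCk+nC[k+1]≡[n+1]C[k+1] n k) ⟨
  suc k ℕ.* (n binom k ℕ.+ n binom suc k)                 ≡⟨ ℕₚ.*-distribˡ-+ (suc k) (n binom k) _ ⟩
  suc k ℕ.* (n binom k) ℕ.+ suc k ℕ.* (n binom suc k)     ≡⟨ ≡.cong (suc k ℕ.* (n binom k) ℕ.+_) (binom-absorption m k) ⟩
  (n binom k ℕ.+ k ℕ.* (n binom k)) ℕ.+ n ℕ.* (m binom k)     ≡⟨ ℕₚ.+-assoc (n binom k) _ _ ⟩
  n binom k ℕ.+ (k ℕ.* (n binom k) ℕ.+ n ℕ.* (m binom k))     ≡⟨ ≡.cong (n binom k ℕ.+_) (split k) ⟩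
  suc n ℕ.* (n binom k)                               ∎
  where
  open ≡.≡-Reasoning
  binom-0 : ∀ l → l binom 0 ≡ 1
  binom-0 l = ≡.trans (nCk≡nC[n∸k] {0} {l} ℕ.z≤n) (nCn≡1 l)
  split : ∀ k → k ℕ.* (n binom k) ℕ.+ n ℕ.* (m binom k) ≡ n ℕ.* (n binom k)
  split zero    = ≡.cong (n ℕ.*_) (≡.trans (binom-0 m) (≡.sym (binom-0 n)))
  split (suc k) = begin
    suc k ℕ.* (n binom suc k) ℕ.+ n ℕ.* (m binom suc k)   ≡⟨ ≡.cong (ℕ._+ n ℕ.* (m binom suc k)) (binom-absorption m k) ⟩
    n ℕ.* (m binom k) ℕ.+ n ℕ.* (m binom suc k)           ≡⟨ ℕₚ.*-distribˡ-+ n (m binom k) _ ⟨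
    n ℕ.* (m binom k ℕ.+ m binom suc k)                   ≡⟨ ≡.cong (n ℕ.*_) (nCk+nC[k+1]≡[n+1]C[k+1] m k) ⟩
    n ℕ.* (n binom suc k)                             ∎

prime∣binom : ∀ {q k} → Prime (suc q) → k ℕ.< q → suc q ℕD.∣ (suc q binom suc k)
prime∣binom {q} {k} pq k<q
  with euclidsLemma (suc k) (suc q binom suc k) pq
         (≡.subst (suc q ℕD.∣_) (≡.sym (binom-absorption q k)) (ℕD.m∣m*n (q binom k)))
... | inj₁ q∣k = contradiction (ℕD.∣⇒≤ q∣k) (ℕₚ.<⇒≱ (ℕ.s<s k<q))
... | inj₂ q∣C = q∣C

record Ringℤ : Set₁ where
  field
    commRing : CommutativeRing 0ℓ 0ℓ
  open CommutativeRing commRing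
  field
    ι     : ℤ → Carrier
    ι-+   : ∀ a b → ι (a ℤ.+ b) ≈ ι a + ι b
    ι-*   : ∀ a b → ι (a ℤ.* b) ≈ ι a * ι b
    ι-neg : ∀ a → ι (ℤ.- a) ≈ - ι a
    ι-0   : ι (+ 0) ≈ 0#
    ι-1   : ι (+ 1) ≈ 1#

module Kit (S : Ringℤ) where
  open Ringℤ S public
  open CommutativeRing commRing public hiding (zero)
  open import Algebra.Properties.Ring ring public
    using (-‿distribˡ-*; -‿distribʳ-*; -0#≈0#; -1*x≈-x)
  open import Algebra.Properties.CommutativeSemiring.Exp commutativeSemiring public
  open import Relation.Binary.Reasoning.Setoid setoid public
  open import Algebra.Properties.CommutativeMonoid.Sum +-commutativeMonoid using (sum; sum-init-last; sum-cong-≋)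
  open import Algebra.Properties.Semiring.Sum semiring using (*-distribˡ-sum)
  import Algebra.Properties.CommutativeSemiring.Binomial commutativeSemiring as Bin
  open import Algebra.Definitions.RawMonoid +-rawMonoid using () renaming (_×_ to _×′_)

  open BigOp +-commutativeMonoid public using () renaming
    ( big to Σ; big-cong to Σ-cong; big-∙ to Σ-+; big-ε to Σ-0; big-comm to Σ-comm
    ; big-last to Σ-last; big-+ to Σ-split; big-* to Σ-blocks; big-shift to Σ-shift
    ; fold to Σₗ; fold-cong to Σₗ-cong; fold-↭ to Σₗ-↭; fold-++ to Σₗ-++; fold-map to Σₗ-map
    ; fold-upTo to Σₗ-upTo; fold-big to Σₗ-Σ )
  open BigOp *-commutativeMonoid public using () renaming
    ( big to Π; big-cong to Π-cong
    ; fold to Πₗ; fold-cong to Πₗ-cong; fold-↭ to Πₗ-↭; fold-++ to Πₗ-++; fold-map to Πₗ-map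
    ; fold-upTo to Πₗ-upTo; fold-∙ to Πₗ-* )

  private
    morphism : CommutativeRing.rawRing ℤₚ.+-*-commutativeRing
               -Raw-AlmostCommutative⟶ fromCommutativeRing commRing
    morphism = record
      { ⟦_⟧ = ι ; +-homo = ι-+ ; *-homo = ι-* ; -‿homo = ι-neg ; 0-homo = ι-0 ; 1-homo = ι-1 }
    ι-≟ : ∀ a b → Maybe (ι a ≈ ι b)
    ι-≟ a b with a ℤ.≟ b
    ... | yes a≡b = just (reflexive (≡.cong ι a≡b))
    ... | no _    = nothing

  open import Algebra.Solver.Ring _ _ morphism ι-≟ public
    using (solve; _:=_; _:+_; _:*_; _:-_; :-_; con)

  ιℕ : ℕ → Carrier
  ιℕ k = ι (+ k)

  ι-Σ : ∀ n f → ι (BigOp.big ℤₚ.+-0-commutativeMonoid n f) ≈ Σ n (ι ∘ f)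
  ι-Σ zero    f = ι-0
  ι-Σ (suc n) f = trans (ι-+ (f 0) _) (+-congˡ (ι-Σ n (f ∘ suc)))

  1^ : ∀ k → 1# ^ k ≈ 1#
  1^ zero    = refl
  1^ (suc k) = trans (*-identityˡ _) (1^ k)

  ιℕ-^ : ∀ a k → ιℕ (a ℕ.^ k) ≈ ιℕ a ^ k
  ιℕ-^ a zero    = ι-1
  ιℕ-^ a (suc k) = begin
    ι (+ (a ℕ.* a ℕ.^ k))      ≡⟨ ≡.cong ι (ℤₚ.pos-* a (a ℕ.^ k)) ⟩
    ι (+ a ℤ.* + (a ℕ.^ k))    ≈⟨ ι-* _ _ ⟩
    ιℕ a * ιℕ (a ℕ.^ k)        ≈⟨ *-congˡ (ιℕ-^ a k) ⟩
    ιℕ a ^ suc k               ∎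

  ι-^ : ∀ a k → ι (a ℤ.^ k) ≈ ι a ^ k
  ι-^ a zero    = ι-1
  ι-^ a (suc k) = trans (ι-* a (a ℤ.^ k)) (*-congˡ (ι-^ a k))

  Σ-*ˡ : ∀ n c f → c * Σ n f ≈ Σ n (λ k → c * f k)
  Σ-*ˡ n c f = *-distribˡ-sum {n} c (λ i → f (toℕ i))

  Σ-*ʳ : ∀ n c f → Σ n f * c ≈ Σ n (λ k → f k * c)
  Σ-*ʳ n c f = trans (*-comm _ c) (trans (Σ-*ˡ n c f) (Σ-cong n λ k _ → *-comm c (f k)))

  Σ-const : ∀ n x → Σ n (λ _ → x) ≈ ιℕ n * x
  Σ-const zero    x = sym (trans (*-congʳ ι-0) (zeroˡ x))
  Σ-const (suc n) x = begin
    x + Σ n (λ _ → x)        ≈⟨ +-congˡ (Σ-const n x) ⟩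
    x + ιℕ n * x             ≈⟨ solve 2 (λ x n → x :+ n :* x := (con (+ 1) :+ n) :* x) refl x (ιℕ n) ⟩
    (ι (+ 1) + ιℕ n) * x     ≈⟨ *-congʳ (ι-+ (+ 1) (+ n)) ⟨
    ιℕ (suc n) * x           ∎

  Σ-neg : ∀ n f → Σ n (λ k → - f k) ≈ - Σ n f
  Σ-neg n f = begin
    Σ n (λ k → - f k)          ≈⟨ Σ-cong n (λ k _ → -1*x≈-x (f k)) ⟨
    Σ n (λ k → - 1# * f k)     ≈⟨ Σ-*ˡ n (- 1#) f ⟨
    - 1# * Σ n f               ≈⟨ -1*x≈-x _ ⟩
    - Σ n f                    ∎

  Σₗ-*ˡ : ∀ xs c f → c * Σₗ xs f ≈ Σₗ xs (λ k → c * f k)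
  Σₗ-*ˡ []       c f = zeroʳ c
  Σₗ-*ˡ (x ∷ xs) c f = trans (distribˡ c _ _) (+-congˡ (Σₗ-*ˡ xs c f))

  Σₗ-const : ∀ (xs : List ℕ) x → Σₗ xs (λ _ → x) ≈ ιℕ (length xs) * x
  Σₗ-const []       x = sym (trans (*-congʳ ι-0) (zeroˡ x))
  Σₗ-const (_ ∷ xs) x = begin
    x + Σₗ xs (λ _ → x)      ≈⟨ +-congˡ (Σₗ-const xs x) ⟩
    x + ιℕ (length xs) * x   ≈⟨ solve 2 (λ x n → x :+ n :* x := (con (+ 1) :+ n) :* x) refl x _ ⟩
    (ι (+ 1) + ιℕ (length xs)) * x  ≈⟨ *-congʳ (ι-+ (+ 1) (+ length xs)) ⟨
    ιℕ (suc (length xs)) * x ∎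

  Πₗ-const : ∀ (xs : List ℕ) x → Πₗ xs (λ _ → x) ≈ x ^ length xs
  Πₗ-const []       x = refl
  Πₗ-const (_ ∷ xs) x = *-congˡ (Πₗ-const xs x)

  infix 4 _≡_[mod_] _∣_

  record _∣_ (d x : Carrier) : Set where
    constructor divides
    field
      quotient : Carrier
      equality : x ≈ d * quotient

  _≡_[mod_] : Carrier → Carrier → Carrier → Set
  x ≡ y [mod d ] = d ∣ (x - y)

  ∣-respʳ : ∀ {d x y} → x ≈ y → d ∣ x → d ∣ y
  ∣-respʳ x≈y (divides z e) = divides z (trans (sym x≈y) e)

  ∣-respˡ : ∀ {d e x} → d ≈ e → d ∣ x → e ∣ x
  ∣-respˡ d≈e (divides z e) = divides z (trans e (*-congʳ d≈e))

  ∣-refl : ∀ {x} → x ∣ x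
  ∣-refl = divides 1# (sym (*-identityʳ _))

  ∣-trans : ∀ {x y z} → x ∣ y → y ∣ z → x ∣ z
  ∣-trans (divides a e) (divides b e′) =
    divides (a * b) (trans e′ (trans (*-congʳ e) (*-assoc _ a b)))

  ∣-0 : ∀ {d} → d ∣ 0#
  ∣-0 = divides 0# (sym (zeroʳ _))

  ∣-+ : ∀ {d x y} → d ∣ x → d ∣ y → d ∣ x + y
  ∣-+ (divides a e) (divides b e′) = divides (a + b) (trans (+-cong e e′) (sym (distribˡ _ a b)))

  ∣-*ˡ : ∀ {d x} y → d ∣ x → d ∣ y * x
  ∣-*ˡ {d} y (divides a e) = divides (y * a)
    (trans (*-congˡ e) (solve 3 (λ y d a → y :* (d :* a) := d :* (y :* a)) refl y d a))

  ∣-*ʳ : ∀ {d x} y → d ∣ x → d ∣ x * y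
  ∣-*ʳ y d∣x = ∣-respʳ (*-comm y _) (∣-*ˡ y d∣x)

  ∣-neg : ∀ {d x} → d ∣ x → d ∣ - x
  ∣-neg d∣x = ∣-respʳ (-1*x≈-x _) (∣-*ˡ (- 1#) d∣x)

  *-pres-∣ : ∀ {a b x y} → a ∣ x → b ∣ y → a * b ∣ x * y
  *-pres-∣ {a} {b} (divides u e) (divides v e′) = divides (u * v)
    (trans (*-cong e e′) (solve 4 (λ a b u v → (a :* u) :* (b :* v) := (a :* b) :* (u :* v)) refl a b u v))

  ∣-^ : ∀ d k → 0 ℕ.< k → d ∣ d ^ k
  ∣-^ d (suc k) _ = ∣-*ʳ (d ^ k) ∣-refl

  ^-pres-∣ : ∀ {d x} → d ∣ x → ∀ k → d ^ k ∣ x ^ k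
  ^-pres-∣ d∣x zero    = ∣-refl
  ^-pres-∣ d∣x (suc k) = *-pres-∣ d∣x (^-pres-∣ d∣x k)

  ∣-Σ : ∀ {d} n {f} → (∀ k → k ℕ.< n → d ∣ f k) → d ∣ Σ n f
  ∣-Σ zero    h = ∣-0
  ∣-Σ (suc n) h = ∣-+ (h 0 ℕ.z<s) (∣-Σ n λ k k<n → h (suc k) (ℕ.s<s k<n))

  ∣-Πₗ : ∀ {d x} {xs} {f} → x ∈ xs → d ∣ f x → d ∣ Πₗ xs f
  ∣-Πₗ (here ≡.refl) h = ∣-*ʳ _ h
  ∣-Πₗ (there x∈)    h = ∣-*ˡ _ (∣-Πₗ x∈ h)

  mod-reflexive : ∀ {d x y} → x ≈ y → x ≡ y [mod d ]
  mod-reflexive x≈y = ∣-respʳ (trans (sym (-‿inverseʳ _)) (+-congˡ (-‿cong x≈y))) ∣-0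

  mod-refl : ∀ {d x} → x ≡ x [mod d ]
  mod-refl = mod-reflexive refl

  mod-sym : ∀ {d x y} → x ≡ y [mod d ] → y ≡ x [mod d ]
  mod-sym {x = x} {y} h = ∣-respʳ (solve 2 (λ x y → :- (x :- y) := y :- x) refl x y) (∣-neg h)

  mod-trans : ∀ {d x y z} → x ≡ y [mod d ] → y ≡ z [mod d ] → x ≡ z [mod d ]
  mod-trans {x = x} {y} {z} h h′ =
    ∣-respʳ (solve 3 (λ x y z → (x :- y) :+ (y :- z) := x :- z) refl x y z) (∣-+ h h′)

  mod-+ : ∀ {d x y u v} → x ≡ y [mod d ] → u ≡ v [mod d ] → x + u ≡ y + v [mod d ]
  mod-+ {x = x} {y} {u} {v} h h′ = ∣-respʳ
    (solve 4 (λ x y u v → (x :- y) :+ (u :- v) := (x :+ u) :- (y :+ v)) refl x y u v) (∣-+ h h′)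

  mod-neg : ∀ {d x y} → x ≡ y [mod d ] → - x ≡ - y [mod d ]
  mod-neg {x = x} {y} h = ∣-respʳ
    (solve 2 (λ x y → :- (x :- y) := (:- x) :- (:- y)) refl x y) (∣-neg h)

  mod-* : ∀ {d x y u v} → x ≡ y [mod d ] → u ≡ v [mod d ] → x * u ≡ y * v [mod d ]
  mod-* {x = x} {y} {u} {v} h h′ = ∣-respʳ
    (solve 4 (λ x y u v → (x :- y) :* u :+ y :* (u :- v) := x :* u :- y :* v) refl x y u v)
    (∣-+ (∣-*ʳ u h) (∣-*ˡ y h′))

  mod-^ : ∀ {d x y} → x ≡ y [mod d ] → ∀ k → x ^ k ≡ y ^ k [mod d ]
  mod-^ h zero    = mod-refl
  mod-^ h (suc k) = mod-* h (mod-^ h k)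

  mod-Πₗ : ∀ {d} xs {f g} → (∀ {x} → x ∈ xs → f x ≡ g x [mod d ]) → Πₗ xs f ≡ Πₗ xs g [mod d ]
  mod-Πₗ []       h = mod-refl
  mod-Πₗ (x ∷ xs) h = mod-* (h (here ≡.refl)) (mod-Πₗ xs (h ∘ there))

  mod-Πₗ-const : ∀ {d} xs {f} y → (∀ {x} → x ∈ xs → f x ≡ y [mod d ]) →
    Πₗ xs f ≡ y ^ length xs [mod d ]
  mod-Πₗ-const xs y h = mod-trans (mod-Πₗ xs h) (mod-reflexive (Πₗ-const xs y))

  mod-weaken : ∀ {c d x y} → c ∣ d → x ≡ y [mod d ] → x ≡ y [mod c ]
  mod-weaken = ∣-trans

  mod-∣ : ∀ {d x y} → x ≡ y [mod d ] → d ∣ x → d ∣ y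
  mod-∣ {x = x} {y} h d∣x =
    ∣-respʳ (solve 2 (λ x y → x :+ (:- (x :- y)) := y) refl x y) (∣-+ d∣x (∣-neg h))

  0≡mod : ∀ {d x} → d ∣ x → x ≡ 0# [mod d ]
  0≡mod d∣x = ∣-respʳ (trans (sym (+-identityʳ _)) (+-congˡ (sym -0#≈0#))) d∣x

  1-x∣1-x^n : ∀ x n → 1# - x ∣ 1# - x ^ n
  1-x∣1-x^n x zero    = ∣-respʳ (sym (-‿inverseʳ 1#)) ∣-0
  1-x∣1-x^n x (suc n) = ∣-respʳ
    (begin
      (1# - x) + x * (1# - x ^ n)  ≈⟨ +-congˡ (distribˡ x _ _) ⟩
      (1# - x) + (x * 1# + x * (- (x ^ n)))  ≈⟨ +-congˡ (+-cong (*-identityʳ x) (sym (-‿distribʳ-* _ _))) ⟩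
      (1# - x) + (x - x ^ suc n)   ≈⟨ solve 3 (λ o x y → (o :- x) :+ (x :- y) := o :- y) refl 1# x (x ^ suc n) ⟩
      1# - x ^ suc n               ∎)
    (∣-+ ∣-refl (∣-*ˡ x (1-x∣1-x^n x n)))

  ιℕ-∣ : ∀ {a b} → a ℕD.∣ b → ιℕ a ∣ ιℕ b
  ιℕ-∣ {a} (ℕD.divides c ≡.refl) = divides (ιℕ c)
    (trans (reflexive (≡.cong ι (≡.trans (≡.cong +_ (ℕₚ.*-comm c a)) (ℤₚ.pos-* a c)))) (ι-* (+ a) (+ c)))

  ×′≈ι* : ∀ n x → n ×′ x ≈ ιℕ n * x
  ×′≈ι* zero    x = sym (trans (*-congʳ ι-0) (zeroˡ x))
  ×′≈ι* (suc n) x = begin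
    x + n ×′ x                  ≈⟨ +-cong (sym (*-identityˡ x)) (×′≈ι* n x) ⟩
    1# * x + ιℕ n * x           ≈⟨ distribʳ x 1# (ιℕ n) ⟨
    (1# + ιℕ n) * x             ≈⟨ *-congʳ (trans (+-congʳ (sym ι-1)) (sym (ι-+ (+ 1) (+ n)))) ⟩
    ιℕ (suc n) * x              ∎

  -- All inner binomial coefficients of a prime exponent vanish modulo it.
  [x+y]^q≡x^q+y^q : ∀ {q} → Prime q → ∀ x y → (x + y) ^ q ≡ x ^ q + y ^ q [mod ιℕ q ]
  [x+y]^q≡x^q+y^q {zero}  ()
  [x+y]^q≡x^q+y^q {suc q} pq x y = mod-trans (mod-reflexive expand)
    (mod-trans (mod-+ mod-refl (mod-+ (0≡mod (∣-sum q middle λ i → middle-∣ i)) mod-refl))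
      (mod-reflexive collect))
    where
    t : Fin (suc (suc q)) → Carrier
    t = Bin.binomialTerm x y (suc q)
    middle : Fin q → Carrier
    middle i = t (suc (Fin.inject₁ i))
    expand : (x + y) ^ suc q ≈ t zero + (sum middle + t (Fin.fromℕ (suc q)))
    expand = trans (Bin.theorem (suc q) x y) (+-congˡ (sum-init-last (λ i → t (suc i))))
    ∣-sum : ∀ {d} n (f : Fin n → Carrier) → (∀ i → d ∣ f i) → d ∣ sum f
    ∣-sum zero    f h = ∣-0
    ∣-sum (suc n) f h = ∣-+ (h zero) (∣-sum n (f ∘ suc) (h ∘ suc))
    middle-∣ : ∀ i → ιℕ (suc q) ∣ middle i
    middle-∣ i = ∣-respʳ (sym (×′≈ι* _ _))
      (∣-*ʳ _ (ιℕ-∣ (prime∣binom pq (≡.subst (ℕ._< q) (≡.sym (Finₚ.toℕ-inject₁ i)) (Finₚ.toℕ<n i)))))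
    t-first : t zero ≈ y ^ suc q
    t-first = begin
      (suc q binom 0) ×′ (1# * y ^ suc q)  ≡⟨ ≡.cong (_×′ (1# * y ^ suc q)) (≡.trans (nCk≡nC[n∸k] {0} {suc q} ℕ.z≤n) (nCn≡1 (suc q))) ⟩
      1# * y ^ suc q + 0#              ≈⟨ trans (+-identityʳ _) (*-identityˡ _) ⟩
      y ^ suc q                        ∎
    t-last : t (Fin.fromℕ (suc q)) ≈ x ^ suc q
    t-last rewrite Finₚ.toℕ-fromℕ q | nCn≡1 (suc q) | ℕₚ.n∸n≡0 q =
      trans (+-identityʳ _) (*-identityʳ _)
    collect : t zero + (0# + t (Fin.fromℕ (suc q))) ≈ x ^ suc q + y ^ suc q
    collect = trans (+-cong t-first (trans (+-identityˡ _) t-last)) (+-comm _ _)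

  fermat : ∀ {q} → Prime q → ∀ a → ι a ^ q ≡ ι a [mod ιℕ q ]
  fermat {zero}  ()
  fermat {suc q} pq (+ n) = pos n
    where
    pos : ∀ n → ιℕ n ^ suc q ≡ ιℕ n [mod ιℕ (suc q) ]
    pos zero    = mod-reflexive (trans (*-congʳ ι-0) (trans (zeroˡ _) (sym ι-0)))
    pos (suc n) = mod-trans (mod-reflexive (^-congˡ (suc q) (ι-+ (+ 1) (+ n))))
      (mod-trans ([x+y]^q≡x^q+y^q pq _ _)
        (mod-trans (mod-+ (mod-reflexive (trans (^-congˡ (suc q) ι-1) (trans (1^ (suc q)) (sym ι-1)))) (pos n))
          (mod-reflexive (sym (ι-+ (+ 1) (+ n))))))
  fermat {suc q} pq a@(ℤ.-[1+ n ]) =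
    ∣-respʳ step (mod-neg (mod-trans ([x+y]^q≡x^q+y^q pq b (ι a)) (mod-+ (fermat pq (+ suc n)) mod-refl)))
    where
    b : Carrier
    b = ι (+ suc n)
    b+a : b + ι a ≈ 0#
    b+a = trans (sym (ι-+ (+ suc n) a)) (trans (reflexive (≡.cong ι (ℤₚ.+-inverseʳ (+ suc n)))) ι-0)
    step : - ((b + ι a) ^ suc q) - - (b + ι a ^ suc q) ≈ ι a ^ suc q - ι a
    step = begin
      - ((b + ι a) ^ suc q) - - (b + ι a ^ suc q)
        ≈⟨ +-congʳ (-‿cong (trans (*-congʳ b+a) (zeroˡ _))) ⟩
      - 0# - - (b + ι a ^ suc q)
        ≈⟨ +-congʳ (-‿cong (sym b+a)) ⟩
      - (b + ι a) - - (b + ι a ^ suc q)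
        ≈⟨ solve 3 (λ b a c → :- (b :+ a) :- (:- (b :+ c)) := c :- a) refl b (ι a) (ι a ^ suc q) ⟩
      ι a ^ suc q - ι a ∎

  private
    geom : Carrier → Carrier → ℕ → Carrier
    geom x y zero    = 0#
    geom x y (suc n) = x * geom x y n + y ^ n

    x^n-y^n : ∀ x y n → x ^ n - y ^ n ≈ (x - y) * geom x y n
    x^n-y^n x y zero    = trans (-‿inverseʳ 1#) (sym (zeroʳ _))
    x^n-y^n x y (suc n) = begin
      x * x ^ n - y * y ^ n
        ≈⟨ solve 4 (λ x y a b → x :* a :- y :* b := x :* (a :- b) :+ (x :- y) :* b) refl x y (x ^ n) (y ^ n) ⟩
      x * (x ^ n - y ^ n) + (x - y) * y ^ n
        ≈⟨ +-congʳ (*-congˡ (x^n-y^n x y n)) ⟩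
      x * ((x - y) * geom x y n) + (x - y) * y ^ n
        ≈⟨ solve 4 (λ x y a b → x :* ((x :- y) :* a) :+ (x :- y) :* b := (x :- y) :* (x :* a :+ b)) refl x y _ _ ⟩
      (x - y) * geom x y (suc n) ∎

    geom≡n*y^ : ∀ x y n → geom x y (suc n) ≡ ιℕ (suc n) * y ^ n [mod x - y ]
    geom≡n*y^ x y zero    = mod-reflexive
      (trans (+-congʳ (zeroʳ x)) (trans (+-identityˡ _) (sym (trans (*-identityʳ _) ι-1))))
    geom≡n*y^ x y (suc n) = mod-trans (mod-+ (mod-* {y = y} ∣-refl (geom≡n*y^ x y n)) mod-refl)
      (mod-reflexive (begin
        y * (ιℕ (suc n) * y ^ n) + y * y ^ n
          ≈⟨ solve 3 (λ y m b → y :* (m :* b) :+ y :* b := (con (+ 1) :+ m) :* (y :* b)) refl y (ιℕ (suc n)) (y ^ n) ⟩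
        (ι (+ 1) + ιℕ (suc n)) * y ^ suc n
          ≈⟨ *-congʳ (ι-+ (+ 1) (+ suc n)) ⟨
        ιℕ (suc (suc n)) * y ^ suc n ∎))

  mod-lift : ∀ q k {x y} → x ≡ y [mod ιℕ q ^ suc k ] → x ^ q ≡ y ^ q [mod ιℕ q ^ suc (suc k) ]
  mod-lift zero    k h = mod-refl
  mod-lift (suc q) k {x} {y} h = ∣-respʳ (sym (x^n-y^n x y (suc q)))
    (∣-respˡ (*-comm _ _) (*-pres-∣ h
      (mod-∣ (mod-sym (mod-weaken (∣-trans (∣-*ʳ _ ∣-refl) h) (geom≡n*y^ x y q))) (∣-*ʳ _ ∣-refl))))

  geometric : ∀ y n → (1# - y) * Σ n (y ^_) ≈ 1# - y ^ n
  geometric y zero    = trans (zeroʳ _) (sym (-‿inverseʳ 1#))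
  geometric y (suc n) = begin
    (1# - y) * Σ (suc n) (y ^_)                ≈⟨ *-congˡ (Σ-last n (y ^_)) ⟩
    (1# - y) * (Σ n (y ^_) + y ^ n)            ≈⟨ distribˡ _ _ _ ⟩
    (1# - y) * Σ n (y ^_) + (1# - y) * y ^ n   ≈⟨ +-cong (geometric y n)
                                                   (trans (distribʳ _ _ _) (+-cong (*-identityˡ _) (sym (-‿distribˡ-* _ _)))) ⟩
    (1# - y ^ n) + (y ^ n - y * y ^ n)         ≈⟨ solve 3 (λ o a b → (o :- a) :+ (a :- b) := o :- b) refl 1# (y ^ n) (y ^ suc n) ⟩
    1# - y ^ suc n                             ∎

  x-y≈0⇒x≈y : ∀ {x y} → x - y ≈ 0# → x ≈ y
  x-y≈0⇒x≈y {x} {y} h =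
    trans (solve 2 (λ x y → x := (x :- y) :+ y) refl x y) (trans (+-congʳ h) (+-identityˡ y))

  Regular : Carrier → Set
  Regular x = ∀ y → x * y ≈ 0# → y ≈ 0#

  regular-∣ : ∀ {x y} → x ∣ y → Regular y → Regular x
  regular-∣ {x} {y} (divides z e) reg w h = reg w (begin
    y * w         ≈⟨ *-congʳ e ⟩
    x * z * w     ≈⟨ solve 3 (λ x z w → x :* z :* w := z :* (x :* w)) refl x z w ⟩
    z * (x * w)   ≈⟨ trans (*-congˡ h) (zeroʳ z) ⟩
    0#            ∎)

  regular-cancelˡ : ∀ {x y z} → Regular x → x * y ≈ x * z → y ≈ z
  regular-cancelˡ {x} {y} {z} reg h = x-y≈0⇒x≈y (reg (y - z) (begin
    x * (y - z)       ≈⟨ solve 3 (λ x y z → x :* (y :- z) := x :* y :- x :* z) refl x y z ⟩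
    x * y - x * z     ≈⟨ trans (+-congʳ h) (-‿inverseʳ _) ⟩
    0#                ∎))

  Σ-single : ∀ n {f k} → k ℕ.< n → (∀ j → j ℕ.< n → j ≢ k → f j ≈ 0#) → Σ n f ≈ f k
  Σ-single (suc n) {f} {zero}  _ h = trans (+-congˡ (trans
    (Σ-cong n (λ j j<n → h (suc j) (ℕ.s<s j<n) λ ())) (Σ-0 n))) (+-identityʳ (f 0))
  Σ-single (suc n) {f} {suc k} k<n h = trans (+-cong (h 0 ℕ.z<s λ ())
    (Σ-single n (ℕ.s<s⁻¹ k<n) λ j j<n ne → h (suc j) (ℕ.s<s j<n) (ne ∘ ℕₚ.suc-injective))) (+-identityˡ (f (suc k)))

  regular-resp : ∀ {x y} → x ≈ y → Regular x → Regular y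
  regular-resp x≈y reg w h = reg w (trans (*-congʳ x≈y) h)

module Determinant (S : Ringℤ) where
  open Kit S
  open import Algebra.Properties.Semiring.Sum semiring
    using (sum; sum-cong-≋; ∑-distrib-+; *-distribˡ-sum; sum-replicate-zero)

  Row : ℕ → Set
  Row m = Fin m → Carrier

  Rows : ℕ → ℕ → Set
  Rows n m = Vec (Row m) n

  _≗_ : ∀ {m} → Row m → Row m → Set
  u ≗ v = ∀ i → u i ≈ v i

  sum-0 : ∀ {n} {f : Row n} → (∀ i → f i ≈ 0#) → sum f ≈ 0#
  sum-0 {n} h = trans (sum-cong-≋ h) (sum-replicate-zero n)

  record IsLinear {m} (L : Row m → Carrier) : Set where
    field
      respects  : ∀ {u v} → u ≗ v → L u ≈ L v
      add   : ∀ u v → L (λ i → u i + v i) ≈ L u + L v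
      scale : ∀ c u → L (λ i → c * u i) ≈ c * L u

  record IsLinearMap {m l} (h : Row m → Row l) : Set where
    field
      respects  : ∀ {u v} → u ≗ v → h u ≗ h v
      add   : ∀ u v → h (λ i → u i + v i) ≗ (λ i → h u i + h v i)
      scale : ∀ c u → h (λ i → c * u i) ≗ (λ i → c * h u i)

  Adjacent : ∀ n m → (Rows n m → Carrier) → Set
  Adjacent (suc (suc n)) m E = ∀ v rs → E (v ∷ v ∷ rs) ≈ 0#
  Adjacent _             m E = ⊤

  Alternating : ∀ n m → (Rows n m → Carrier) → Set
  Alternating zero    m E = ⊤
  Alternating (suc n) m E =
    (∀ rs → IsLinear (λ v → E (v ∷ rs))) ×
    (∀ v → Alternating n m (λ rs → E (v ∷ rs))) ×
    Adjacent (suc n) m E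

  Alternating-cong : ∀ n m {E} → Alternating n m E → ∀ {rs ss} → Pointwise _≗_ rs ss → E rs ≈ E ss
  Alternating-cong zero    m alt [] = refl
  Alternating-cong (suc n) m (lin , tl , _) {r ∷ rs} {s ∷ ss} (e ∷ es) =
    trans (IsLinear.respects (lin rs) e) (Alternating-cong n m (tl s) es)

  Alternating-map : ∀ n m l {E} {h : Row l → Row m} → IsLinearMap h →
    Alternating n m E → Alternating n l (λ rs → E (mapV h rs))
  Alternating-map zero    m l lh alt = tt
  Alternating-map (suc n) m l {E} {h} lh (lin , tl , adj) =
    (λ rs → let open IsLinear (lin (mapV h rs)) renaming (respects to c; add to a; scale to s) in record
      { respects = λ e → c (IsLinearMap.respects lh e)
      ; add   = λ u v → trans (c (IsLinearMap.add lh u v)) (a _ _)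
      ; scale = λ x u → trans (c (IsLinearMap.scale lh x u)) (s x _) }) ,
    (λ v → Alternating-map n m l lh (tl (h v))) ,
    adjacent n adj
    where
    adjacent : ∀ n {E} → Adjacent (suc n) m E → Adjacent (suc n) l (λ rs → E (mapV h rs))
    adjacent zero    a = tt
    adjacent (suc n) a v rs = a (h v) (mapV h rs)

  Alternating-sum : ∀ n m {k} (c : Fin k → Carrier) (E : Fin k → Rows n m → Carrier) →
    (∀ j → Alternating n m (E j)) → Alternating n m (λ rs → sum (λ j → c j * E j rs))
  Alternating-sum zero    m c E alt = tt
  Alternating-sum (suc n) m {k} c E alt =
    (λ rs → let module L j = IsLinear (proj₁ (alt j) rs) in record
      { respects = λ e → sum-cong-≋ {k} λ j → *-congˡ (L.respects j e)
      ; add   = λ u v → trans (sum-cong-≋ {k} λ j → trans (*-congˡ (L.add j u v)) (distribˡ _ _ _))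
                              (∑-distrib-+ {k} _ _)
      ; scale = λ x u → trans (sum-cong-≋ {k} λ j → trans (*-congˡ (L.scale j x u))
                                (solve 3 (λ c x e → c :* (x :* e) := x :* (c :* e)) refl (c j) x (E j (u ∷ rs))))
                              (sym (*-distribˡ-sum {k} x _)) }) ,
    (λ v → Alternating-sum n m c (λ j rs → E j (v ∷ rs)) (λ j → proj₁ (proj₂ (alt j)) v)) ,
    adjacent n (λ j → proj₂ (proj₂ (alt j)))
    where
    adjacent : ∀ n {E : Fin _ → Rows (suc n) m → Carrier} → (∀ j → Adjacent (suc n) m (E j)) →
      Adjacent (suc n) m (λ rs → sum (λ j → c j * E j rs))
    adjacent zero    a = tt
    adjacent (suc n) a v rs = sum-0 {k} λ j → trans (*-congˡ (a j v rs)) (zeroʳ _)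

  swap-rows : ∀ n m {E} → Alternating (suc (suc n)) m E → ∀ u v rs →
    E (u ∷ v ∷ rs) ≈ - E (v ∷ u ∷ rs)
  swap-rows n m {E} (lin , tl , adj) u v rs = begin
    a                                    ≈⟨ +-identityˡ a ⟨
    0# + a                               ≈⟨ +-congʳ (adj (u ⊹ v) rs) ⟨
    E ((u ⊹ v) ∷ (u ⊹ v) ∷ rs) + a       ≈⟨ +-congʳ (IsLinear.add (lin _) u v) ⟩
    (E (u ∷ (u ⊹ v) ∷ rs) + E (v ∷ (u ⊹ v) ∷ rs)) + a
      ≈⟨ +-congʳ (+-cong (IsLinear.add (proj₁ (tl u) rs) u v) (IsLinear.add (proj₁ (tl v) rs) u v)) ⟩
    ((E (u ∷ u ∷ rs) + a) + (b + E (v ∷ v ∷ rs))) + a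
      ≈⟨ +-congʳ (+-cong (trans (+-congʳ (adj u rs)) (+-identityˡ a))
                         (trans (+-congˡ (adj v rs)) (+-identityʳ b))) ⟩
    (a + b) + a                          ≈⟨ +-congʳ a+b≈0 ⟩
    0# + a                               ≈⟨ +-congʳ (-‿inverseˡ b) ⟨
    (- b + b) + a                        ≈⟨ solve 2 (λ a b → (:- b :+ b) :+ a := :- b :+ (a :+ b)) refl a b ⟩
    - b + (a + b)                        ≈⟨ +-congˡ a+b≈0 ⟩
    - b + 0#                             ≈⟨ +-identityʳ _ ⟩
    - b                                  ∎
    where
    _⊹_ : Row m → Row m → Row m
    (x ⊹ y) i = x i + y i
    a = E (u ∷ v ∷ rs)
    b = E (v ∷ u ∷ rs)
    a+b≈0 : a + b ≈ 0#
    a+b≈0 = begin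
      a + b                                ≈⟨ +-cong (trans (+-congʳ (adj u rs)) (+-identityˡ a))
                                                     (trans (+-congˡ (adj v rs)) (+-identityʳ b)) ⟨
      (E (u ∷ u ∷ rs) + a) + (b + E (v ∷ v ∷ rs))
        ≈⟨ +-cong (IsLinear.add (proj₁ (tl u) rs) u v) (IsLinear.add (proj₁ (tl v) rs) u v) ⟨
      E (u ∷ (u ⊹ v) ∷ rs) + E (v ∷ (u ⊹ v) ∷ rs)
        ≈⟨ IsLinear.add (lin _) u v ⟨
      E ((u ⊹ v) ∷ (u ⊹ v) ∷ rs)           ≈⟨ adj (u ⊹ v) rs ⟩
      0#                                   ∎

  Kills : ∀ n {m} → Row m → (Rows n m → Carrier) → Set
  Kills zero    w F = ⊤
  Kills (suc n) w F = (∀ rs → F (w ∷ rs) ≈ 0#) × (∀ v → Kills n w (λ rs → F (v ∷ rs)))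

  Kills-neg : ∀ n {m} {w : Row m} {F G} → (∀ rs → G rs ≈ - F rs) → Kills n w F → Kills n w G
  Kills-neg zero    e k = tt
  Kills-neg (suc n) e (k , ks) =
    (λ rs → trans (e _) (trans (-‿cong (k rs)) -0#≈0#)) ,
    (λ v → Kills-neg n (λ rs → e (v ∷ rs)) (ks v))

  Alternating⇒Kills : ∀ n m {E} → Alternating (suc n) m E → ∀ w → Kills n w (λ rs → E (w ∷ rs))
  Alternating⇒Kills zero    m alt w = tt
  Alternating⇒Kills (suc n) m {E} alt@(_ , tl , adj) w =
    adj w ,
    (λ v → Kills-neg n (swap-rows n m {E} alt w v) (Alternating⇒Kills n m (tl v) w))

  reduce-rows : ∀ n m {F} {w : Row m} {h : Row m → Row m} {c : Row m → Carrier} →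
    Alternating n m F → Kills n w F → (∀ r → r ≗ (λ i → h r i + c r * w i)) →
    ∀ rs → F rs ≈ F (mapV h rs)
  reduce-rows zero    m alt k e [] = refl
  reduce-rows (suc n) m {F} {w} {h} {c} (lin , tl , _) (k , ks) e (r ∷ rs) = begin
    F (r ∷ rs)                                  ≈⟨ L.respects (e r) ⟩
    F ((λ i → h r i + c r * w i) ∷ rs)          ≈⟨ L.add (h r) _ ⟩
    F (h r ∷ rs) + F ((λ i → c r * w i) ∷ rs)   ≈⟨ +-congˡ (trans (L.scale (c r) w) (trans (*-congˡ (k rs)) (zeroʳ _))) ⟩
    F (h r ∷ rs) + 0#                           ≈⟨ +-identityʳ _ ⟩
    F (h r ∷ rs)                                ≈⟨ reduce-rows n m (tl (h r)) (ks (h r)) e rs ⟩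
    F (mapV h (r ∷ rs))                         ∎
    where module L = IsLinear (lin rs)

  basis : ∀ {m} → Fin m → Row m
  basis zero    zero    = 1#
  basis zero    (suc _) = 0#
  basis (suc _) zero    = 0#
  basis (suc i) (suc j) = basis i j

  sign : ∀ {n} → Fin n → Carrier
  sign zero    = 1#
  sign (suc j) = - sign j

  insert0 : ∀ {n} → Fin (suc n) → Row n → Row (suc n)
  insert0 zero    s zero    = 0#
  insert0 zero    s (suc i) = s i
  insert0 {suc n} (suc j) s zero    = s zero
  insert0 {suc n} (suc j) s (suc i) = insert0 j (s ∘ suc) i

  insert0-0 : ∀ {n} (j : Fin (suc n)) {s : Row n} → (∀ i → s i ≈ 0#) → ∀ i → insert0 j s i ≈ 0#
  insert0-0 zero    h zero    = refl
  insert0-0 zero    h (suc i) = h i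
  insert0-0 {suc n} (suc j) h zero    = h zero
  insert0-0 {suc n} (suc j) h (suc i) = insert0-0 j (h ∘ suc) i

  insert0-linear : ∀ {n} (j : Fin (suc n)) → IsLinearMap (insert0 j)
  insert0-linear j = record { respects = respects j ; add = add j ; scale = scale j }
    where
    respects : ∀ {n} (j : Fin (suc n)) {u v : Row n} → u ≗ v → insert0 j u ≗ insert0 j v
    respects zero    e zero    = refl
    respects zero    e (suc i) = e i
    respects {suc n} (suc j) e zero    = e zero
    respects {suc n} (suc j) e (suc i) = respects j (e ∘ suc) i
    add : ∀ {n} (j : Fin (suc n)) (u v : Row n) →
      insert0 j (λ i → u i + v i) ≗ (λ i → insert0 j u i + insert0 j v i)
    add zero    u v zero    = sym (+-identityˡ 0#)
    add zero    u v (suc i) = refl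
    add {suc n} (suc j) u v zero    = refl
    add {suc n} (suc j) u v (suc i) = add j (u ∘ suc) (v ∘ suc) i
    scale : ∀ {n} (j : Fin (suc n)) c (u : Row n) →
      insert0 j (λ i → c * u i) ≗ (λ i → c * insert0 j u i)
    scale zero    c u zero    = sym (zeroʳ c)
    scale zero    c u (suc i) = refl
    scale {suc n} (suc j) c u zero    = refl
    scale {suc n} (suc j) c u (suc i) = scale j c (u ∘ suc) i

  insert0-decompose : ∀ {n} (j : Fin (suc n)) (r : Row (suc n)) →
    r ≗ (λ i → insert0 j (r ∘ punchIn j) i + r j * basis j i)
  insert0-decompose zero r zero    = sym (trans (+-identityˡ _) (*-identityʳ _))
  insert0-decompose zero r (suc i) = sym (trans (+-congˡ (zeroʳ _)) (+-identityʳ _))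
  insert0-decompose {suc n} (suc j) r zero    = sym (trans (+-congˡ (zeroʳ _)) (+-identityʳ _))
  insert0-decompose {suc n} (suc j) r (suc i) = insert0-decompose j (r ∘ suc) i

  linear-expand : ∀ m {L} → IsLinear {m} L → ∀ r → L r ≈ sum (λ j → r j * L (basis j))
  linear-expand zero {L} lin r = begin
    L r                ≈⟨ IsLinear.respects lin (λ ()) ⟩
    L (λ i → 0# * r i) ≈⟨ IsLinear.scale lin 0# r ⟩
    0# * L r           ≈⟨ zeroˡ _ ⟩
    0#                 ∎
  linear-expand (suc m) {L} lin r = begin
    L r
      ≈⟨ respects (insert0-decompose zero r) ⟩
    L (λ i → insert0 zero (r ∘ suc) i + r zero * basis zero i)
      ≈⟨ add _ _ ⟩
    L (insert0 zero (r ∘ suc)) + L (λ i → r zero * basis zero i)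
      ≈⟨ +-cong (linear-expand m lin′ (r ∘ suc)) (scale (r zero) _) ⟩
    sum (λ j → r (suc j) * L (insert0 zero (basis j))) + r zero * L (basis zero)
      ≈⟨ +-comm _ _ ⟩
    r zero * L (basis zero) + sum (λ j → r (suc j) * L (insert0 zero (basis j)))
      ≈⟨ +-congˡ (sum-cong-≋ {m} λ j → *-congˡ (respects λ { zero → refl ; (suc i) → refl })) ⟩
    sum (λ j → r j * L (basis j)) ∎
    where
    open IsLinear lin
    module I = IsLinearMap (insert0-linear {m} zero)
    lin′ : IsLinear (λ s → L (insert0 zero s))
    lin′ = record
      { respects = λ e → respects (I.respects e)
      ; add   = λ u v → trans (respects (I.add u v)) (add _ _)
      ; scale = λ c u → trans (respects (I.scale c u)) (scale c _) }

  minor : ∀ {n m} → Fin (suc m) → Rows n (suc m) → Rows n m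
  minor j = mapV (_∘ punchIn j)

  detᵛ : ∀ {n} → Rows n n → Carrier
  detᵛ []       = 1#
  detᵛ (r ∷ rs) = sum (λ j → (sign j * r j) * detᵛ (minor j rs))

  private
    *-distribˡ-congˡ : ∀ n {x y} {f g : Row n} → (∀ k → x * f k ≈ y * g k) → x * sum f ≈ y * sum g
    *-distribˡ-congˡ n h = trans (*-distribˡ-sum {n} _ _)
      (trans (sum-cong-≋ {n} h) (sym (*-distribˡ-sum {n} _ _)))

  double-expansion : ∀ n (b : Row (suc (suc n))) (g : (Fin n → Fin (suc (suc n))) → Carrier) →
    (∀ {c d} → (∀ x → c x ≡ d x) → g c ≈ g d) →
    sum (λ j → (sign j * b j) *
      sum (λ k → (sign k * b (punchIn j k)) * g (λ x → punchIn j (punchIn k x)))) ≈ 0#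
  double-expansion n b g g-cong = begin
    (1# * b zero) * sum top + sum (λ j → c j * (left j + rest j))
      ≈⟨ +-cong (*-distribˡ-sum {suc n} (1# * b zero) top)
           (trans (sum-cong-≋ {suc n} λ j → distribˡ (c j) (left j) (rest j))
                  (∑-distrib-+ {suc n} (λ j → c j * left j) (λ j → c j * rest j))) ⟩
    sum (λ k → (1# * b zero) * top k) + (sum (λ j → c j * left j) + sum (λ j → c j * rest j))
      ≈⟨ +-assoc _ _ _ ⟨
    (sum (λ k → (1# * b zero) * top k) + sum (λ j → c j * left j)) + sum (λ j → c j * rest j)
      ≈⟨ +-cong (trans (sym (∑-distrib-+ {suc n} (λ k → (1# * b zero) * top k) (λ j → c j * left j)))
                       (sum-0 {suc n} cancel))
                (inner n b g g-cong) ⟩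
    0# + 0#  ≈⟨ +-identityˡ 0# ⟩
    0#       ∎
    where
    top left rest c : Fin (suc n) → Carrier
    top k  = (sign k * b (suc k)) * g (λ x → suc (punchIn k x))
    left j = (1# * b zero) * g (λ x → punchIn (suc j) (suc x))
    rest j = sum {n} (λ k → (- sign k * b (punchIn (suc j) (suc k))) * g (λ x → punchIn (suc j) (punchIn (suc k) x)))
    c j    = - sign j * b (suc j)
    cancel : ∀ k → (1# * b zero) * ((sign k * b (suc k)) * g (λ x → suc (punchIn k x))) +
                   (- sign k * b (suc k)) * ((1# * b zero) * g (λ x → suc (punchIn k x))) ≈ 0#
    cancel k = begin
      (1# * b zero) * ((sign k * b (suc k)) * G) + (- sign k * b (suc k)) * ((1# * b zero) * G)
        ≈⟨ solve 4 (λ o s b g → o :* ((s :* b) :* g) :+ (:- s :* b) :* (o :* g) := con (+ 0)) refl (1# * b zero) (sign k) (b (suc k)) G ⟩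
      ι (+ 0)  ≈⟨ ι-0 ⟩
      0#       ∎
      where G = g (λ x → suc (punchIn k x))
    inner : ∀ n (b : Row (suc (suc n))) (g : (Fin n → Fin (suc (suc n))) → Carrier) →
      (∀ {c d} → (∀ x → c x ≡ d x) → g c ≈ g d) →
      sum (λ j → (- sign j * b (suc j)) *
        sum (λ k → (- sign k * b (punchIn (suc j) (suc k))) * g (λ x → punchIn (suc j) (punchIn (suc k) x)))) ≈ 0#
    inner zero    b g g-cong = sum-0 {1} λ j → zeroʳ (- sign j * b (suc j))
    inner (suc n) b g g-cong = trans
      (sum-cong-≋ {suc (suc n)} λ j → *-distribˡ-congˡ (suc n) (signs j))
      (double-expansion n (b ∘ suc) (λ c → g (lift c)) (λ e → g-cong λ { zero → ≡.refl ; (suc x) → ≡.cong suc (e x) }))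
      where
      lift : (Fin n → Fin (suc (suc n))) → Fin (suc n) → Fin (suc (suc (suc n)))
      lift c zero    = zero
      lift c (suc x) = suc (c x)
      signs : ∀ j k →
        (- sign j * b (suc j)) * ((- sign k * b (suc (punchIn j k))) * g (λ x → punchIn (suc j) (punchIn (suc k) x)))
        ≈ (sign j * b (suc j)) * ((sign k * b (suc (punchIn j k))) * g (lift (λ x → punchIn j (punchIn k x))))
      signs j k = trans
        (*-congˡ (*-congˡ (g-cong λ { zero → ≡.refl ; (suc x) → ≡.refl })))
        (solve 5 (λ s t a b g → (:- s :* a) :* ((:- t :* b) :* g) := (s :* a) :* ((t :* b) :* g)) refl
          (sign j) (sign k) (b (suc j)) (b (suc (punchIn j k))) (g (lift (λ x → punchIn j (punchIn k x)))))

  reindex-linear : ∀ {m l} (c : Fin m → Fin l) → IsLinearMap {l} {m} (_∘ c)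
  reindex-linear c = record { respects = λ e i → e (c i) ; add = λ _ _ _ → refl ; scale = λ _ _ _ → refl }

  detᵛ-alternating : ∀ n → Alternating n n detᵛ
  detᵛ-alternating zero    = tt
  detᵛ-alternating (suc n) =
    (λ rs → let term : Row (suc n) → Row (suc n)
                term v j = (sign j * v j) * detᵛ (minor j rs) in record
      { respects = λ {u} {v} e → sum-cong-≋ {suc n} {term u} {term v} λ j → *-congʳ (*-congˡ (e j))
      ; add   = λ u v → trans
          (sum-cong-≋ {suc n} {term (λ i → u i + v i)} λ j →
            solve 4 (λ s u v d → (s :* (u :+ v)) :* d := (s :* u) :* d :+ (s :* v) :* d) refl
              (sign j) (u j) (v j) (detᵛ (minor j rs)))
          (∑-distrib-+ {suc n} (term u) (term v))
      ; scale = λ c u → trans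
          (sum-cong-≋ {suc n} {term (λ i → c * u i)} λ j →
            solve 4 (λ s c u d → (s :* (c :* u)) :* d := c :* ((s :* u) :* d)) refl
              (sign j) c (u j) (detᵛ (minor j rs)))
          (sym (*-distribˡ-sum {suc n} c (term u))) }) ,
    (λ v → Alternating-sum n (suc n) (λ j → sign j * v j) (λ j rs → detᵛ (minor j rs))
             (λ j → Alternating-map n n (suc n) (reindex-linear (punchIn j)) (detᵛ-alternating n))) ,
    adjacent n
    where
    adjacent : ∀ n → Adjacent (suc n) (suc n) detᵛ
    adjacent zero    = tt
    adjacent (suc n) v rs = trans
      (sum-cong-≋ {suc (suc n)} λ j → *-congˡ {sign j * v j} (sum-cong-≋ {suc n} λ k →
        *-congˡ {sign k * v (punchIn j k)}
          (reflexive (≡.cong detᵛ (≡.sym (Vecₚ.map-∘ (_∘ punchIn k) (_∘ punchIn j) rs))))))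
      (double-expansion n v (λ c → detᵛ (mapV (_∘ c) rs))
        (λ e → Alternating-cong n n (detᵛ-alternating n) (map-pointwise (λ r i → reflexive (≡.cong r (e i))) rs)))
      where
      map-pointwise : ∀ {k m l} {f h : Row m → Row l} → (∀ r → f r ≗ h r) → (rs : Rows k m) →
        Pointwise _≗_ (mapV f rs) (mapV h rs)
      map-pointwise e []       = []
      map-pointwise e (r ∷ rs) = e r ∷ map-pointwise e rs

  tabulate-pointwise : ∀ {n m} {f g : Fin n → Row m} → (∀ i → f i ≗ g i) →
    Pointwise _≗_ (tabulate f) (tabulate g)
  tabulate-pointwise {zero}  e = []
  tabulate-pointwise {suc n} e = e zero ∷ tabulate-pointwise (e ∘ suc)

  identity : ∀ n → Rows n n
  identity n = tabulate basis

  private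
    step : ∀ n {E} (j : Fin (suc n)) → Alternating (suc n) (suc n) E →
      Alternating n n (λ B → E (basis j ∷ mapV (insert0 j) B))
    step n j (_ , tl , _) = Alternating-map n (suc n) n (insert0-linear j) (tl (basis j))

    identity-minor : ∀ n {E} → Alternating (suc n) (suc n) E →
      E (basis zero ∷ mapV (insert0 zero) (identity n)) ≈ E (identity (suc n))
    identity-minor n {E} alt = trans
      (reflexive (≡.cong (λ rs → E (basis zero ∷ rs)) (≡.sym (Vecₚ.tabulate-∘ (insert0 zero) basis))))
      (Alternating-cong (suc n) (suc n) {E} alt ((λ _ → refl) ∷
        tabulate-pointwise {n} (λ { i zero → refl ; i (suc k) → refl })))

  cofactor-sign : ∀ n {E} → Alternating (suc n) (suc n) E → ∀ j →
    E (basis j ∷ mapV (insert0 j) (identity n)) ≈ sign j * E (identity (suc n))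
  cofactor-sign n       {E} alt zero = trans (identity-minor n {E} alt) (sym (*-identityˡ _))
  cofactor-sign (suc n) {E} alt@(lin , tl , adj) (suc j) = begin
    E (basis (suc j) ∷ insert0 (suc j) (basis zero) ∷ mapV (insert0 (suc j)) (tabulate (basis ∘ suc)))
      ≡⟨ ≡.cong (λ rs → E (basis (suc j) ∷ insert0 (suc j) (basis zero) ∷ rs))
           (≡.sym (Vecₚ.tabulate-∘ (insert0 (suc j)) (basis ∘ suc))) ⟩
    E (basis (suc j) ∷ insert0 (suc j) (basis zero) ∷ tabulate (λ k → insert0 (suc j) (basis (suc k))))
      ≈⟨ Alternating-cong (suc (suc n)) (suc (suc n)) {E} alt
           ((λ { zero → refl ; (suc i) → refl }) ∷
            (λ { zero → refl ; (suc i) → insert0-0 j (λ _ → refl) i }) ∷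
            tabulate-pointwise {n} (λ { k zero → refl ; k (suc i) → refl })) ⟩
    E (insert0 zero (basis j) ∷ basis zero ∷ tabulate (λ k → insert0 zero (insert0 j (basis k))))
      ≈⟨ swap-rows n (suc (suc n)) {E} alt _ _ _ ⟩
    - E (basis zero ∷ insert0 zero (basis j) ∷ tabulate (λ k → insert0 zero (insert0 j (basis k))))
      ≡⟨ ≡.cong (λ rs → - E (basis zero ∷ insert0 zero (basis j) ∷ rs))
           (≡.trans (Vecₚ.tabulate-∘ (insert0 zero) (insert0 j ∘ basis))
                    (≡.cong (mapV (insert0 zero)) (Vecₚ.tabulate-∘ (insert0 j) basis))) ⟩
    - E (basis zero ∷ mapV (insert0 zero) (basis j ∷ mapV (insert0 j) (identity n)))
      ≈⟨ -‿cong (cofactor-sign n (step (suc n) {E} zero alt) j) ⟩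
    - (sign j * E (basis zero ∷ mapV (insert0 zero) (identity (suc n))))
      ≈⟨ -‿cong (*-congˡ (identity-minor (suc n) {E} alt)) ⟩
    - (sign j * E (identity (suc (suc n))))
      ≈⟨ -‿distribˡ-* _ _ ⟩
    - sign j * E (identity (suc (suc n))) ∎

  alternating-unique : ∀ n {E} → Alternating n n E → ∀ rs → E rs ≈ E (identity n) * detᵛ rs
  alternating-unique zero    alt [] = sym (*-identityʳ _)
  alternating-unique (suc n) {E} alt@(lin , tl , _) (r ∷ rs) = begin
    E (r ∷ rs)
      ≈⟨ linear-expand (suc n) (lin rs) r ⟩
    sum (λ j → r j * E (basis j ∷ rs))
      ≈⟨ sum-cong-≋ {suc n} column ⟩
    sum (λ j → E (identity (suc n)) * ((sign j * r j) * detᵛ (minor j rs)))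
      ≈⟨ *-distribˡ-sum {suc n} (E (identity (suc n))) (λ j → (sign j * r j) * detᵛ (minor j rs)) ⟨
    E (identity (suc n)) * detᵛ (r ∷ rs) ∎
    where
    column : ∀ j → r j * E (basis j ∷ rs) ≈ E (identity (suc n)) * ((sign j * r j) * detᵛ (minor j rs))
    column j = begin
      r j * E (basis j ∷ rs)
        ≈⟨ *-congˡ (reduce-rows n (suc n) (tl (basis j)) (Alternating⇒Kills n (suc n) {E} alt (basis j))
             (insert0-decompose j) rs) ⟩
      r j * E (basis j ∷ mapV (λ s → insert0 j (s ∘ punchIn j)) rs)
        ≡⟨ ≡.cong (λ ss → r j * E (basis j ∷ ss)) (Vecₚ.map-∘ (insert0 j) (_∘ punchIn j) rs) ⟩
      r j * E (basis j ∷ mapV (insert0 j) (minor j rs))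
        ≈⟨ *-congˡ (alternating-unique n (step n {E} j alt) (minor j rs)) ⟩
      r j * (E (basis j ∷ mapV (insert0 j) (identity n)) * detᵛ (minor j rs))
        ≈⟨ *-congˡ (*-congʳ (cofactor-sign n {E} alt j)) ⟩
      r j * ((sign j * E (identity (suc n))) * detᵛ (minor j rs))
        ≈⟨ solve 4 (λ r s e d → r :* ((s :* e) :* d) := e :* ((s :* r) :* d)) refl _ _ _ _ ⟩
      E (identity (suc n)) * ((sign j * r j) * detᵛ (minor j rs)) ∎

  Matrix : ℕ → Set
  Matrix n = Fin n → Row n

  detᵐ : ∀ {n} → Matrix n → Carrier
  detᵐ M = detᵛ (tabulate M)

  detᵐ-cong : ∀ {n} {A B : Matrix n} → (∀ i → A i ≗ B i) → detᵐ A ≈ detᵐ B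
  detᵐ-cong {n} e = Alternating-cong n n (detᵛ-alternating n) (tabulate-pointwise e)

  sum-basis : ∀ {n} (i : Fin n) (f : Row n) → sum (λ j → basis i j * f j) ≈ f i
  sum-basis {suc n} zero    f = trans (+-cong (*-identityˡ _) (sum-0 {n} λ j → zeroˡ _)) (+-identityʳ _)
  sum-basis (suc i) f = trans (+-congʳ (zeroˡ _)) (trans (+-identityˡ _) (sum-basis i (f ∘ suc)))

  infixl 7 _·_
  _·_ : ∀ {n} → Matrix n → Matrix n → Matrix n
  (A · B) i k = sum (λ j → A i j * B j k)

  detᵐ-· : ∀ {n} (A B : Matrix n) → detᵐ (A · B) ≈ detᵐ B * detᵐ A
  detᵐ-· {n} A B = begin
    detᵛ (tabulate (λ i → A i ▹B))                ≡⟨ ≡.cong detᵛ (Vecₚ.tabulate-∘ _▹B A) ⟩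
    detᵛ (mapV _▹B (tabulate A))                  ≈⟨ alternating-unique n (Alternating-map n n n linear (detᵛ-alternating n)) (tabulate A) ⟩
    detᵛ (mapV _▹B (identity n)) * detᵐ A         ≡⟨ ≡.cong (λ rs → detᵛ rs * detᵐ A) (≡.sym (Vecₚ.tabulate-∘ _▹B basis)) ⟩
    detᵐ (λ i → basis i ▹B) * detᵐ A              ≈⟨ *-congʳ (detᵐ-cong (λ i k → sum-basis i (λ j → B j k))) ⟩
    detᵐ B * detᵐ A                               ∎
    where
    _▹B : Row n → Row n
    (r ▹B) k = sum (λ j → r j * B j k)
    linear : IsLinearMap _▹B
    linear = record
      { respects = λ e k → sum-cong-≋ {n} λ j → *-congʳ (e j)
      ; add   = λ u v k → trans (sum-cong-≋ {n} λ j → distribʳ _ _ _) (∑-distrib-+ {n} _ _)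
      ; scale = λ c u k → trans (sum-cong-≋ {n} λ j → *-assoc c _ _) (sym (*-distribˡ-sum {n} c _)) }

  detᵐ-basis : ∀ n → detᵐ {n} basis ≈ 1#
  detᵐ-basis zero    = refl
  detᵐ-basis (suc n) = begin
    (1# * 1#) * detᵛ (minor {n} zero (tabulate (basis ∘ suc))) +
      sum {n} (λ j → (- sign j * 0#) * detᵛ (minor (suc j) (tabulate (basis ∘ suc))))
      ≈⟨ +-cong (trans (*-congʳ (*-identityˡ 1#)) (*-identityˡ _))
                (sum-0 {n} λ j → trans (*-congʳ (zeroʳ _)) (zeroˡ _)) ⟩
    detᵛ (minor {n} zero (tabulate (basis ∘ suc))) + 0#
      ≈⟨ +-identityʳ _ ⟩
    detᵛ (minor {n} zero (tabulate (basis ∘ suc)))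
      ≡⟨ ≡.cong detᵛ (≡.sym (Vecₚ.tabulate-∘ {n = n} (_∘ suc) (basis ∘ suc))) ⟩
    detᵐ {n} basis
      ≈⟨ detᵐ-basis n ⟩
    1# ∎

  alternating-scale : ∀ n m {E} → Alternating n m E → ∀ (d : ℕ → Carrier) (v : Fin n → Row m) →
    E (tabulate (λ i j → d (toℕ i) * v i j)) ≈ Π n d * E (tabulate v)
  alternating-scale zero    m alt d v = sym (*-identityˡ _)
  alternating-scale (suc n) m {E} (lin , tl , _) d v = begin
    E ((λ j → d 0 * v zero j) ∷ _)
      ≈⟨ IsLinear.scale (lin _) (d 0) (v zero) ⟩
    d 0 * E (v zero ∷ tabulate (λ i j → d (suc (toℕ i)) * v (suc i) j))
      ≈⟨ *-congˡ (alternating-scale n m (tl (v zero)) (d ∘ suc) (v ∘ suc)) ⟩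
    d 0 * (Π n (d ∘ suc) * E (tabulate v))
      ≈⟨ *-assoc _ _ _ ⟨
    Π (suc n) d * E (tabulate v) ∎

  detᵐ-diagonal : ∀ n (d : ℕ → Carrier) → detᵐ {n} (λ i j → d (toℕ i) * basis i j) ≈ Π n d
  detᵐ-diagonal n d = trans (alternating-scale n n (detᵛ-alternating n) d basis)
    (trans (*-congˡ (detᵐ-basis n)) (*-identityʳ _))

  ι-sumFin : ∀ n f → ι (sumFin n f) ≈ sum (λ i → ι (f i))
  ι-sumFin zero    f = ι-0
  ι-sumFin (suc n) f = trans (ι-+ _ _) (+-congˡ (ι-sumFin n (f ∘ suc)))

  ι-sign : ∀ {n} (j : Fin n) → ι ((ℤ.- + 1) ℤ.^ toℕ j) ≈ sign j
  ι-sign zero    = ι-1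
  ι-sign (suc j) = begin
    ι ((ℤ.- + 1) ℤ.* (ℤ.- + 1) ℤ.^ toℕ j)     ≈⟨ ι-* _ _ ⟩
    ι (ℤ.- + 1) * ι ((ℤ.- + 1) ℤ.^ toℕ j)     ≈⟨ *-cong (trans (ι-neg (+ 1)) (-‿cong ι-1)) (ι-sign j) ⟩
    - 1# * sign j                             ≈⟨ -1*x≈-x _ ⟩
    - sign j                                  ∎

  ι-det : ∀ n M → ι (det n M) ≈ detᵐ (λ i j → ι (M i j))
  ι-det zero    M = ι-1
  ι-det (suc n) M = trans (ι-sumFin (suc n) (λ j → (ℤ.- + 1) ℤ.^ toℕ j ℤ.* (M zero j ℤ.* det n (λ i k → M (suc i) (punchIn j k))))) (sum-cong-≋ {suc n} λ j → begin
    ι ((ℤ.- + 1) ℤ.^ toℕ j ℤ.* (M zero j ℤ.* det n (λ i k → M (suc i) (punchIn j k))))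
      ≈⟨ trans (ι-* _ _) (*-cong (ι-sign j) (ι-* _ _)) ⟩
    sign j * (ι (M zero j) * ι (det n (λ i k → M (suc i) (punchIn j k))))
      ≈⟨ *-assoc _ _ _ ⟨
    (sign j * ι (M zero j)) * ι (det n (λ i k → M (suc i) (punchIn j k)))
      ≈⟨ *-congˡ (ι-det n _) ⟩
    (sign j * ι (M zero j)) * detᵐ (λ i k → ι (M (suc i) (punchIn j k)))
      ≡⟨ ≡.cong (λ rs → (sign j * ι (M zero j)) * detᵛ rs) (Vecₚ.tabulate-∘ (_∘ punchIn j) _) ⟩
    (sign j * ι (M zero j)) * detᵛ (minor j (tabulate (λ i k → ι (M (suc i) k)))) ∎)

mod-periodic : ∀ k l → (l ℕ.+ suc k) mod suc k ≡ l mod suc k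
mod-periodic k l = Finₚ.toℕ-injective (≡.trans (Finₚ.toℕ-fromℕ< (m%n<n (l ℕ.+ suc k) (suc k)))
  (≡.trans ([m+n]%n≡m%n l (suc k)) (≡.sym (Finₚ.toℕ-fromℕ< (m%n<n l (suc k))))))

module MonicPolynomial (S : Ringℤ) where
  open Kit S

  -- A vector of length n holds the coefficients below the leading 1 of a monic polynomial of degree n.
  evalᵐ : ∀ {n} → Vec Carrier n → Carrier → Carrier
  evalᵐ []       y = 1#
  evalᵐ (a ∷ as) y = a + y * evalᵐ as y

  quotientᵐ : ∀ {n} → Carrier → Vec Carrier (suc n) → Vec Carrier n
  quotientᵐ r (a ∷ [])          = []
  quotientᵐ r (a ∷ as@(_ ∷ _)) = evalᵐ as r ∷ quotientᵐ r as

  quotientᵐ-correct : ∀ {n} r (v : Vec Carrier (suc n)) y →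
    evalᵐ v y - evalᵐ v r ≈ (y - r) * evalᵐ (quotientᵐ r v) y
  quotientᵐ-correct r (a ∷ []) y =
    solve 4 (λ a y r o → (a :+ y :* o) :- (a :+ r :* o) := (y :- r) :* o) refl a y r 1#
  quotientᵐ-correct r (a ∷ as@(_ ∷ _)) y = begin
    (a + y * evalᵐ as y) - (a + r * evalᵐ as r)
      ≈⟨ solve 5 (λ a y r u v → (a :+ y :* u) :- (a :+ r :* v) := (y :- r) :* v :+ y :* (u :- v)) refl
           a y r (evalᵐ as y) (evalᵐ as r) ⟩
    (y - r) * evalᵐ as r + y * (evalᵐ as y - evalᵐ as r)
      ≈⟨ +-congˡ (*-congˡ (quotientᵐ-correct r as y)) ⟩
    (y - r) * evalᵐ as r + y * ((y - r) * evalᵐ (quotientᵐ r as) y)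
      ≈⟨ solve 4 (λ d v y q → d :* v :+ y :* (d :* q) := d :* (v :+ y :* q)) refl (y - r) (evalᵐ as r) y _ ⟩
    (y - r) * (evalᵐ as r + y * evalᵐ (quotientᵐ r as) y) ∎

  evalᵐ-factors : ∀ {n} (v : Vec Carrier n) (r : ℕ → Carrier) →
    (∀ k → k ℕ.< n → evalᵐ v (r k) ≈ 0#) →
    (∀ i j → i ℕ.< j → j ℕ.< n → Regular (r j - r i)) →
    ∀ y → evalᵐ v y ≈ Π n (λ k → y - r k)
  evalᵐ-factors [] r root reg y = refl
  evalᵐ-factors {suc n} v@(_ ∷ _) r root reg y = begin
    evalᵐ v y                      ≈⟨ factor y ⟩
    (y - r 0) * evalᵐ q y          ≈⟨ *-congˡ (evalᵐ-factors q (r ∘ suc) root′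
                                        (λ i j i<j j<n → reg (suc i) (suc j) (ℕ.s<s i<j) (ℕ.s<s j<n)) y) ⟩
    Π (suc n) (λ k → y - r k)      ∎
    where
    q = quotientᵐ (r 0) v
    factor : ∀ y → evalᵐ v y ≈ (y - r 0) * evalᵐ q y
    factor y = begin
      evalᵐ v y                    ≈⟨ +-identityʳ _ ⟨
      evalᵐ v y + 0#               ≈⟨ +-congˡ (trans (-‿cong (root 0 ℕ.z<s)) -0#≈0#) ⟨
      evalᵐ v y - evalᵐ v (r 0)    ≈⟨ quotientᵐ-correct (r 0) v y ⟩
      (y - r 0) * evalᵐ q y        ∎
    root′ : ∀ k → k ℕ.< n → evalᵐ q (r (suc k)) ≈ 0#
    root′ k k<n = reg 0 (suc k) ℕ.z<s (ℕ.s<s k<n) _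
      (trans (sym (factor (r (suc k)))) (root (suc k) (ℕ.s<s k<n)))

module RootOfUnity (S : Ringℤ) (m-1 : ℕ)
  (torsion-free : ∀ c → c ≢ + 0 → Kit.Regular S (Kit.ι S c))
  (ρ : Kit.Carrier S) (ρ^m≈1 : Kit._≈_ S (Kit._^_ S ρ (suc m-1)) (Kit.1# S))
  (regular : ∀ k → 0 ℕ.< k → k ℕ.< suc m-1 → Kit.Regular S (Kit._-_ S (Kit.1# S) (Kit._^_ S ρ k)))
  where
  open Kit S
  open MonicPolynomial S
  open Determinant S

  private
    m : ℕ
    m = suc m-1

  ρ^mk≈1 : ∀ k → ρ ^ (m ℕ.* k) ≈ 1#
  ρ^mk≈1 k = trans (sym (^-assocʳ ρ m k)) (trans (^-congˡ k ρ^m≈1) (1^ k))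

  Σρ^kh≈0 : ∀ k → 0 ℕ.< k → k ℕ.< m → Σ m ((ρ ^ k) ^_) ≈ 0#
  Σρ^kh≈0 k 0<k k<m = regular k 0<k k<m _ (begin
    (1# - ρ ^ k) * Σ m ((ρ ^ k) ^_)   ≈⟨ geometric (ρ ^ k) m ⟩
    1# - (ρ ^ k) ^ m                  ≈⟨ +-congˡ (-‿cong (trans (^-assocʳ ρ k m)
                                           (trans (^-congʳ ρ (ℕₚ.*-comm k m)) (ρ^mk≈1 k)))) ⟩
    1# - 1#                           ≈⟨ -‿inverseʳ 1# ⟩
    0#                                ∎)

  ∏[1-ρ^k]≈m : Π m-1 (λ k → 1# - ρ ^ suc k) ≈ ιℕ m
  ∏[1-ρ^k]≈m = begin
    Π m-1 (λ k → 1# - ρ ^ suc k)   ≈⟨ evalᵐ-factors ones (λ k → ρ ^ suc k)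
                                        (λ k k<m-1 → trans (evalᵐ-ones m-1 _) (Σρ^kh≈0 (suc k) ℕ.z<s (ℕ.s<s k<m-1)))
                                        difference-regular 1# ⟨
    evalᵐ ones 1#                  ≈⟨ evalᵐ-ones m-1 1# ⟩
    Σ m (1# ^_)                    ≈⟨ Σ-cong m (λ k _ → 1^ k) ⟩
    Σ m (λ _ → 1#)                 ≈⟨ Σ-const m 1# ⟩
    ιℕ m * 1#                      ≈⟨ *-identityʳ _ ⟩
    ιℕ m                           ∎
    where
    ones : Vec Carrier m-1
    ones = replicate m-1 1#
    evalᵐ-ones : ∀ n y → evalᵐ (replicate n 1#) y ≈ Σ (suc n) (y ^_)
    evalᵐ-ones zero    y = sym (+-identityʳ 1#)
    evalᵐ-ones (suc n) y = +-congˡ (trans (*-congˡ (evalᵐ-ones n y)) (Σ-*ˡ (suc n) y (y ^_)))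
    difference-regular : ∀ i j → i ℕ.< j → j ℕ.< m-1 → Regular (ρ ^ suc j - ρ ^ suc i)
    difference-regular i j i<j j<m-1 y h =
      regular (j ℕ.∸ i) (ℕₚ.m<n⇒0<n∸m i<j) (ℕₚ.≤-<-trans (ℕₚ.m∸n≤m j i) (ℕₚ.m<n⇒m<1+n j<m-1)) y (begin
        (1# - ρ ^ d) * y
          ≈⟨ *-congʳ (begin
               1# - ρ ^ d                              ≈⟨ *-identityˡ _ ⟨
               1# * (1# - ρ ^ d)                       ≈⟨ *-congʳ unit ⟨
               (ρ ^ e * ρ ^ suc i) * (1# - ρ ^ d)      ≈⟨ solve 4 (λ e a o b → (e :* a) :* (o :- b) := :- (e :* (a :* b :- a :* o))) refl (ρ ^ e) (ρ ^ suc i) 1# (ρ ^ d) ⟩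
               - (ρ ^ e * (ρ ^ suc i * ρ ^ d - ρ ^ suc i * 1#))
                 ≈⟨ -‿cong (*-congˡ (+-cong (trans (sym (^-homo-* ρ (suc i) d)) (^-congʳ ρ (≡.cong suc (ℕₚ.m+[n∸m]≡n (ℕₚ.<⇒≤ i<j))))) (-‿cong (*-identityʳ _)))) ⟩
               - (ρ ^ e * (ρ ^ suc j - ρ ^ suc i))     ∎) ⟩
        - (ρ ^ e * (ρ ^ suc j - ρ ^ suc i)) * y
          ≈⟨ solve 3 (λ e d y → :- (e :* d) :* y := :- (e :* (d :* y))) refl (ρ ^ e) _ y ⟩
        - (ρ ^ e * ((ρ ^ suc j - ρ ^ suc i) * y))
          ≈⟨ -‿cong (trans (*-congˡ h) (zeroʳ _)) ⟩
        - 0#  ≈⟨ -0#≈0# ⟩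
        0#    ∎)
      where
      d = j ℕ.∸ i
      e = m ℕ.∸ suc i
      unit : ρ ^ e * ρ ^ suc i ≈ 1#
      unit = trans (sym (^-homo-* ρ e (suc i)))
        (trans (^-congʳ ρ (ℕₚ.m∸n+n≡m (ℕ.s≤s (ℕₚ.<⇒≤ (ℕₚ.<-trans i<j j<m-1))))) ρ^m≈1)

  entry : (Fin m → ℤ) → ℕ → ℤ
  entry a l = a (l mod m)

  det-circulant : ∀ a → ι (det m (circulant m-1 a)) ≈ Π m (λ k → Σ m (λ l → ι (entry a l) * (ρ ^ k) ^ l))
  det-circulant a = trans (ι-det m (circulant m-1 a)) (trans (x-y≈0⇒x≈y (torsion-free (+ (m ℕ.^ m))
      (λ e → ℕ.≢-nonZero⁻¹ (m ℕ.^ m) {{ℕₚ.m^n≢0 m m}} (ℤ+-inj e)) _ (begin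
    ιℕ (m ℕ.^ m) * (detᵐ C - detᵐ Δ)
      ≈⟨ *-congʳ (trans (ιℕ-^ m m) (sym (Π-const m (ιℕ m)))) ⟩
    Π m (λ _ → ιℕ m) * (detᵐ C - detᵐ Δ)
      ≈⟨ *-congʳ (trans (sym (detᵐ-diagonal m (λ _ → ιℕ m))) (trans (detᵐ-cong {m} (λ i j → sym (VW i j))) (detᵐ-· V W))) ⟩
    (detᵐ W * detᵐ V) * (detᵐ C - detᵐ Δ)
      ≈⟨ solve 4 (λ w v c d → (w :* v) :* (c :- d) := w :* (v :* c :- d :* v)) refl (detᵐ W) (detᵐ V) (detᵐ C) (detᵐ Δ) ⟩
    detᵐ W * (detᵐ V * detᵐ C - detᵐ Δ * detᵐ V)
      ≈⟨ *-congˡ (+-cong (sym (detᵐ-· C V)) (-‿cong (sym (detᵐ-· V Δ)))) ⟩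
    detᵐ W * (detᵐ (C · V) - detᵐ (V · Δ))
      ≈⟨ *-congˡ (trans (+-congʳ (detᵐ-cong {m} CV)) (-‿inverseʳ _)) ⟩
    detᵐ W * 0#  ≈⟨ zeroʳ _ ⟩
    0#           ∎))) (detᵐ-diagonal m F))
    where
    ℤ+-inj : ∀ {x} → + x ≡ + 0 → x ≡ 0
    ℤ+-inj ≡.refl = ≡.refl
    Π-const : ∀ n x → Π n (λ _ → x) ≈ x ^ n
    Π-const zero    x = refl
    Π-const (suc n) x = *-congˡ (Π-const n x)
    F : ℕ → Carrier
    F k = Σ m (λ l → ι (entry a l) * (ρ ^ k) ^ l)
    C V W Δ : Matrix m
    C i j = ι (circulant m-1 a i j)
    V i k = ρ ^ (toℕ i ℕ.* toℕ k)
    W k j = ρ ^ (toℕ k ℕ.* (m ℕ.∸ toℕ j))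
    Δ k l = F (toℕ k) * basis k l
    open import Algebra.Properties.Semiring.Sum semiring using (sum; sum-cong-≋)
    basis-sym : ∀ {n} (i j : Fin n) → basis i j ≈ basis j i
    basis-sym zero    zero    = refl
    basis-sym zero    (suc j) = refl
    basis-sym (suc i) zero    = refl
    basis-sym (suc i) (suc j) = basis-sym i j
    CV : ∀ i k → (C · V) i k ≈ (V · Δ) i k
    CV i k = begin
      Σ m (λ j → b (j ℕ.+ s) * ρ ^ (j ℕ.* κ))
        ≈⟨ Σ-cong m (λ j _ → begin
             b (j ℕ.+ s) * ρ ^ (j ℕ.* κ)
               ≈⟨ *-congˡ (trans (sym (*-identityʳ _)) (*-congˡ (sym unit))) ⟩
             b (j ℕ.+ s) * (ρ ^ (j ℕ.* κ) * (ρ ^ (s ℕ.* κ) * ρ ^ (toℕ i ℕ.* κ)))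
               ≈⟨ solve 4 (λ b x y z → b :* (x :* (y :* z)) := (b :* (x :* y)) :* z) refl (b (j ℕ.+ s)) _ _ _ ⟩
             (b (j ℕ.+ s) * (ρ ^ (j ℕ.* κ) * ρ ^ (s ℕ.* κ))) * ρ ^ (toℕ i ℕ.* κ)
               ≈⟨ *-congʳ (*-congˡ (trans (sym (^-homo-* ρ (j ℕ.* κ) (s ℕ.* κ)))
                    (trans (^-congʳ ρ (≡.trans (≡.sym (ℕₚ.*-distribʳ-+ κ j s)) (ℕₚ.*-comm (j ℕ.+ s) κ)))
                           (sym (^-assocʳ ρ κ (j ℕ.+ s)))))) ⟩
             h (j ℕ.+ s) * ρ ^ (toℕ i ℕ.* κ) ∎) ⟩
      Σ m (λ j → h (j ℕ.+ s) * ρ ^ (toℕ i ℕ.* κ))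
        ≈⟨ Σ-*ʳ m (ρ ^ (toℕ i ℕ.* κ)) (λ j → h (j ℕ.+ s)) ⟨
      Σ m (λ j → h (j ℕ.+ s)) * ρ ^ (toℕ i ℕ.* κ)
        ≈⟨ *-congʳ (Σ-shift m h periodic s) ⟩
      F κ * ρ ^ (toℕ i ℕ.* κ)
        ≈⟨ *-comm _ _ ⟩
      V i k * F κ
        ≈⟨ sum-basis k (λ j → V i j * F (toℕ j)) ⟨
      sum (λ j → basis k j * (V i j * F (toℕ j)))
        ≈⟨ sum-cong-≋ {m} (λ j → trans (*-congʳ (basis-sym k j))
             (solve 3 (λ b v f → b :* (v :* f) := v :* (f :* b)) refl (basis j k) (V i j) (F (toℕ j)))) ⟩
      (V · Δ) i k ∎
      where
      κ = toℕ k
      s = m ℕ.∸ toℕ i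
      b : ℕ → Carrier
      b l = ι (entry a l)
      h : ℕ → Carrier
      h l = b l * (ρ ^ κ) ^ l
      unit : ρ ^ (s ℕ.* κ) * ρ ^ (toℕ i ℕ.* κ) ≈ 1#
      unit = trans (sym (^-homo-* ρ (s ℕ.* κ) _)) (trans (^-congʳ ρ
        (≡.trans (≡.sym (ℕₚ.*-distribʳ-+ κ s (toℕ i)))
                 (≡.cong (ℕ._* κ) (ℕₚ.m∸n+n≡m (ℕₚ.<⇒≤ (Finₚ.toℕ<n i)))))) (ρ^mk≈1 κ))
      periodic : ∀ l → h (l ℕ.+ m) ≈ h l
      periodic l = *-cong (reflexive (≡.cong (λ x → ι (a x)) (mod-periodic m-1 l)))
        (trans (^-homo-* (ρ ^ κ) l m) (trans (*-congˡ (trans (^-assocʳ ρ κ m)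
          (trans (^-congʳ ρ (ℕₚ.*-comm κ m)) (ρ^mk≈1 κ)))) (*-identityʳ _)))
    basis-≡ : ∀ {n} {i j : Fin n} → i ≡ j → basis i j ≈ 1#
    basis-≡ {i = zero}  ≡.refl = refl
    basis-≡ {i = suc i} ≡.refl = basis-≡ {i = i} ≡.refl
    basis-≢ : ∀ {n} (i j : Fin n) → i ≢ j → basis i j ≈ 0#
    basis-≢ zero    zero    ne = contradiction ≡.refl ne
    basis-≢ zero    (suc j) ne = refl
    basis-≢ (suc i) zero    ne = refl
    basis-≢ (suc i) (suc j) ne = basis-≢ i j (ne ∘ ≡.cong suc)
    VW : ∀ i j → (V · W) i j ≈ ιℕ m * basis i j
    VW i j = trans (Σ-cong m (λ k _ → trans (sym (^-homo-* ρ (i′ ℕ.* k) (k ℕ.* (m ℕ.∸ j′))))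
        (trans (^-congʳ ρ (≡.trans (≡.cong (i′ ℕ.* k ℕ.+_) (ℕₚ.*-comm k (m ℕ.∸ j′))) (≡.sym (ℕₚ.*-distribʳ-+ k i′ (m ℕ.∸ j′)))))
               (sym (^-assocʳ ρ (i′ ℕ.+ (m ℕ.∸ j′)) k))))) orthogonal
      where
      i′ = toℕ i
      j′ = toℕ j
      j≤m = ℕₚ.<⇒≤ (Finₚ.toℕ<n j)
      off-diagonal : i ≢ j → ∀ d → 0 ℕ.< d → d ℕ.< m → ρ ^ (i′ ℕ.+ (m ℕ.∸ j′)) ≈ ρ ^ d →
        Σ m ((ρ ^ (i′ ℕ.+ (m ℕ.∸ j′))) ^_) ≈ ιℕ m * basis i j
      off-diagonal ne d 0<d d<m e = begin
        Σ m ((ρ ^ (i′ ℕ.+ (m ℕ.∸ j′))) ^_)   ≈⟨ Σ-cong m (λ k _ → ^-congˡ k e) ⟩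
        Σ m ((ρ ^ d) ^_)                     ≈⟨ Σρ^kh≈0 d 0<d d<m ⟩
        0#                                   ≈⟨ zeroʳ _ ⟨
        ιℕ m * 0#                            ≈⟨ *-congˡ (basis-≢ i j ne) ⟨
        ιℕ m * basis i j                     ∎
      orthogonal : Σ m ((ρ ^ (i′ ℕ.+ (m ℕ.∸ j′))) ^_) ≈ ιℕ m * basis i j
      orthogonal with ℕₚ.<-cmp i′ j′
      ... | tri< i<j i≢j _ = off-diagonal (i≢j ∘ ≡.cong toℕ) _
              (ℕₚ.<-≤-trans (ℕₚ.m<n⇒0<n∸m (Finₚ.toℕ<n j)) (ℕₚ.m≤n+m _ i′))
              (≡.subst (i′ ℕ.+ (m ℕ.∸ j′) ℕ.<_) (ℕₚ.m+[n∸m]≡n j≤m) (ℕₚ.+-monoˡ-< (m ℕ.∸ j′) i<j)) refl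
      ... | tri≈ _ i≡j _ = begin
        Σ m ((ρ ^ (i′ ℕ.+ (m ℕ.∸ j′))) ^_)   ≈⟨ Σ-cong m {f = (ρ ^ (i′ ℕ.+ (m ℕ.∸ j′))) ^_} (λ k _ → trans (^-assocʳ ρ (i′ ℕ.+ (m ℕ.∸ j′)) k)
                                                  (trans (^-congʳ ρ (≡.cong (ℕ._* k) (≡.trans (≡.cong (ℕ._+ (m ℕ.∸ j′)) i≡j) (ℕₚ.m+[n∸m]≡n j≤m)))) (ρ^mk≈1 k))) ⟩
        Σ m (λ _ → 1#)                       ≈⟨ Σ-const m 1# ⟩
        ιℕ m * 1#                            ≈⟨ *-congˡ (basis-≡ (Finₚ.toℕ-injective i≡j)) ⟨
        ιℕ m * basis i j                     ∎
      ... | tri> _ i≢j j<i = off-diagonal (i≢j ∘ ≡.cong toℕ) (i′ ℕ.∸ j′) (ℕₚ.m<n⇒0<n∸m j<i)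
              (ℕₚ.≤-<-trans (ℕₚ.m∸n≤m i′ j′) (Finₚ.toℕ<n i)) (begin
        ρ ^ (i′ ℕ.+ (m ℕ.∸ j′))               ≈⟨ ^-congʳ ρ (begin-nat) ⟩
        ρ ^ ((i′ ℕ.∸ j′) ℕ.+ m)               ≈⟨ ^-homo-* ρ (i′ ℕ.∸ j′) m ⟩
        ρ ^ (i′ ℕ.∸ j′) * ρ ^ m               ≈⟨ trans (*-congˡ ρ^m≈1) (*-identityʳ _) ⟩
        ρ ^ (i′ ℕ.∸ j′)                       ∎)
        where
        begin-nat : i′ ℕ.+ (m ℕ.∸ j′) ≡ (i′ ℕ.∸ j′) ℕ.+ m
        begin-nat = ≡.trans (≡.cong (ℕ._+ (m ℕ.∸ j′)) (≡.sym (ℕₚ.m∸n+n≡m (ℕₚ.<⇒≤ j<i))))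
          (≡.trans (ℕₚ.+-assoc (i′ ℕ.∸ j′) j′ _) (≡.cong (i′ ℕ.∸ j′ ℕ.+_) (ℕₚ.m+[n∸m]≡n j≤m)))

module Arithmetic where
  open import Data.Nat as ℕ using (ℕ; zero; suc; _+_; _*_; _^_; _∸_; _<_; _≤_; _%_; _/_; NonZero; z≤n; s≤s)
  open import Data.Nat.Properties
  open import Data.Nat.DivMod
  open import Data.Nat.Divisibility
  open import Data.Nat.Induction using (<-rec)
  open import Data.Nat.Primality using (Prime; euclidsLemma; prime⇒nonZero; prime⇒nonTrivial)
  open import Data.Fin using (toℕ; fromℕ<)
  import Data.Fin.Properties as Finₚ
  open import Data.List using (List; []; _∷_; _++_; map; filter; upTo; concat; length)
  open import Data.List.Properties using (filter-notAll)
  open import Data.List.Membership.Propositional using (_∈_)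
  open import Data.List.Membership.Propositional.Properties
  open import Data.List.Membership.Propositional.Properties.WithK using (unique∧set⇒bag)
  open import Data.List.Membership.DecPropositional ℕ._≟_ using (_∈?_)
  open import Data.List.Relation.Unary.Any using (here; there)
  open import Data.List.Relation.Unary.All as All using (All; []; _∷_)
  open import Data.List.Relation.Unary.AllPairs using ([]; _∷_)
  open import Data.List.Relation.Unary.Unique.Propositional using (Unique)
  import Data.List.Relation.Unary.Unique.Propositional.Properties as Unique
  open import Data.List.Relation.Binary.BagAndSetEquality using (∼bag⇒↭)
  open import Data.List.Relation.Binary.Permutation.Propositional using (_↭_; ↭-refl; ↭-trans; ↭-sym)
  open import Data.List.Relation.Binary.Permutation.Propositional.Properties using (++⁺ˡ; ++⁺ʳ)
  open import Data.Sum using (_⊎_; inj₁; inj₂)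
  open import Data.Product using (∃; ∃₂; _,_; _×_; proj₁; proj₂)
  open import Function using (_∘_; mk⇔)
  open import Relation.Nullary using (¬_; yes; no; contradiction; Dec; ¬?)
  open import Relation.Unary using (Decidable)
  open import Relation.Binary using (tri<; tri≈; tri>)
  open import Relation.Binary.PropositionalEquality

  unique-↭ : ∀ {xs ys : List ℕ} → Unique xs → Unique ys →
    (∀ {x} → x ∈ xs → x ∈ ys) → (∀ {x} → x ∈ ys → x ∈ xs) → xs ↭ ys
  unique-↭ uxs uys f g = ∼bag⇒↭ (unique∧set⇒bag uxs uys (mk⇔ f g))

  unique-map : ∀ (f : ℕ → ℕ) {xs} → (∀ {x y} → x ∈ xs → y ∈ xs → f x ≡ f y → x ≡ y) →
    Unique xs → Unique (map f xs)
  unique-map f inj []           = []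
  unique-map f {x ∷ xs} inj (x≢ ∷ uxs) =
    All.tabulate (λ fy∈ → let (y , y∈ , e) = ∈-map⁻ f fy∈ in λ fx≡ →
      All.lookup x≢ y∈ (inj (here refl) (there y∈) (trans fx≡ e))) ∷
    unique-map f (λ x∈ y∈ → inj (there x∈) (there y∈)) uxs

  partition-↭ : ∀ {P : ℕ → Set} (P? : Decidable P) {xs} → Unique xs →
    filter P? xs ++ filter (¬? ∘ P?) xs ↭ xs
  partition-↭ P? {xs} uxs = unique-↭
    (Unique.++⁺ (Unique.filter⁺ P? uxs) (Unique.filter⁺ (¬? ∘ P?) uxs)
      (λ (a , b) → proj₂ (∈-filter⁻ (¬? ∘ P?) {xs = xs} b) (proj₂ (∈-filter⁻ P? {xs = xs} a))))
    uxs to from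
    where
    to : ∀ {x} → x ∈ filter P? xs ++ filter (¬? ∘ P?) xs → x ∈ xs
    to x∈ with ∈-++⁻ (filter P? xs) x∈
    ... | inj₁ h = proj₁ (∈-filter⁻ P? h)
    ... | inj₂ h = proj₁ (∈-filter⁻ (¬? ∘ P?) h)
    from : ∀ {x} → x ∈ xs → x ∈ filter P? xs ++ filter (¬? ∘ P?) xs
    from {x} x∈ with P? x
    ... | yes px = ∈-++⁺ˡ (∈-filter⁺ P? x∈ px)
    ... | no ¬px = ∈-++⁺ʳ (filter P? xs) (∈-filter⁺ (¬? ∘ P?) x∈ ¬px)

  ∃-least : ∀ {P : ℕ → Set} → Decidable P → ∀ n → P n → ∃ λ m → P m × (∀ {k} → k < m → ¬ P k)
  ∃-least {P} P? = <-rec _ λ n rec pn → case n rec pn (anyUpTo? P? n)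
    where
    case : ∀ n → (∀ {m} → m < n → P m → ∃ λ m → P m × (∀ {k} → k < m → ¬ P k)) → P n →
      Dec (∃ λ m → m < n × P m) → ∃ λ m → P m × (∀ {k} → k < m → ¬ P k)
    case n rec pn (yes (m , m<n , pm)) = rec m<n pm
    case n rec pn (no none)            = n , pn , λ {k} k<n pk → none (k , k<n , pk)

  even∨odd : ∀ n → (∃ λ h → n ≡ h + h) ⊎ n % 2 ≡ 1
  even∨odd zero          = inj₁ (0 , refl)
  even∨odd (suc zero)    = inj₂ refl
  even∨odd (suc (suc n)) with even∨odd n
  ... | inj₁ (h , e) = inj₁ (suc h , cong suc (trans (cong suc e) (sym (+-suc h h))))
  ... | inj₂ e       = inj₂ (trans (cong (_% 2) (+-comm 2 n)) (trans ([m+n]%n≡m%n n 2) e))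

  module _ {n} .{{_ : NonZero n}} where
    %-∣-∸ : ∀ {x y} → x ≤ y → x % n ≡ y % n → n ∣ y ∸ x
    %-∣-∸ {x} {y} x≤y e = divides (y / n ∸ x / n) (begin
      y ∸ x                                          ≡⟨ cong₂ _∸_ (m≡m%n+[m/n]*n y n) (m≡m%n+[m/n]*n x n) ⟩
      (y % n + y / n * n) ∸ (x % n + x / n * n)      ≡⟨ cong (λ r → (r + y / n * n) ∸ (x % n + x / n * n)) (sym e) ⟩
      (x % n + y / n * n) ∸ (x % n + x / n * n)      ≡⟨ [m+n]∸[m+o]≡n∸o (x % n) _ _ ⟩
      y / n * n ∸ x / n * n                          ≡⟨ *-distribʳ-∸ n (y / n) (x / n) ⟨
      (y / n ∸ x / n) * n                            ∎)
      where open ≡-Reasoning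

    ∸-∣-% : ∀ {x y} → x ≤ y → n ∣ y ∸ x → x % n ≡ y % n
    ∸-∣-% {x} {y} x≤y n∣ = trans (sym (%-remove-+ʳ x n∣)) (cong (_% n) (m+[n∸m]≡n x≤y))

    %-cong-* : ∀ {x x′ y y′} → x % n ≡ x′ % n → y % n ≡ y′ % n → (x * y) % n ≡ (x′ * y′) % n
    %-cong-* {x} {x′} {y} {y′} e f = trans (%-distribˡ-* x y n)
      (trans (cong₂ (λ a b → (a * b) % n) e f) (sym (%-distribˡ-* x′ y′ n)))

    %-cong-^ : ∀ {x y} → x % n ≡ y % n → ∀ k → (x ^ k) % n ≡ (y ^ k) % n
    %-cong-^ e zero    = refl
    %-cong-^ {x} {y} e (suc k) = %-cong-* {x} {y} e (%-cong-^ e k)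

    %-^-1 : ∀ {x} → x % n ≡ 1 % n → ∀ k → (x ^ k) % n ≡ 1 % n
    %-^-1 e k = trans (%-cong-^ e k) (cong (_% n) (^-zeroˡ k))

    <⇒%-injective : ∀ {x y} → x < n → y < n → x % n ≡ y % n → x ≡ y
    <⇒%-injective x<n y<n e = trans (sym (m<n⇒m%n≡m x<n)) (trans e (m<n⇒m%n≡m y<n))

  module PrimePower (p : ℕ) (pp : Prime p) where
    private instance
      p≢0 : NonZero p
      p≢0 = prime⇒nonZero pp

    1<p : 1 < p
    1<p = ℕ.nonTrivial⇒n>1 p {{prime⇒nonTrivial pp}}

    p∤1 : ¬ (p ∣ 1)
    p∤1 h = <⇒≱ 1<p (∣⇒≤ h)

    p∤* : ∀ {x y} → ¬ (p ∣ x) → ¬ (p ∣ y) → ¬ (p ∣ x * y)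
    p∤* {x} {y} p∤x p∤y h with euclidsLemma x y pp h
    ... | inj₁ p∣x = p∤x p∣x
    ... | inj₂ p∣y = p∤y p∣y

    p∤^ : ∀ {x} → ¬ (p ∣ x) → ∀ k → ¬ (p ∣ x ^ k)
    p∤^ p∤x zero    = p∤1
    p∤^ p∤x (suc k) = p∤* p∤x (p∤^ p∤x k)

    p∣^⇒p∣ : ∀ {x} k → p ∣ x ^ k → p ∣ x
    p∣^⇒p∣ zero    h = contradiction h p∤1
    p∣^⇒p∣ {x} (suc k) h with euclidsLemma x (x ^ k) pp h
    ... | inj₁ p∣x = p∣x
    ... | inj₂ h′  = p∣^⇒p∣ k h′

    p^a∣xy⇒p^a∣y : ∀ a {x y} → ¬ (p ∣ x) → p ^ a ∣ x * y → p ^ a ∣ y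
    p^a∣xy⇒p^a∣y zero    p∤x h = 1∣ _
    p^a∣xy⇒p^a∣y (suc a) {x} {y} p∤x h with euclidsLemma x y pp (m*n∣⇒m∣ p (p ^ a) h)
    ... | inj₁ p∣x = contradiction p∣x p∤x
    ... | inj₂ (divides y′ refl) = subst (p * p ^ a ∣_) (*-comm p y′) (*-monoʳ-∣ p
      (p^a∣xy⇒p^a∣y a p∤x (*-cancelˡ-∣ p (subst (p * p ^ a ∣_)
        (trans (sym (*-assoc x y′ p)) (*-comm (x * y′) p)) h))))

    ^-∣-cancel : ∀ a b {m} → p ^ a ∣ p ^ b * m → ¬ (p ∣ m) → a ≤ b
    ^-∣-cancel zero    b       h p∤m = z≤n
    ^-∣-cancel (suc a) zero    h p∤m = contradiction (subst (p ∣_) (*-identityˡ _) (m*n∣⇒m∣ p (p ^ a) h)) p∤m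
    ^-∣-cancel (suc a) (suc b) {m} h p∤m = s≤s (^-∣-cancel a b
      (*-cancelˡ-∣ p (subst (p * p ^ a ∣_) (*-assoc p (p ^ b) m) h)) p∤m)

    module Modulus (i : ℕ) where
      P n : ℕ
      P = p ^ i
      n = p * P

      instance
        P≢0 : NonZero P
        P≢0 = m^n≢0 p i
        n≢0 : NonZero n
        n≢0 = m*n≢0 p P

      0<P : 0 < P
      0<P = ℕ.>-nonZero⁻¹ P

      1<n : 1 < n
      1<n = <-≤-trans 1<p (m≤m*n p P)

      P<n : P < n
      P<n = subst (_< p * P) (*-identityˡ P) (*-monoˡ-< P 1<p)

      p∣n : p ∣ n
      p∣n = m∣m*n P

      %-cancelˡ : ∀ {k x y} → ¬ (p ∣ k) → (k * x) % n ≡ (k * y) % n → x % n ≡ y % n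
      %-cancelˡ {k} {x} {y} p∤k e with ≤-total x y
      ... | inj₁ x≤y = ∸-∣-% x≤y (p^a∣xy⇒p^a∣y (suc i) p∤k
              (subst (n ∣_) (sym (*-distribˡ-∸ k y x)) (%-∣-∸ (*-monoʳ-≤ k x≤y) e)))
      ... | inj₂ y≤x = sym (∸-∣-% y≤x (p^a∣xy⇒p^a∣y (suc i) p∤k
              (subst (n ∣_) (sym (*-distribˡ-∸ k x y)) (%-∣-∸ (*-monoʳ-≤ k y≤x) (sym e)))))

      p∤-%⁺ : ∀ {k} → ¬ (p ∣ k) → ¬ (p ∣ k % n)
      p∤-%⁺ p∤k h = p∤k (∣n∣m%n⇒∣m p∣n h)

      units : List ℕ
      units = filter (λ k → ¬? (p ∣? k)) (upTo n)

      units-unique : Unique units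
      units-unique = Unique.filter⁺ _ (Unique.upTo⁺ n)

      ∈-units⁺ : ∀ {k} → k < n → ¬ (p ∣ k) → k ∈ units
      ∈-units⁺ k<n p∤k = ∈-filter⁺ _ (∈-upTo⁺ k<n) p∤k

      ∈-units⁻ : ∀ {k} → k ∈ units → k < n × ¬ (p ∣ k)
      ∈-units⁻ k∈ with h , p∤k ← ∈-filter⁻ (λ k → ¬? (p ∣? k)) k∈ = ∈-upTo⁻ h , p∤k

      %-units : ∀ {k} → ¬ (p ∣ k) → k % n ∈ units
      %-units p∤k = ∈-units⁺ (m%n<n _ n) (p∤-%⁺ p∤k)

      1∈units : 1 ∈ units
      1∈units = ∈-units⁺ 1<n p∤1

      upTo-↭ : units ++ map (p *_) (upTo P) ↭ upTo n
      upTo-↭ = unique-↭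
        (Unique.++⁺ units-unique (Unique.map⁺ (*-cancelˡ-≡ _ _ p) (Unique.upTo⁺ P)) disjoint)
        (Unique.upTo⁺ n) to from
        where
        disjoint : ∀ {x} → ¬ (x ∈ units × x ∈ map (p *_) (upTo P))
        disjoint (a , b) with _ , _ , refl ← ∈-map⁻ (p *_) b = proj₂ (∈-units⁻ a) (m∣m*n _)
        to : ∀ {x} → x ∈ units ++ map (p *_) (upTo P) → x ∈ upTo n
        to x∈ with ∈-++⁻ units x∈
        ... | inj₁ h = ∈-upTo⁺ (proj₁ (∈-units⁻ h))
        ... | inj₂ h with y , y∈ , refl ← ∈-map⁻ (p *_) h = ∈-upTo⁺ (*-monoʳ-< p (∈-upTo⁻ y∈))
        from : ∀ {x} → x ∈ upTo n → x ∈ units ++ map (p *_) (upTo P)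
        from {x} x∈ with p ∣? x
        ... | no p∤x = ∈-++⁺ˡ (∈-units⁺ (∈-upTo⁻ x∈) p∤x)
        ... | yes (divides y refl) = ∈-++⁺ʳ units (subst (_∈ map (p *_) (upTo P)) (*-comm p y)
                (∈-map⁺ (p *_) (∈-upTo⁺ (*-cancelˡ-< p y P (subst (_< n) (*-comm y p) (∈-upTo⁻ x∈))))))

      module _ {q} (p∤q : ¬ (p ∣ q)) where
        private abstract
          periodic : ∃ λ f → 0 < f × (q ^ f) % n ≡ 1 % n
          periodic with Finₚ.pigeonhole {n} {suc n} ≤-refl (λ j → fromℕ< (m%n<n (q ^ toℕ j) n))
          ... | a , b , a<b , e = toℕ b ∸ toℕ a , m<n⇒0<n∸m a<b ,
                %-cancelˡ (p∤^ p∤q (toℕ a)) (trans (cong (_% n) (trans (sym (^-distribˡ-+-* q (toℕ a) _)) (cong (q ^_) (m+[n∸m]≡n (<⇒≤ a<b)))))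
                  (trans (sym (trans (sym (Finₚ.toℕ-fromℕ< _)) (trans (cong toℕ e) (Finₚ.toℕ-fromℕ< _))))
                         (cong (_% n) (sym (*-identityʳ (q ^ toℕ a))))))

          least : ∃ λ f → (0 < f × (q ^ f) % n ≡ 1 % n) × (∀ {k} → k < f → ¬ (0 < k × (q ^ k) % n ≡ 1 % n))
          least = ∃-least decide (proj₁ periodic) (proj₂ periodic)
            where
            decide : Decidable (λ f → 0 < f × (q ^ f) % n ≡ 1 % n)
            decide f with 0 <? f | (q ^ f) % n ≟ 1 % n
            ... | yes a | yes b = yes (a , b)
            ... | no ¬a | _     = no (¬a ∘ proj₁)
            ... | _     | no ¬b = no (¬b ∘ proj₂)

        order : ℕ
        order = proj₁ least

        0<order : 0 < order
        0<order = proj₁ (proj₁ (proj₂ least))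

        q^order≡1 : (q ^ order) % n ≡ 1 % n
        q^order≡1 = proj₂ (proj₁ (proj₂ least))

        order-minimal : ∀ {k} → 0 < k → k < order → (q ^ k) % n ≢ 1 % n
        order-minimal 0<k k<f e = proj₂ (proj₂ least) k<f (0<k , e)

        orbit : ℕ → List ℕ
        orbit x = map (λ j → (x * q ^ j) % n) (upTo order)

        private
          instance
            order≢0 : NonZero order
            order≢0 = ℕ.>-nonZero 0<order

          powers-injective : ∀ {x} → ¬ (p ∣ x) → ∀ {j k} → j < k → k < order → (x * q ^ j) % n ≢ (x * q ^ k) % n
          powers-injective p∤x {j} {k} j<k k<f e = order-minimal (m<n⇒0<n∸m j<k) (≤-<-trans (m∸n≤m k j) k<f)
            (sym (%-cancelˡ (p∤^ p∤q j) (trans (cong (_% n) (*-identityʳ (q ^ j))) (trans (%-cancelˡ p∤x e)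
              (cong (_% n) (sym (trans (sym (^-distribˡ-+-* q j (k ∸ j))) (cong (q ^_) (m+[n∸m]≡n (<⇒≤ j<k))))))))))

          q^-% : ∀ k → (q ^ k) % n ≡ (q ^ (k % order)) % n
          q^-% k = begin
            (q ^ k) % n                                   ≡⟨ cong (λ e → (q ^ e) % n) (m≡m%n+[m/n]*n k order) ⟩
            (q ^ (k % order + k / order * order)) % n     ≡⟨ cong (_% n) (^-distribˡ-+-* q (k % order) _) ⟩
            (q ^ (k % order) * q ^ (k / order * order)) % n
              ≡⟨ %-cong-* {n} {x = q ^ (k % order)} refl (trans (cong (λ e → (q ^ e) % n) (*-comm (k / order) order))
                   (trans (cong (_% n) (sym (^-*-assoc q order (k / order)))) (%-^-1 q^order≡1 (k / order)))) ⟩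
            (q ^ (k % order) * 1) % n                     ≡⟨ cong (_% n) (*-identityʳ _) ⟩
            (q ^ (k % order)) % n                         ∎
            where open ≡-Reasoning

          ∈-orbit : ∀ x k → (x * q ^ k) % n ∈ orbit x
          ∈-orbit x k = subst (_∈ orbit x) (sym (%-cong-* {n} {x = x} refl (q^-% k)))
            (∈-map⁺ _ (∈-upTo⁺ (m%n<n k order)))

          orbit-unique : ∀ {x} → ¬ (p ∣ x) → Unique (orbit x)
          orbit-unique {x} p∤x = unique-map _ injective (Unique.upTo⁺ order)
            where
            injective : ∀ {j k} → j ∈ upTo order → k ∈ upTo order → (x * q ^ j) % n ≡ (x * q ^ k) % n → j ≡ k
            injective {j} {k} j∈ k∈ e with <-cmp j k
            ... | tri< j<k _ _ = contradiction e (powers-injective p∤x j<k (∈-upTo⁻ k∈))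
            ... | tri≈ _ j≡k _ = j≡k
            ... | tri> _ _ k<j = contradiction (sym e) (powers-injective p∤x k<j (∈-upTo⁻ j∈))

          Closed : List ℕ → Set
          Closed xs = ∀ {x} → x ∈ xs → x ∈ units × (∀ j → (x * q ^ j) % n ∈ xs)

          decompose : ∀ m xs → length xs ≤ m → Unique xs → Closed xs →
            ∃ λ reps → (∀ {x} → x ∈ reps → x ∈ units) × xs ↭ concat (map orbit reps)
          decompose m [] _ _ _ = [] , (λ ()) , ↭-refl
          decompose (suc m) L@(x ∷ xs) (s≤s len) uL closed =
            x ∷ proj₁ rec ,
            (λ { (here refl) → proj₁ (closed (here refl)) ; (there y∈) → proj₁ (proj₂ rec) y∈ }) ,
            ↭-trans (↭-sym (partition-↭ (_∈? orbit x) uL))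
              (↭-trans (++⁺ʳ rest in-orbit)
                       (++⁺ˡ (orbit x) (proj₂ (proj₂ rec))))
            where
            p∤x : ¬ (p ∣ x)
            p∤x = proj₂ (∈-units⁻ (proj₁ (closed (here refl))))
            rest : List ℕ
            rest = filter (¬? ∘ (_∈? orbit x)) L
            x∈orbit : x ∈ orbit x
            x∈orbit = subst (_∈ orbit x) (trans (cong (_% n) (*-identityʳ x))
              (m<n⇒m%n≡m (proj₁ (∈-units⁻ (proj₁ (closed (here refl))))))) (∈-orbit x 0)
            in-orbit : filter (_∈? orbit x) L ↭ orbit x
            in-orbit = unique-↭ (Unique.filter⁺ (_∈? orbit x) uL) (orbit-unique p∤x)
              (λ y∈ → proj₂ (∈-filter⁻ (_∈? orbit x) {xs = L} y∈))
              (λ y∈ → ∈-filter⁺ (_∈? orbit x) (orbit⊆ y∈) y∈)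
              where
              orbit⊆ : ∀ {y} → y ∈ orbit x → y ∈ L
              orbit⊆ y∈ with j , _ , refl ← ∈-map⁻ _ y∈ = proj₂ (closed (here refl)) j
            rest-closed : Closed rest
            rest-closed {y} y∈ with y∈L , y∉ ← ∈-filter⁻ (¬? ∘ (_∈? orbit x)) {xs = L} y∈ =
              proj₁ (closed y∈L) , λ j → ∈-filter⁺ (¬? ∘ (_∈? orbit x)) (proj₂ (closed y∈L) j) (y∉ ∘ back j)
              where
              y≡ : y % n ≡ y
              y≡ = m<n⇒m%n≡m (proj₁ (∈-units⁻ (proj₁ (closed (proj₁ (∈-filter⁻ (¬? ∘ (_∈? orbit x)) {xs = L} y∈))))))
              -- Multiplying by q^((order ∸ 1) j) inverts multiplication by q^j.
              back : ∀ j → (y * q ^ j) % n ∈ orbit x → y ∈ orbit x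
              back j h with k , _ , e ← ∈-map⁻ _ h = subst (_∈ orbit x) eq (∈-orbit x (k + j′))
                where
                open ≡-Reasoning
                j′ = (order ∸ 1) * j
                eq : (x * q ^ (k + j′)) % n ≡ y
                eq = begin
                  (x * q ^ (k + j′)) % n         ≡⟨ cong (_% n) (trans (cong (x *_) (^-distribˡ-+-* q k j′)) (sym (*-assoc x (q ^ k) _))) ⟩
                  (x * q ^ k * q ^ j′) % n       ≡⟨ %-cong-* {n} {x = (y * q ^ j) % n} (trans (m%n%n≡m%n (y * q ^ j) n) e) refl ⟨
                  ((y * q ^ j) % n * q ^ j′) % n ≡⟨ %-cong-* {n} {x = (y * q ^ j) % n} (m%n%n≡m%n (y * q ^ j) n) refl ⟩
                  (y * q ^ j * q ^ j′) % n       ≡⟨ cong (_% n) (trans (*-assoc y _ _) (cong (y *_) (sym (^-distribˡ-+-* q j j′)))) ⟩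
                  (y * q ^ (j + j′)) % n         ≡⟨ cong (λ e → (y * q ^ e) % n) (cong (_* j) (m+[n∸m]≡n 0<order)) ⟩
                  (y * q ^ (order * j)) % n      ≡⟨ %-cong-* {n} {x = y} refl (trans (cong (_% n) (sym (^-*-assoc q order j))) (%-^-1 q^order≡1 j)) ⟩
                  (y * 1) % n                    ≡⟨ trans (cong (_% n) (*-identityʳ y)) y≡ ⟩
                  y                              ∎
            shorter : length rest < suc (length xs)
            shorter = filter-notAll (¬? ∘ (_∈? orbit x)) L (here (λ x∉ → x∉ x∈orbit))
            rec : ∃ λ reps → (∀ {x} → x ∈ reps → x ∈ units) × rest ↭ concat (map orbit reps)
            rec = decompose m rest (≤-trans (s<s⁻¹′ shorter) len) (Unique.filter⁺ (¬? ∘ (_∈? orbit x)) uL) rest-closed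
              where
              s<s⁻¹′ : ∀ {a b} → a < suc b → a ≤ b
              s<s⁻¹′ (s≤s h) = h

        units-↭-orbits : ∃ λ reps → (∀ {x} → x ∈ reps → x ∈ units) × units ↭ concat (map orbit reps)
        units-↭-orbits = decompose (length units) units ≤-refl units-unique
          (λ {x} x∈ → x∈ , λ j → %-units (p∤* (proj₂ (∈-units⁻ x∈)) (p∤^ p∤q j)))

        ∃-inverse : ∃ λ h → (h * q) % n ≡ 1 % n
        ∃-inverse = q ^ (order ∸ 1) , trans (cong (_% n) (trans (*-comm (q ^ (order ∸ 1)) q) (cong (q ^_) (m+[n∸m]≡n 0<order)))) q^order≡1

        n∣q^order∸1 : n ∣ q ^ order ∸ 1
        n∣q^order∸1 = %-∣-∸ {n} (m^n>0 q {{q≢0}} order) (sym q^order≡1)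
          where
          q≢0 : NonZero q
          q≢0 = ℕ.≢-nonZero λ q≡0 → p∤q (subst (p ∣_) (sym q≡0) (p ∣0))

        units-*-↭ : map (λ k → (q * k) % n) units ↭ units
        units-*-↭ = unique-↭ (unique-map _ injective units-unique) units-unique to from
          where
          injective : ∀ {x y} → x ∈ units → y ∈ units → (q * x) % n ≡ (q * y) % n → x ≡ y
          injective x∈ y∈ e = <⇒%-injective (proj₁ (∈-units⁻ x∈)) (proj₁ (∈-units⁻ y∈)) (%-cancelˡ p∤q e)
          to : ∀ {x} → x ∈ map (λ k → (q * k) % n) units → x ∈ units
          to x∈ with k , k∈ , refl ← ∈-map⁻ _ x∈ = %-units (p∤* p∤q (proj₂ (∈-units⁻ k∈)))
          from : ∀ {x} → x ∈ units → x ∈ map (λ k → (q * k) % n) units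
          from {x} x∈ = subst (_∈ map (λ k → (q * k) % n) units)
            (trans (%-cong-* {n} {x = q} refl (m%n%n≡m%n (h * x) n))
              (trans (cong (_% n) (trans (sym (*-assoc q h x)) (cong (_* x) (*-comm q h))))
                (trans (%-cong-* {n} {x = h * q} {y = x} (proj₂ ∃-inverse) refl)
                  (trans (cong (_% n) (*-identityˡ x)) (m<n⇒m%n≡m (proj₁ (∈-units⁻ x∈)))))))
            (∈-map⁺ (λ k → (q * k) % n) (%-units (p∤* p∤h (proj₂ (∈-units⁻ x∈)))))
            where
            h : ℕ
            h = proj₁ ∃-inverse
            p∤h : ¬ (p ∣ h)
            p∤h = p∤^ p∤q (order ∸ 1)

        -- A square root of 1 modulo an odd prime power is ±1.
        q^h≡-1 : 2 < p → ∀ h → order ≡ h + h → n ∣ q ^ h + 1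
        q^h≡-1 2<p h e with p ∣? (q ^ h ∸ 1)
        ... | no p∤  = p^a∣xy⇒p^a∣y (suc i) p∤ (subst (n ∣_) square n∣q^order∸1)
          where
          open ≡-Reasoning
          square : q ^ order ∸ 1 ≡ (q ^ h ∸ 1) * (q ^ h + 1)
          square = begin
            q ^ order ∸ 1                             ≡⟨ cong (λ k → q ^ k ∸ 1) e ⟩
            q ^ (h + h) ∸ 1                           ≡⟨ cong (_∸ 1) (^-distribˡ-+-* q h h) ⟩
            x * x ∸ 1                                 ≡⟨ [m+n]∸[m+o]≡n∸o x (x * x) 1 ⟨
            (x + x * x) ∸ (x + 1)                     ≡⟨ cong₂ _∸_ (trans (sym (*-suc x x)) (cong (x *_) (+-comm 1 x))) (sym (*-identityˡ (x + 1))) ⟩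
            x * (x + 1) ∸ 1 * (x + 1)                 ≡⟨ *-distribʳ-∸ (x + 1) x 1 ⟨
            (x ∸ 1) * (x + 1)                         ∎
            where
            x : ℕ
            x = q ^ h
        ... | yes p∣ = contradiction (sym (∸-∣-% 1≤q^h (p^a∣xy⇒p^a∣y (suc i) p∤+1 (subst (n ∣_) square n∣q^order∸1)))) (order-minimal 0<h h<f)
          where
          x : ℕ
          x = q ^ h
          0<h : 0 < h
          0<h = n≢0⇒n>0 λ h≡0 → <⇒≢ 0<order (sym (trans e (cong₂ _+_ h≡0 h≡0)))
          h<f : h < order
          h<f = subst (h <_) (sym e) (m<m+n h 0<h)
          1≤q^h : 1 ≤ x
          1≤q^h = m^n>0 q {{ℕ.≢-nonZero λ q≡0 → p∤q (subst (p ∣_) (sym q≡0) (p ∣0))}} h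
          p∤+1 : ¬ (p ∣ x + 1)
          p∤+1 p∣′ = <⇒≱ 2<p (∣⇒≤ (∣m+n∣m⇒∣n (subst (p ∣_) (begin
            x + 1               ≡⟨ cong (_+ 1) (m∸n+n≡m 1≤q^h) ⟨
            (x ∸ 1) + 1 + 1     ≡⟨ +-assoc (x ∸ 1) 1 1 ⟩
            (x ∸ 1) + 2         ∎) p∣′) p∣))
            where open ≡-Reasoning
          square : q ^ order ∸ 1 ≡ (x + 1) * (x ∸ 1)
          square = begin
            q ^ order ∸ 1                             ≡⟨ cong (λ k → q ^ k ∸ 1) e ⟩
            q ^ (h + h) ∸ 1                           ≡⟨ cong (_∸ 1) (^-distribˡ-+-* q h h) ⟩
            x * x ∸ 1                                 ≡⟨ [m+n]∸[m+o]≡n∸o x (x * x) 1 ⟨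
            (x + x * x) ∸ (x + 1)                     ≡⟨ cong₂ _∸_ (trans (sym (*-suc x x)) (trans (cong (x *_) (+-comm 1 x)) (*-comm x (x + 1)))) (sym (*-identityʳ (x + 1))) ⟩
            (x + 1) * x ∸ (x + 1) * 1                 ≡⟨ *-distribˡ-∸ (x + 1) x 1 ⟨
            (x + 1) * (x ∸ 1)                         ∎
            where open ≡-Reasoning

    ∃-multiple≡P : ∀ i {k} → ¬ (p * p ^ i ∣ k) → ∃₂ λ c d → c * k ≡ p ^ i + d * (p * p ^ i)
    ∃-multiple≡P i {k} n∤k with p ∣? k
    ∃-multiple≡P i {k} n∤k | no p∤k with h , e ← Modulus.∃-inverse i {k} p∤k =
      P * h , P * ((h * k) / n) , (begin
        P * h * k                              ≡⟨ *-assoc P h k ⟩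
        P * (h * k)                            ≡⟨ cong (P *_) (trans (m≡m%n+[m/n]*n (h * k) n) (cong (_+ (h * k) / n * n) (trans e (m<n⇒m%n≡m 1<n)))) ⟩
        P * (1 + (h * k) / n * n)              ≡⟨ *-distribˡ-+ P 1 _ ⟩
        P * 1 + P * ((h * k) / n * n)          ≡⟨ cong₂ _+_ (*-identityʳ P) (sym (*-assoc P _ n)) ⟩
        P + P * ((h * k) / n) * n              ∎)
      where
      open Modulus i
      open ≡-Reasoning
    ∃-multiple≡P zero    {k} n∤k | yes p∣k = contradiction (subst (_∣ k) (sym (*-identityʳ p)) p∣k) n∤k
    ∃-multiple≡P (suc i) {k} n∤k | yes (divides k′ refl)
      with c , d , e ← ∃-multiple≡P i {k′} (λ h → n∤k (subst (p * (p * p ^ i) ∣_) (*-comm p k′) (*-monoʳ-∣ p h))) =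
      c , d , (begin
        c * (k′ * p)                              ≡⟨ trans (sym (*-assoc c k′ p)) (*-comm (c * k′) p) ⟩
        p * (c * k′)                              ≡⟨ cong (p *_) e ⟩
        p * (p ^ i + d * (p * p ^ i))             ≡⟨ *-distribˡ-+ p (p ^ i) _ ⟩
        p * p ^ i + p * (d * (p * p ^ i))         ≡⟨ cong (_+_ (p * p ^ i)) (trans (sym (*-assoc p d _)) (trans (cong (_* (p * p ^ i)) (*-comm p d)) (*-assoc d p _))) ⟩
        p * p ^ i + d * (p * (p * p ^ i))         ∎)
      where open ≡-Reasoning

open Arithmetic

module Polynomial where
  open import Level using (0ℓ)
  open import Algebra.Bundles using (CommutativeRing)
  open import Data.Nat as ℕ using (ℕ; zero; suc; NonZero)
  import Data.Nat.Properties as ℕₚ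
  import Data.Nat.Divisibility as ℕD
  open import Data.Nat.DivMod using (_%_; m%n<n; [m+n]%n≡m%n; m<n⇒m%n≡m; m%n%n≡m%n; %-congʳ)
  open import Data.Nat.Primality using (Prime; prime⇒nonZero)
  open import Data.Integer using (ℤ; +_; _+_; _*_; -_; _-_)
  import Data.Integer.Properties as ℤₚ
  open import Data.List using (map; upTo)
  open import Data.List.Membership.Propositional using (_∈_)
  open import Data.List.Membership.Propositional.Properties using (∈-map⁻; ∈-map⁺; ∈-upTo⁺; ∈-upTo⁻)
  import Data.List.Relation.Unary.Unique.Propositional.Properties as Unique
  open import Data.List.Relation.Binary.Permutation.Propositional using (_↭_)
  open import Data.Product using (∃; _,_; proj₁; proj₂)
  open import Function using (_∘_)
  open import Relation.Nullary using (¬_; yes; no; contradiction; Dec)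
  open import Relation.Binary.PropositionalEquality as ≡ using (_≡_; _≢_; refl; sym; trans; cong; cong₂)

  infixr 2 _≡⟪_⟫_
  infix  3 _□

  _≡⟪_⟫_ : ∀ {A : Set} (x : A) {y z} → x ≡ y → y ≡ z → x ≡ z
  x ≡⟪ e ⟫ e′ = trans e e′

  _□ : ∀ {A : Set} (x : A) → x ≡ x
  x □ = refl

  ℤ-ring : Ringℤ
  ℤ-ring = record
    { commRing = ℤₚ.+-*-commutativeRing ; ι = λ a → a
    ; ι-+ = λ _ _ → refl ; ι-* = λ _ _ → refl ; ι-neg = λ _ → refl ; ι-0 = refl ; ι-1 = refl }

  module ℤK = Kit ℤ-ring
  open ℤK using (Σ; Σ-cong; Σ-+; Σ-*ˡ; Σ-0; Σ-last; Σ-neg; Σ-const; Σ-comm; Σ-split; Σ-blocks; Σ-shift; Σₗ)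

  data Poly : Set where
    con     : ℤ → Poly
    X       : Poly
    _⊕_ _⊗_ : Poly → Poly → Poly

  infixl 6 _⊕_
  infixl 7 _⊗_

  X^_ : ℕ → Poly
  X^ zero  = con (+ 1)
  X^ suc k = X ⊗ X^ k

  subst : Poly → Poly → Poly
  subst g (con c)  = con c
  subst g X        = g
  subst g (f ⊕ f′) = subst g f ⊕ subst g f′
  subst g (f ⊗ f′) = subst g f ⊗ subst g f′

  at1 : Poly → ℤ
  at1 (con c) = c
  at1 X       = + 1
  at1 (f ⊕ g) = at1 f + at1 g
  at1 (f ⊗ g) = at1 f * at1 g

  -- Polynomials act on integer sequences, X being the shift; ℤ[X]/(f) is dual to the sequences killed by f.
  act : Poly → (ℕ → ℤ) → ℕ → ℤ
  act (con c) φ k = c * φ k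
  act X       φ k = φ (suc k)
  act (f ⊕ g) φ k = act f φ k + act g φ k
  act (f ⊗ g) φ   = act f (act g φ)

  act-cong : ∀ f {φ ψ} → (∀ k → φ k ≡ ψ k) → ∀ k → act f φ k ≡ act f ψ k
  act-cong (con c) e k = cong (c *_) (e k)
  act-cong X       e k = e (suc k)
  act-cong (f ⊕ g) e k = cong₂ _+_ (act-cong f e k) (act-cong g e k)
  act-cong (f ⊗ g) e   = act-cong f (act-cong g e)

  act-+ : ∀ f φ ψ k → act f (λ j → φ j + ψ j) k ≡ act f φ k + act f ψ k
  act-+ (con c) φ ψ k = ℤₚ.*-distribˡ-+ c (φ k) (ψ k)
  act-+ X       φ ψ k = refl
  act-+ (f ⊕ g) φ ψ k = trans (cong₂ _+_ (act-+ f φ ψ k) (act-+ g φ ψ k))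
    (ℤK.solve 4 (λ a b c d → (a ℤK.:+ b) ℤK.:+ (c ℤK.:+ d) ℤK.:= (a ℤK.:+ c) ℤK.:+ (b ℤK.:+ d)) refl
      (act f φ k) (act f ψ k) (act g φ k) (act g ψ k))
  act-+ (f ⊗ g) φ ψ k = trans (act-cong f (act-+ g φ ψ) k) (act-+ f (act g φ) (act g ψ) k)

  act-* : ∀ f c φ k → act f (λ j → c * φ j) k ≡ c * act f φ k
  act-* (con a) c φ k = ℤK.solve 3 (λ a c x → a ℤK.:* (c ℤK.:* x) ℤK.:= c ℤK.:* (a ℤK.:* x)) refl a c (φ k)
  act-* X       c φ k = refl
  act-* (f ⊕ g) c φ k = trans (cong₂ _+_ (act-* f c φ k) (act-* g c φ k)) (sym (ℤₚ.*-distribˡ-+ c _ _))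
  act-* (f ⊗ g) c φ k = trans (act-cong f (act-* g c φ) k) (act-* f c (act g φ) k)

  act-comm : ∀ f g φ k → act f (act g φ) k ≡ act g (act f φ) k
  act-comm (con c) g φ k = sym (act-* g c φ k)
  act-comm (f ⊕ f′) g φ k = trans (cong₂ _+_ (act-comm f g φ k) (act-comm f′ g φ k))
    (sym (act-+ g (act f φ) (act f′ φ) k))
  act-comm (f ⊗ f′) g φ k = trans (act-cong f (act-comm f′ g φ) k) (act-comm f g (act f′ φ) k)
  act-comm X (con c) φ k = refl
  act-comm X X       φ k = refl
  act-comm X (f ⊕ g) φ k = cong₂ _+_ (act-comm X f φ k) (act-comm X g φ k)
  act-comm X (f ⊗ g) φ k = trans (act-comm X f (act g φ) k) (act-cong f (act-comm X g φ) k)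

  act-0 : ∀ f {φ} → (∀ k → φ k ≡ + 0) → ∀ k → act f φ k ≡ + 0
  act-0 f {φ} e k = trans (act-cong f {φ} {λ j → + 0 * φ j} (λ j → trans (e j) (sym (ℤₚ.*-zeroˡ (φ j)))) k)
    (trans (act-* f (+ 0) φ k) (ℤₚ.*-zeroˡ (act f φ k)))

  act-Σ : ∀ f m (φ : ℕ → ℕ → ℤ) k → act f (λ j → Σ m (λ l → φ l j)) k ≡ Σ m (λ l → act f (φ l) k)
  act-Σ f zero    φ k = act-0 f (λ _ → refl) k
  act-Σ f (suc m) φ k = trans (act-+ f (φ 0) (λ j → Σ m (λ l → φ (suc l) j)) k) (cong (_+_ (act f (φ 0) k)) (act-Σ f m (φ ∘ suc) k))

  act-shift : ∀ f φ e k → act f (λ j → φ (j ℕ.+ e)) k ≡ act f φ (k ℕ.+ e)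
  act-shift f φ zero    k = trans (act-cong f (λ j → cong φ (ℕₚ.+-identityʳ j)) k)
    (cong (act f φ) (sym (ℕₚ.+-identityʳ k)))
  act-shift f φ (suc e) k = begin
    act f (λ j → φ (j ℕ.+ suc e)) k       ≡⟨ act-cong f (λ j → cong φ (ℕₚ.+-suc j e)) k ⟩
    act f (λ j → φ (suc j ℕ.+ e)) k       ≡⟨ act-comm X f (λ j → φ (j ℕ.+ e)) k ⟨
    act f (λ j → φ (j ℕ.+ e)) (suc k)     ≡⟨ act-shift f φ e (suc k) ⟩
    act f φ (suc k ℕ.+ e)                 ≡⟨ cong (act f φ) (ℕₚ.+-suc k e) ⟨
    act f φ (k ℕ.+ suc e)                 ∎
    where open ≡.≡-Reasoning

  act-X^ : ∀ k φ e → act (X^ k) φ e ≡ φ (e ℕ.+ k)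
  act-X^ zero    φ e = trans (ℤₚ.*-identityˡ _) (cong φ (sym (ℕₚ.+-identityʳ e)))
  act-X^ (suc k) φ e = trans (act-X^ k φ (suc e)) (cong φ (sym (ℕₚ.+-suc e k)))

  act-subst-X^ : ∀ k f φ e j → act (subst (X^ k) f) φ (e ℕ.+ k ℕ.* j) ≡ act f (λ m → φ (e ℕ.+ k ℕ.* m)) j
  act-subst-X^ k (con c) φ e j = refl
  act-subst-X^ k X       φ e j = trans (act-X^ k φ (e ℕ.+ k ℕ.* j)) (cong φ
    (trans (ℕₚ.+-assoc e (k ℕ.* j) k) (cong (e ℕ.+_) (trans (ℕₚ.+-comm (k ℕ.* j) k) (sym (ℕₚ.*-suc k j))))))
  act-subst-X^ k (f ⊕ g) φ e j = cong₂ _+_ (act-subst-X^ k f φ e j) (act-subst-X^ k g φ e j)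
  act-subst-X^ k (f ⊗ g) φ e j = trans (act-subst-X^ k f (act (subst (X^ k) g) φ) e j)
    (act-cong f (act-subst-X^ k g φ e) j)

  act-one : ∀ f k → act f (λ _ → + 1) k ≡ at1 f
  act-one (con c) k = ℤₚ.*-identityʳ c
  act-one X       k = refl
  act-one (f ⊕ g) k = cong₂ _+_ (act-one f k) (act-one g k)
  act-one (f ⊗ g) k = trans
    (trans (act-cong f (λ j → trans (act-one g j) (sym (ℤₚ.*-identityʳ (at1 g)))) k)
      (trans (act-* f (at1 g) (λ _ → + 1) k) (cong (at1 g *_) (act-one f k))))
    (ℤₚ.*-comm (at1 g) (at1 f))

  module Annihilator (p P : ℕ) where
    -- The sequences killed by the polynomial 1 + x^P + ... + x^((p-1)P).
    Ann : (ℕ → ℤ) → Set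
    Ann φ = ∀ e → Σ p (λ c → φ (e ℕ.+ c ℕ.* P)) ≡ + 0

    act-Ann : ∀ f {φ} → Ann φ → Ann (act f φ)
    act-Ann (con c) {φ} a e = trans (sym (Σ-*ˡ p c (λ d → φ (e ℕ.+ d ℕ.* P)))) (trans (cong (c *_) (a e)) (ℤₚ.*-zeroʳ c))
    act-Ann X       a e = a (suc e)
    act-Ann (f ⊕ g) {φ} a e = trans (Σ-+ p (λ d → act f φ (e ℕ.+ d ℕ.* P)) (λ d → act g φ (e ℕ.+ d ℕ.* P)))
      (cong₂ _+_ (act-Ann f a e) (act-Ann g a e))
    act-Ann (f ⊗ g) a = act-Ann f (act-Ann g a)

    infix 4 _≈_
    record _≈_ (f g : Poly) : Set where
      constructor mk
      field at : ∀ φ → Ann φ → ∀ k → act f φ k ≡ act g φ k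
    open _≈_ public

    private
      neg : Poly → Poly
      neg f = con (- + 1) ⊗ f

    ring : CommutativeRing 0ℓ 0ℓ
    ring = record
      { Carrier = Poly ; _≈_ = _≈_ ; _+_ = _⊕_ ; _*_ = _⊗_ ; -_ = neg ; 0# = con (+ 0) ; 1# = con (+ 1)
      ; isCommutativeRing = record
        { isRing = record
          { +-isAbelianGroup = record
            { isGroup = record
              { isMonoid = record
                { isSemigroup = record
                  { isMagma = record
                    { isEquivalence = record
                      { refl  = mk λ _ _ _ → refl
                      ; sym   = λ e → mk λ φ a k → sym (at e φ a k)
                      ; trans = λ e e′ → mk λ φ a k → trans (at e φ a k) (at e′ φ a k) }
                    ; ∙-cong = λ e e′ → mk λ φ a k → cong₂ _+_ (at e φ a k) (at e′ φ a k) }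
                  ; assoc = λ f g h → mk λ φ a k → ℤₚ.+-assoc (act f φ k) (act g φ k) (act h φ k) }
                ; identity = (λ f → mk λ φ a k → ℤₚ.+-identityˡ _) , (λ f → mk λ φ a k → ℤₚ.+-identityʳ _) }
              ; inverse =
                  (λ f → mk λ φ a k → trans (cong (_+ act f φ k) (ℤₚ.-1*i≡-i (act f φ k))) (ℤₚ.+-inverseˡ (act f φ k))) ,
                  (λ f → mk λ φ a k → trans (cong (_+_ (act f φ k)) (ℤₚ.-1*i≡-i (act f φ k))) (ℤₚ.+-inverseʳ (act f φ k)))
              ; ⁻¹-cong = λ e → mk λ φ a k → cong (- + 1 *_) (at e φ a k) }
            ; comm = λ f g → mk λ φ a k → ℤₚ.+-comm (act f φ k) (act g φ k) }
          ; *-cong = λ {f} {f′} {g} {g′} e e′ → mk λ φ a k →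
              trans (act-cong f (at e′ φ a) k) (at e (act g′ φ) (act-Ann g′ a) k)
          ; *-assoc = λ f g h → mk λ φ a k → refl
          ; *-identity = (λ f → mk λ φ a k → ℤₚ.*-identityˡ _) ,
                         (λ f → mk λ φ a k → act-cong f (λ j → ℤₚ.*-identityˡ (φ j)) k)
          ; distrib = (λ f g h → mk λ φ a k → act-+ f (act g φ) (act h φ) k) , (λ f g h → mk λ φ a k → refl) }
        ; *-comm = λ f g → mk λ φ a k → act-comm f g φ k } }

    ringℤ : Ringℤ
    ringℤ = record
      { commRing = ring ; ι = con
      ; ι-+   = λ a b → mk λ φ _ k → ℤₚ.*-distribʳ-+ (φ k) a b
      ; ι-*   = λ a b → mk λ φ _ k → ℤₚ.*-assoc a b (φ k)
      ; ι-neg = λ a → mk λ φ _ k → trans (cong (_* φ k) (sym (ℤₚ.-1*i≡-i a))) (ℤₚ.*-assoc (- + 1) a (φ k))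
      ; ι-0   = mk λ _ _ _ → refl ; ι-1 = mk λ _ _ _ → refl }

    ≈-from-0 : ∀ {f g} → (∀ φ → Ann φ → act f φ 0 ≡ act g φ 0) → f ≈ g
    ≈-from-0 {f} {g} h = mk λ φ a e → trans (sym (act-shift f φ e 0))
      (trans (h (λ j → φ (j ℕ.+ e)) (λ j → trans (Σ-cong p λ c _ → cong φ (swap j (c ℕ.* P) e)) (a (j ℕ.+ e)))) (act-shift g φ e 0))
      where
      swap : ∀ a b c → a ℕ.+ b ℕ.+ c ≡ a ℕ.+ c ℕ.+ b
      swap a b c = trans (ℕₚ.+-assoc a b c) (trans (cong (a ℕ.+_) (ℕₚ.+-comm b c)) (sym (ℕₚ.+-assoc a c b)))

    Ann-periodic : ∀ {φ} → Ann φ → ∀ e → φ (e ℕ.+ p ℕ.* P) ≡ φ e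
    Ann-periodic {φ} a e = begin
      ψ p                                 ≡⟨ ℤₚ.+-identityˡ _ ⟨
      + 0 + ψ p                           ≡⟨ cong (_+ ψ p) (a e) ⟨
      Σ p ψ + ψ p                         ≡⟨ Σ-last p ψ ⟨
      ψ 0 + Σ p (ψ ∘ suc)                 ≡⟨ cong₂ _+_ (cong φ (ℕₚ.+-identityʳ e))
                                               (trans (Σ-cong p λ c _ → cong φ (sym (ℕₚ.+-assoc e P (c ℕ.* P)))) (a (e ℕ.+ P))) ⟩
      φ e + + 0                           ≡⟨ ℤₚ.+-identityʳ _ ⟩
      φ e                                 ∎
      where
      open ≡.≡-Reasoning
      ψ : ℕ → ℤ
      ψ c = φ (e ℕ.+ c ℕ.* P)

    Periodic : (ℕ → ℤ) → Set
    Periodic g = ∀ e → g (e ℕ.+ p ℕ.* P) ≡ g e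

    Periodic-* : ∀ {g} → Periodic g → ∀ k e → g (e ℕ.+ k ℕ.* (p ℕ.* P)) ≡ g e
    Periodic-* {g} per zero    e = cong g (ℕₚ.+-identityʳ e)
    Periodic-* {g} per (suc k) e = trans (cong g (sym (ℕₚ.+-assoc e (p ℕ.* P) _)))
      (trans (Periodic-* per k (e ℕ.+ p ℕ.* P)) (per e))

    -- g - shift^P g is killed, because the sum telescopes.
    difference : (ℕ → ℤ) → ℕ → ℤ
    difference g e = g e - g (e ℕ.+ P)

    difference-Ann : ∀ {g} → Periodic g → Ann (difference g)
    difference-Ann {g} per e = trans (telescope p) (begin
      ψ 0 - ψ p                 ≡⟨ cong₂ _-_ (cong g (ℕₚ.+-identityʳ e)) (per e) ⟩
      g e - g e                 ≡⟨ ℤₚ.+-inverseʳ (g e) ⟩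
      + 0                       ∎)
      where
      open ≡.≡-Reasoning
      ψ : ℕ → ℤ
      ψ c = g (e ℕ.+ c ℕ.* P)
      telescope : ∀ m → Σ m (λ c → difference g (e ℕ.+ c ℕ.* P)) ≡ ψ 0 - ψ m
      telescope zero    = sym (ℤₚ.+-inverseʳ (ψ 0))
      telescope (suc m) = begin
        Σ (suc m) (λ c → difference g (e ℕ.+ c ℕ.* P))
          ≡⟨ Σ-last m (λ c → difference g (e ℕ.+ c ℕ.* P)) ⟩
        Σ m (λ c → difference g (e ℕ.+ c ℕ.* P)) + (ψ m - g (e ℕ.+ m ℕ.* P ℕ.+ P))
          ≡⟨ cong₂ (λ a b → a + (ψ m - g b)) (telescope m)
               (trans (ℕₚ.+-assoc e (m ℕ.* P) P) (cong (e ℕ.+_) (ℕₚ.+-comm (m ℕ.* P) P))) ⟩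
        (ψ 0 - ψ m) + (ψ m - ψ (suc m))
          ≡⟨ ℤK.solve 3 (λ a b c → (a ℤK.:- b) ℤK.:+ (b ℤK.:- c) ℤK.:= a ℤK.:- c) refl (ψ 0) (ψ m) (ψ (suc m)) ⟩
        ψ 0 - ψ (suc m) ∎

    subst-cong : ∀ {f g k l} → X^ k ≈ X^ l → f ≈ g → (∀ φ → Ann φ → ∀ e → Ann (λ m → φ (e ℕ.+ l ℕ.* m))) →
      subst (X^ k) f ≈ subst (X^ l) g
    subst-cong {f} {g} {k} {l} e f≈g pres = R.trans (point f) (mk λ φ a j → begin
      act (subst (X^ l) f) φ j                      ≡⟨ cong (act (subst (X^ l) f) φ) (j+l0 j) ⟨
      act (subst (X^ l) f) φ (j ℕ.+ l ℕ.* 0)        ≡⟨ act-subst-X^ l f φ j 0 ⟩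
      act f (λ m → φ (j ℕ.+ l ℕ.* m)) 0             ≡⟨ at f≈g _ (pres φ a j) 0 ⟩
      act g (λ m → φ (j ℕ.+ l ℕ.* m)) 0             ≡⟨ act-subst-X^ l g φ j 0 ⟨
      act (subst (X^ l) g) φ (j ℕ.+ l ℕ.* 0)        ≡⟨ cong (act (subst (X^ l) g) φ) (j+l0 j) ⟩
      act (subst (X^ l) g) φ j                      ∎)
      where
      module R = CommutativeRing ring
      open ≡.≡-Reasoning
      j+l0 : ∀ j → j ℕ.+ l ℕ.* 0 ≡ j
      j+l0 j = trans (cong (j ℕ.+_) (ℕₚ.*-zeroʳ l)) (ℕₚ.+-identityʳ j)
      point : ∀ f → subst (X^ k) f ≈ subst (X^ l) f
      point (con c) = R.refl
      point X       = e
      point (f ⊕ g) = R.+-cong (point f) (point g)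
      point (f ⊗ g) = R.*-cong (point f) (point g)

  module _ {p} (pp : Prime p) where
    private instance
      p≢0 : NonZero p
      p≢0 = prime⇒nonZero pp
    open PrimePower p pp

    residues-*-↭ : ∀ {k} → ¬ (p ℕD.∣ k) → map (λ c → (k ℕ.* c) % p) (upTo p) ↭ upTo p
    residues-*-↭ {k} p∤k = unique-↭ (unique-map _ injective (Unique.upTo⁺ p)) (Unique.upTo⁺ p) to from
      where
      inverse : ∃ λ h → (h ℕ.* k) % p ≡ 1 % p
      inverse with h , e ← Modulus.∃-inverse 0 {k} p∤k =
        h , trans (%-congʳ (sym (ℕₚ.*-identityʳ p))) (trans e (%-congʳ (ℕₚ.*-identityʳ p)))
        where open Modulus 0
      h = proj₁ inverse
      cancel : ∀ c → (h ℕ.* ((k ℕ.* c) % p)) % p ≡ c % p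
      cancel c = trans (%-cong-* {p} {h} refl (m%n%n≡m%n (k ℕ.* c) p))
        (trans (cong (_% p) (sym (ℕₚ.*-assoc h k c)))
          (trans (%-cong-* {p} {h ℕ.* k} {y = c} (proj₂ inverse) refl) (cong (_% p) (ℕₚ.*-identityˡ c))))
      injective : ∀ {x y} → x ∈ upTo p → y ∈ upTo p → (k ℕ.* x) % p ≡ (k ℕ.* y) % p → x ≡ y
      injective {x} {y} x∈ y∈ e = <⇒%-injective (∈-upTo⁻ x∈) (∈-upTo⁻ y∈)
        (trans (sym (cancel x)) (trans (cong (λ z → (h ℕ.* z) % p) e) (cancel y)))
      to : ∀ {x} → x ∈ map (λ c → (k ℕ.* c) % p) (upTo p) → x ∈ upTo p
      to x∈ with c , _ , refl ← ∈-map⁻ _ x∈ = ∈-upTo⁺ (m%n<n (k ℕ.* c) p)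
      from : ∀ {x} → x ∈ upTo p → x ∈ map (λ c → (k ℕ.* c) % p) (upTo p)
      from {x} x∈ = ≡.subst (_∈ map (λ c → (k ℕ.* c) % p) (upTo p))
        (trans (%-cong-* {p} {k} refl (m%n%n≡m%n (h ℕ.* x) p))
          (trans (cong (_% p) (trans (sym (ℕₚ.*-assoc k h x)) (cong (ℕ._* x) (ℕₚ.*-comm k h))))
            (trans (%-cong-* {p} {h ℕ.* k} {y = x} (proj₂ inverse) refl)
              (trans (cong (_% p) (ℕₚ.*-identityˡ x)) (m<n⇒m%n≡m (∈-upTo⁻ x∈))))))
        (∈-map⁺ (λ c → (k ℕ.* c) % p) (∈-upTo⁺ (m%n<n (h ℕ.* x) p)))

  truth : ∀ {A : Set} → Dec A → ℤ
  truth (yes _) = + 1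
  truth (no _)  = + 0

  indicator : ∀ n .{{_ : NonZero n}} → ℕ → ℕ → ℤ
  indicator n k e = truth (e % n ℕ.≟ k)

  indicator-≡ : ∀ n .{{_ : NonZero n}} k e → e % n ≡ k → indicator n k e ≡ + 1
  indicator-≡ n k e h with e % n ℕ.≟ k
  ... | yes _ = refl
  ... | no ne = contradiction h ne

  indicator-≢ : ∀ n .{{_ : NonZero n}} k e → e % n ≢ k → indicator n k e ≡ + 0
  indicator-≢ n k e h with e % n ℕ.≟ k
  ... | yes eq = contradiction eq h
  ... | no _   = refl

  indicator-periodic : ∀ n .{{_ : NonZero n}} k e → indicator n k (e ℕ.+ n) ≡ indicator n k e
  indicator-periodic n k e = cong (λ r → truth (r ℕ.≟ k)) ([m+n]%n≡m%n e n)

open Polynomial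

abs-^ : ∀ c k → ℤ.∣ c ℤ.^ k ∣ ≡ ℤ.∣ c ∣ ℕ.^ k
abs-^ c zero    = ≡.refl
abs-^ c (suc k) = ≡.trans (ℤₚ.abs-* c (c ℤ.^ k)) (cong (ℤ.∣ c ∣ ℕ.*_) (abs-^ c k))

module CyclotomicRing (p : ℕ) (pp : Prime p) (i : ℕ) where
  open PrimePower p pp public
  open Modulus i public
  open Annihilator p P public hiding (ring)
  open Kit ringℤ public hiding (_≈_)
  private instance
    p≢0 : NonZero p
    p≢0 = prime⇒nonZero pp

  Ann-% : ∀ {φ} → Ann φ → ∀ e → φ e ≡ φ (e % n)
  Ann-% {φ} a e = ≡.trans (cong φ (m≡m%n+[m/n]*n e n)) (Periodic-* {φ} (Ann-periodic {φ} a) (e / n) (e % n))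

  X^-cong-% : ∀ {k l} → k % n ≡ l % n → X^ k ≈ X^ l
  X^-cong-% {k} {l} e = ≈-from-0 λ φ a →
    act (X^ k) φ 0     ≡⟪ act-X^ k φ 0 ⟫
    φ k                ≡⟪ Ann-% {φ} a k ⟫
    φ (k % n)          ≡⟪ cong φ e ⟫
    φ (l % n)          ≡⟪ ≡.sym (Ann-% {φ} a l) ⟫
    φ l                ≡⟪ ≡.sym (act-X^ l φ 0) ⟫
    act (X^ l) φ 0     □

  X^-+ : ∀ k l → X^ (k ℕ.+ l) ≈ X^ k * X^ l
  X^-+ zero    l = sym (*-identityˡ _)
  X^-+ (suc k) l = trans (*-congˡ (X^-+ k l)) (sym (*-assoc X (X^ k) (X^ l)))

  X^-* : ∀ k l → X^ (k ℕ.* l) ≈ (X^ k) ^ l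
  X^-* k zero    = reflexive (cong X^_ (ℕₚ.*-zeroʳ k))
  X^-* k (suc l) = trans (reflexive (cong X^_ (ℕₚ.*-suc k l))) (trans (X^-+ k (k ℕ.* l)) (*-congˡ (X^-* k l)))

  ^≈X^ : ∀ k → X ^ k ≈ X^ k
  ^≈X^ zero    = refl
  ^≈X^ (suc k) = *-congˡ (^≈X^ k)

  X^-n∣ : ∀ {k} → n ℕD.∣ k → X^ k ≈ 1#
  X^-n∣ {k} (ℕD.divides d ≡.refl) = X^-cong-% (≡.trans (m*n%n≡0 d n) (≡.sym (m*n%n≡0 0 n)))

  act-ΣR : ∀ m (F : ℕ → Poly) φ k → act (Σ m F) φ k ≡ ℤK.Σ m (λ l → act (F l) φ k)
  act-ΣR zero    F φ k = ≡.refl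
  act-ΣR (suc m) F φ k = cong (ℤ._+_ (act (F 0) φ k)) (act-ΣR m (F ∘ suc) φ k)

  torsion-free : ∀ c → c ≢ + 0 → Regular (ι c)
  torsion-free c c≢0 y h = mk λ φ a k → case (ℤₚ.i*j≡0⇒i≡0∨j≡0 c (at h φ a k))
    where
    case : ∀ {x} → c ≡ + 0 ⊎ x ≡ + 0 → x ≡ + 0
    case (inj₁ c≡0) = contradiction c≡0 c≢0
    case (inj₂ x≡0) = x≡0

  λ₀ : ℕ → ℤ
  λ₀ = difference (indicator n 0)

  λ₀-Ann : Ann λ₀
  λ₀-Ann = difference-Ann {indicator n 0} (indicator-periodic n 0)

  λ₀-0 : λ₀ 0 ≡ + 1
  λ₀-0 = cong₂ (λ a b → a ℤ.- b) (indicator-≡ n 0 0 (m*n%n≡0 0 n))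
    (indicator-≢ n 0 P (λ e → ℕₚ.<⇒≢ 0<P (≡.sym (≡.trans (≡.sym (m<n⇒m%n≡m P<n)) e))))

  retract : Poly → ℤ
  retract f = act f λ₀ 0

  retract-cong : ∀ {f g} → f ≈ g → retract f ≡ retract g
  retract-cong e = at e λ₀ λ₀-Ann 0

  retract-ι : ∀ c → retract (ι c) ≡ c
  retract-ι c = ≡.trans (cong (c ℤ.*_) λ₀-0) (ℤₚ.*-identityʳ c)

  ι-injective : ∀ {a b} → ι a ≈ ι b → a ≡ b
  ι-injective {a} {b} e = ≡.trans (≡.sym (retract-ι a)) (≡.trans (retract-cong e) (retract-ι b))

  ι-∣⁻ : ∀ {a b} → ι a ∣ ι b → ∃ λ c → b ≡ a ℤ.* c
  ι-∣⁻ {a} {b} (divides z e) = retract z , ≡.trans (≡.sym (retract-ι b)) (retract-cong e)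

  ι-∣⁺ : ∀ {a b} → a ℤD.∣ b → ι a ∣ ι b
  ι-∣⁺ {a} {b} a∣b with ℤS.divides c ≡.refl ← ℤS.∣ᵤ⇒∣ {a} {b} a∣b = divides (ι c) (trans (reflexive (cong ι (ℤₚ.*-comm c a))) (ι-* a c))

  ι-∣⇒∣ : ∀ {a b} → ι a ∣ ι b → a ℤD.∣ b
  ι-∣⇒∣ {a} h with c , e ← ι-∣⁻ h = ℤS.∣⇒∣ᵤ (ℤS.divides c (≡.trans e (ℤₚ.*-comm a c)))

  ζ : Poly
  ζ = X^ P

  Σζ^c≈0 : Σ p (λ c → X^ (c ℕ.* P)) ≈ 0#
  Σζ^c≈0 = mk λ φ a k → ≡.trans (act-ΣR p (λ c → X^ (c ℕ.* P)) φ k)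
    (≡.trans (ℤK.Σ-cong p (λ c _ → act-X^ (c ℕ.* P) φ k)) (a k))

  1-X^∣1-X^* : ∀ k l → 1# - X^ k ∣ 1# - X^ (k ℕ.* l)
  1-X^∣1-X^* k l = ∣-respʳ (+-congˡ (-‿cong (sym (X^-* k l)))) (1-x∣1-x^n (X^ k) l)

  1-X∣1-X^ : ∀ l → 1# - X ∣ 1# - X^ l
  1-X∣1-X^ l = ∣-respˡ (+-congˡ (-‿cong (*-identityʳ X)))
    (∣-respʳ (+-congˡ (-‿cong (reflexive (cong X^_ (ℕₚ.*-identityˡ l))))) (1-X^∣1-X^* 1 l))

  p≈Σ[1-ζ^c] : ιℕ p ≈ Σ p (λ c → 1# - X^ (c ℕ.* P))
  p≈Σ[1-ζ^c] = sym (begin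
    Σ p (λ c → 1# - X^ (c ℕ.* P))                ≈⟨ Σ-+ p (λ _ → 1#) (λ c → - X^ (c ℕ.* P)) ⟩
    Σ p (λ _ → 1#) + Σ p (λ c → - X^ (c ℕ.* P))  ≈⟨ +-cong (trans (Σ-const p 1#) (*-identityʳ _))
                                                      (trans (Σ-neg p (λ c → X^ (c ℕ.* P))) (trans (-‿cong Σζ^c≈0) -0#≈0#)) ⟩
    ιℕ p + 0#                                    ≈⟨ +-identityʳ _ ⟩
    ιℕ p                                         ∎)

  1-ζ∣p : 1# - ζ ∣ ιℕ p
  1-ζ∣p = ∣-respʳ (sym p≈Σ[1-ζ^c]) (∣-Σ p λ c _ →
    ∣-respʳ (+-congˡ (-‿cong (reflexive (cong X^_ (ℕₚ.*-comm P c))))) (1-X^∣1-X^* P c))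

  1-X^k∣1-ζ : ∀ {k} → ¬ (n ℕD.∣ k) → 1# - X^ k ∣ 1# - ζ
  1-X^k∣1-ζ {k} n∤k with c , d , e ← ∃-multiple≡P i n∤k =
    ∣-respʳ (+-congˡ (-‿cong (X^-cong-% (≡.trans (cong (_% n) (≡.trans (ℕₚ.*-comm k c) e)) ([m+kn]%n≡m%n P d n)))))
      (1-X^∣1-X^* k c)

  regular-p : Regular (ιℕ p)
  regular-p = torsion-free (+ p) (λ e → ℕ.≢-nonZero⁻¹ p (ℤₚ.+-injective e))

  1-X^-regular : ∀ {k} → ¬ (n ℕD.∣ k) → Regular (1# - X^ k)
  1-X^-regular n∤k = regular-∣ (∣-trans (1-X^k∣1-ζ n∤k) 1-ζ∣p) regular-p

  σ : ℕ → Poly → Poly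
  σ k = subst (X^ k)

  private
    -- k permutes the residues modulo p, so dilation by k preserves the vanishing of the p-term sums.
    dilate-Ann : ∀ {k} → ¬ (p ℕD.∣ k) → ∀ φ → Ann φ → ∀ e → Ann (λ m → φ (e ℕ.+ k ℕ.* m))
    dilate-Ann {k} p∤k φ a e m =
      ℤK.Σ p (λ c → φ (e ℕ.+ k ℕ.* (m ℕ.+ c ℕ.* P)))
        ≡⟪ ℤK.Σ-cong p (λ c _ → cong φ (expand c)) ⟫
      ℤK.Σ p (λ c → ψ (k ℕ.* c))
        ≡⟪ ℤK.Σ-cong p (λ c _ → ψ-% (k ℕ.* c)) ⟫
      ℤK.Σ p (λ c → ψ ((k ℕ.* c) % p))
        ≡⟪ ≡.sym (ℤK.Σₗ-upTo p (λ c → ψ ((k ℕ.* c) % p))) ⟫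
      ℤK.Σₗ (upTo p) (λ c → ψ ((k ℕ.* c) % p))
        ≡⟪ ≡.sym (ℤK.Σₗ-map (λ c → (k ℕ.* c) % p) (upTo p) ψ) ⟫
      ℤK.Σₗ (map (λ c → (k ℕ.* c) % p) (upTo p)) ψ
        ≡⟪ ℤK.Σₗ-↭ (residues-*-↭ pp p∤k) ψ ⟫
      ℤK.Σₗ (upTo p) ψ
        ≡⟪ ℤK.Σₗ-upTo p ψ ⟫
      ℤK.Σ p ψ
        ≡⟪ a (e ℕ.+ k ℕ.* m) ⟫
      + 0 □
      where
      ψ : ℕ → ℤ
      ψ d = φ (e ℕ.+ k ℕ.* m ℕ.+ d ℕ.* P)
      expand : ∀ c → e ℕ.+ k ℕ.* (m ℕ.+ c ℕ.* P) ≡ e ℕ.+ k ℕ.* m ℕ.+ k ℕ.* c ℕ.* P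
      expand c = ≡.trans (cong (e ℕ.+_) (≡.trans (ℕₚ.*-distribˡ-+ k m (c ℕ.* P)) (cong (k ℕ.* m ℕ.+_) (≡.sym (ℕₚ.*-assoc k c P)))))
        (≡.sym (ℕₚ.+-assoc e (k ℕ.* m) _))
      ψ-% : ∀ d → ψ d ≡ ψ (d % p)
      ψ-% d = ≡.trans (cong φ (
        s ℕ.+ d ℕ.* P                                  ≡⟪ cong (λ d → s ℕ.+ d ℕ.* P) (m≡m%n+[m/n]*n d p) ⟫
        s ℕ.+ (d % p ℕ.+ d / p ℕ.* p) ℕ.* P            ≡⟪ cong (s ℕ.+_) (ℕₚ.*-distribʳ-+ P (d % p) _) ⟫
        s ℕ.+ (d % p ℕ.* P ℕ.+ d / p ℕ.* p ℕ.* P)      ≡⟪ ≡.sym (ℕₚ.+-assoc s _ _) ⟫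
        s ℕ.+ d % p ℕ.* P ℕ.+ d / p ℕ.* p ℕ.* P        ≡⟪ cong (s ℕ.+ d % p ℕ.* P ℕ.+_) (ℕₚ.*-assoc (d / p) p P) ⟫
        s ℕ.+ d % p ℕ.* P ℕ.+ d / p ℕ.* n              □))
        (Periodic-* {φ} (Ann-periodic {φ} a) (d / p) _)
        where s = e ℕ.+ k ℕ.* m

  σ-cong : ∀ {k f g} → ¬ (p ℕD.∣ k) → f ≈ g → σ k f ≈ σ k g
  σ-cong {k} p∤k e = subst-cong {k = k} {k} refl e (dilate-Ann p∤k)

  σ-cong-% : ∀ {k l} f → k % n ≡ l % n → σ k f ≈ σ l f
  σ-cong-% (con c) e = refl
  σ-cong-% X       e = X^-cong-% e
  σ-cong-% (f ⊕ g) e = +-cong (σ-cong-% f e) (σ-cong-% g e)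
  σ-cong-% (f ⊗ g) e = *-cong (σ-cong-% f e) (σ-cong-% g e)

  σ-X^ : ∀ k l → σ k (X^ l) ≈ X^ (k ℕ.* l)
  σ-X^ k zero    = reflexive (cong X^_ (≡.sym (ℕₚ.*-zeroʳ k)))
  σ-X^ k (suc l) = trans (*-congˡ (σ-X^ k l)) (trans (sym (X^-+ k (k ℕ.* l))) (reflexive (cong X^_ (≡.sym (ℕₚ.*-suc k l)))))

  σ-σ : ∀ k l f → σ k (σ l f) ≈ σ (k ℕ.* l) f
  σ-σ k l (con c) = refl
  σ-σ k l X       = σ-X^ k l
  σ-σ k l (f ⊕ g) = +-cong (σ-σ k l f) (σ-σ k l g)
  σ-σ k l (f ⊗ g) = *-cong (σ-σ k l f) (σ-σ k l g)

  σ-1 : ∀ f → σ 1 f ≈ f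
  σ-1 (con c) = refl
  σ-1 X       = *-identityʳ X
  σ-1 (f ⊕ g) = +-cong (σ-1 f) (σ-1 g)
  σ-1 (f ⊗ g) = *-cong (σ-1 f) (σ-1 g)

  σ-^ : ∀ k f m → σ k (f ^ m) ≡ σ k f ^ m
  σ-^ k f zero    = ≡.refl
  σ-^ k f (suc m) = cong (σ k f ⊗_) (σ-^ k f m)

  σ-Σ : ∀ k m F → σ k (Σ m F) ≡ Σ m (σ k ∘ F)
  σ-Σ k zero    F = ≡.refl
  σ-Σ k (suc m) F = cong (σ k (F 0) ⊕_) (σ-Σ k m (F ∘ suc))

  σ-Πₗ : ∀ k xs F → σ k (Πₗ xs F) ≡ Πₗ xs (σ k ∘ F)
  σ-Πₗ k []       F = ≡.refl
  σ-Πₗ k (x ∷ xs) F = cong (σ k (F x) ⊗_) (σ-Πₗ k xs F)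

  σ-∣ : ∀ {k f g} → ¬ (p ℕD.∣ k) → f ∣ g → σ k f ∣ σ k g
  σ-∣ p∤k (divides z e) = divides (σ _ z) (σ-cong p∤k e)

  coefficient : ℕ → Poly → ℤ
  coefficient k f = act f (indicator n k) 0

  expansion : ∀ f → f ≈ Σ n (λ k → ι (coefficient k f) * X^ k)
  expansion f = ≈-from-0 λ φ a →
    act f φ 0
      ≡⟪ act-cong f (φ-expand φ a) 0 ⟫
    act f (λ e → ℤK.Σ n (λ k → φ k ℤ.* indicator n k e)) 0
      ≡⟪ act-Σ f n (λ k e → φ k ℤ.* indicator n k e) 0 ⟫
    ℤK.Σ n (λ k → act f (λ e → φ k ℤ.* indicator n k e) 0)
      ≡⟪ ℤK.Σ-cong n (λ k _ → ≡.trans (act-* f (φ k) (indicator n k) 0) (≡.trans (ℤₚ.*-comm (φ k) _)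
           (cong (coefficient k f ℤ.*_) (≡.sym (act-X^ k φ 0))))) ⟫
    ℤK.Σ n (λ k → act (ι (coefficient k f) * X^ k) φ 0)
      ≡⟪ ≡.sym (act-ΣR n (λ k → ι (coefficient k f) * X^ k) φ 0) ⟫
    act (Σ n (λ k → ι (coefficient k f) * X^ k)) φ 0 □
    where
    φ-expand : ∀ φ → Ann φ → ∀ e → φ e ≡ ℤK.Σ n (λ k → φ k ℤ.* indicator n k e)
    φ-expand φ a e = ≡.sym (≡.trans
      (ℤK.Σ-single n {λ k → φ k ℤ.* indicator n k e} {e % n} (m%n<n e n) (λ k _ k≢ →
        ≡.trans (cong (φ k ℤ.*_) (indicator-≢ n k e (k≢ ∘ ≡.sym))) (ℤₚ.*-zeroʳ (φ k))))
      (≡.trans (cong (φ (e % n) ℤ.*_) (indicator-≡ n (e % n) e ≡.refl)) (≡.trans (ℤₚ.*-identityʳ _) (≡.sym (Ann-% {φ} a e)))))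

  private
    geometric-integral : ∀ m k → n ℕD.∣ k ℕ.* m → ∃ λ c → Σ m (λ h → X^ (k ℕ.* h)) ≈ ι c
    geometric-integral m k n∣km with n ℕD.∣? k
    ... | yes n∣k = + m , trans (Σ-cong m (λ h _ → X^-n∣ (ℕD.∣m⇒∣m*n h n∣k))) (trans (Σ-const m 1#) (*-identityʳ _))
    ... | no n∤k  = + 0 , 1-X^-regular n∤k _ (begin
      (1# - X^ k) * Σ m (λ h → X^ (k ℕ.* h))   ≈⟨ *-congˡ (Σ-cong m λ h _ → X^-* k h) ⟩
      (1# - X^ k) * Σ m ((X^ k) ^_)            ≈⟨ geometric (X^ k) m ⟩
      1# - (X^ k) ^ m                          ≈⟨ +-congˡ (-‿cong (trans (sym (X^-* k m)) (X^-n∣ n∣km))) ⟩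
      1# - 1#                                  ≈⟨ -‿inverseʳ 1# ⟩
      0#                                       ∎)

  trace-X^ : ∀ k → ∃ λ c → Σₗ units (λ h → X^ (h ℕ.* k)) ≈ ι c
  trace-X^ k with a , ea ← geometric-integral n k (ℕD.n∣m*n k)
                | b , eb ← geometric-integral P (p ℕ.* k) (≡.subst (n ℕD.∣_)
                             (≡.trans (ℕₚ.*-comm (p ℕ.* P) k) (≡.trans (≡.sym (ℕₚ.*-assoc k p P)) (cong (ℕ._* P) (ℕₚ.*-comm k p)))) (ℕD.m∣m*n k)) =
    a ℤ.- b , (begin
      Σₗ units F
        ≈⟨ solve 2 (λ u v → u := (u :+ v) :- v) refl (Σₗ units F) (Σₗ (map (p ℕ.*_) (upTo P)) F) ⟩
      (Σₗ units F + Σₗ (map (p ℕ.*_) (upTo P)) F) - Σₗ (map (p ℕ.*_) (upTo P)) F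
        ≈⟨ +-cong (trans (sym (Σₗ-++ units (map (p ℕ.*_) (upTo P)) F)) (trans (Σₗ-↭ upTo-↭ F) (reflexive (Σₗ-upTo n F))))
                  (-‿cong (reflexive (≡.trans (Σₗ-map (p ℕ.*_) (upTo P) F) (Σₗ-upTo P (F ∘ (p ℕ.*_)))))) ⟩
      Σ n F - Σ P (λ h → F (p ℕ.* h))
        ≈⟨ +-cong (trans (Σ-cong n (λ h _ → reflexive (cong X^_ (ℕₚ.*-comm h k)))) ea)
                  (-‿cong (trans (Σ-cong P (λ h _ → reflexive (cong X^_ (swap h)))) eb)) ⟩
      ι a - ι b
        ≈⟨ trans (ι-+ a (ℤ.- b)) (+-congˡ (ι-neg b)) ⟨
      ι (a ℤ.- b) ∎)
    where
    F : ℕ → Poly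
    F h = X^ (h ℕ.* k)
    swap : ∀ h → p ℕ.* h ℕ.* k ≡ p ℕ.* k ℕ.* h
    swap h = ≡.trans (ℕₚ.*-assoc p h k) (≡.trans (cong (p ℕ.*_) (ℕₚ.*-comm h k)) (≡.sym (ℕₚ.*-assoc p k h)))

  length-units≢0 : + length units ≢ + 0
  length-units≢0 e = nonempty 1∈units (ℤₚ.+-injective e)
    where
    nonempty : ∀ {x} {xs : List ℕ} → x ∈ xs → length xs ≢ 0
    nonempty (here _)  ()
    nonempty (there _) ()

  invariant⇒integral : ∀ y → (∀ {h} → h ∈ units → σ h y ≈ y) → y ≈ ι (retract y)
  invariant⇒integral y inv = regular-cancelˡ (torsion-free (+ length units) length-units≢0) (begin
    ιℕ (length units) * y
      ≈⟨ trace ⟩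
    ι C
      ≡⟨ cong ι (≡.trans (≡.sym (retract-ι C)) (retract-cong (sym trace))) ⟩
    ι (+ length units ℤ.* retract y)
      ≈⟨ ι-* (+ length units) (retract y) ⟩
    ιℕ (length units) * ι (retract y) ∎)
    where
    a : ℕ → ℤ
    a k = coefficient k y
    C : ℤ
    C = ℤK.Σ n (λ k → a k ℤ.* proj₁ (trace-X^ k))
    trace : ιℕ (length units) * y ≈ ι C
    trace = begin
      ιℕ (length units) * y
        ≈⟨ Σₗ-const units y ⟨
      Σₗ units (λ _ → y)
        ≈⟨ Σₗ-cong units (λ h∈ → sym (trans (σ-cong (proj₂ (∈-units⁻ h∈)) (sym (expansion y))) (inv h∈))) ⟩
      Σₗ units (λ h → σ h (Σ n (λ k → ι (a k) * X^ k)))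
        ≈⟨ Σₗ-cong units (λ {h} _ → trans (reflexive (σ-Σ h n (λ k → ι (a k) * X^ k))) (Σ-cong n λ k _ → *-congˡ {ι (a k)} (σ-X^ h k))) ⟩
      Σₗ units (λ h → Σ n (λ k → ι (a k) * X^ (h ℕ.* k)))
        ≈⟨ Σₗ-Σ units n (λ h k → ι (a k) * X^ (h ℕ.* k)) ⟩
      Σ n (λ k → Σₗ units (λ h → ι (a k) * X^ (h ℕ.* k)))
        ≈⟨ Σ-cong n (λ k _ → trans (sym (Σₗ-*ˡ units (ι (a k)) (λ h → X^ (h ℕ.* k))))
             (trans (*-congˡ (proj₂ (trace-X^ k))) (sym (ι-* (a k) _)))) ⟩
      Σ n (λ k → ι (a k ℤ.* proj₁ (trace-X^ k)))
        ≈⟨ ι-Σ n (λ k → a k ℤ.* proj₁ (trace-X^ k)) ⟨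
      ι C ∎

  conjugates : Poly → Poly
  conjugates f = Πₗ units (λ h → σ h f)

  norm : Poly → ℤ
  norm f = retract (conjugates f)

  conjugates≈norm : ∀ f → conjugates f ≈ ι (norm f)
  conjugates≈norm f = invariant⇒integral (conjugates f) λ {h} h∈ → begin
    σ h (Πₗ units (λ k → σ k f))              ≡⟨ σ-Πₗ h units (λ k → σ k f) ⟩
    Πₗ units (λ k → σ h (σ k f))              ≈⟨ Πₗ-cong units (λ {k} _ → trans (σ-σ h k f) (σ-cong-% f (≡.sym (m%n%n≡m%n (h ℕ.* k) n)))) ⟩
    Πₗ units (λ k → σ ((h ℕ.* k) % n) f)      ≡⟨ Πₗ-map (λ k → (h ℕ.* k) % n) units (λ k → σ k f) ⟨
    Πₗ (map (λ k → (h ℕ.* k) % n) units) (λ k → σ k f)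
                                              ≈⟨ Πₗ-↭ (units-*-↭ (proj₂ (∈-units⁻ h∈))) (λ k → σ k f) ⟩
    Πₗ units (λ k → σ k f)                    ∎

  norm-cong : ∀ {f g} → f ≈ g → norm f ≡ norm g
  norm-cong e = retract-cong (Πₗ-cong units λ h∈ → σ-cong (proj₂ (∈-units⁻ h∈)) e)

  norm-* : ∀ f g → norm (f * g) ≡ norm f ℤ.* norm g
  norm-* f g = ι-injective (begin
    ι (norm (f * g))           ≈⟨ conjugates≈norm (f * g) ⟨
    conjugates (f * g)         ≈⟨ Πₗ-* units (λ h → σ h f) (λ h → σ h g) ⟩
    conjugates f * conjugates g ≈⟨ *-cong (conjugates≈norm f) (conjugates≈norm g) ⟩
    ι (norm f) * ι (norm g)    ≈⟨ ι-* (norm f) (norm g) ⟨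
    ι (norm f ℤ.* norm g)      ∎)

  norm-ι : ∀ c → norm (ι c) ≡ c ℤ.^ length units
  norm-ι c = ι-injective (begin
    ι (norm (ι c))         ≈⟨ conjugates≈norm (ι c) ⟨
    conjugates (ι c)       ≈⟨ Πₗ-const units (ι c) ⟩
    ι c ^ length units     ≈⟨ ι-^ c (length units) ⟨
    ι (c ℤ.^ length units) ∎)

  ∣-norm : ∀ f → f ∣ ι (norm f)
  ∣-norm f = ∣-respʳ (conjugates≈norm f) (∣-Πₗ 1∈units (∣-respʳ (sym (σ-1 f)) ∣-refl))

  mod-norm : ∀ {d f g} → f ≡ g [mod ι d ] → ι (norm f) ≡ ι (norm g) [mod ι d ]
  mod-norm {d} {f} {g} h = mod-trans (mod-reflexive (sym (conjugates≈norm f)))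
    (mod-trans (mod-Πₗ units λ {k} k∈ → σ-mod (proj₂ (∈-units⁻ k∈))) (mod-reflexive (conjugates≈norm g)))
    where
    σ-mod : ∀ {k} → ¬ (p ℕD.∣ k) → σ k f ≡ σ k g [mod ι d ]
    σ-mod p∤k = σ-∣ p∤k h

0≤x*x : ∀ x → + 0 ℤ.≤ x ℤ.* x
0≤x*x (+ n)      = ≡.subst (+ 0 ℤ.≤_) (ℤₚ.pos-* n n) (+≤+ ℕ.z≤n)
0≤x*x (-[1+ n ]) = +≤+ ℕ.z≤n

x≤x*x : ∀ x → x ℤ.≤ x ℤ.* x
x≤x*x (+ zero)    = +≤+ ℕ.z≤n
x≤x*x (+ (suc n)) = +≤+ (ℕₚ.m≤m*n (suc n) (suc n))
x≤x*x (-[1+ n ])  = -≤+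

x*x≡0∨1≤x*x : ∀ x → x ≡ + 0 ⊎ + 1 ℤ.≤ x ℤ.* x
x*x≡0∨1≤x*x (+ zero)    = inj₁ ≡.refl
x*x≡0∨1≤x*x (+ (suc n)) = inj₂ (+≤+ (ℕ.s≤s ℕ.z≤n))
x*x≡0∨1≤x*x (-[1+ n ])  = inj₂ (+≤+ (ℕ.s≤s ℕ.z≤n))

x*x≡1 : ∀ x → x ℤ.* x ≡ + 1 → x ≡ + 1 ⊎ x ≡ ℤ.- + 1
x*x≡1 (+ (suc zero))    e = inj₁ ≡.refl
x*x≡1 (-[1+ zero ])     e = inj₂ ≡.refl
x*x≡1 (-[1+ suc n ])    e with ℤₚ.+-injective e
... | ()
x*x≡1 (+ zero)          ()
x*x≡1 (+ (suc (suc n))) e with ℤₚ.+-injective e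
... | ()

x-k≡y⇒x≡k+y : ∀ x k {y} → x ℤ.- k ≡ y → x ≡ k ℤ.+ y
x-k≡y⇒x≡k+y x k e = ≡.trans
  (ℤK.solve 2 (λ x k → x ℤK.:= k ℤK.:+ (x ℤK.:- k)) ≡.refl x k) (cong (ℤ._+_ k) e)

module ℤSums where
  open ℤK

  Σ-mono : ∀ n {f g} → (∀ k → k ℕ.< n → f k ℤ.≤ g k) → Σ n f ℤ.≤ Σ n g
  Σ-mono zero    h = ℤₚ.≤-refl
  Σ-mono (suc n) h = ℤₚ.+-mono-≤ (h 0 ℕ.z<s) (Σ-mono n λ k k<n → h (suc k) (ℕ.s<s k<n))

  Σ-nonneg : ∀ n {f} → (∀ k → k ℕ.< n → + 0 ℤ.≤ f k) → + 0 ℤ.≤ Σ n f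
  Σ-nonneg n {f} h = ≡.subst (ℤ._≤ Σ n f) (Σ-0 n) (Σ-mono n h)

  term≤Σ : ∀ n {f} → (∀ k → k ℕ.< n → + 0 ℤ.≤ f k) → ∀ k → k ℕ.< n → f k ℤ.≤ Σ n f
  term≤Σ (suc n) {f} h zero    _ = ≡.subst (ℤ._≤ Σ (suc n) f) (ℤₚ.+-identityʳ (f 0))
    (ℤₚ.+-monoʳ-≤ (f 0) (Σ-nonneg n λ k k<n → h (suc k) (ℕ.s<s k<n)))
  term≤Σ (suc n) {f} h (suc k) k<n = ≡.subst (ℤ._≤ Σ (suc n) f) (ℤₚ.+-identityˡ (f (suc k)))
    (ℤₚ.+-mono-≤ (h 0 ℕ.z<s) (term≤Σ n (λ k k<n → h (suc k) (ℕ.s<s k<n)) k (ℕ.s<s⁻¹ k<n)))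

  unique-term : ∀ n {f} {C : ℕ → Set} b → + 0 ℤ.< b → (∀ k → k ℕ.< n → + 0 ℤ.≤ f k) →
    (∀ k → C k → f k ≡ + 0) → (∀ k → k ℕ.< n → C k ⊎ b ℤ.≤ f k) → Σ n f ≡ b →
    ∃ λ k → k ℕ.< n × f k ≡ b × (∀ j → j ℕ.< n → j ≢ k → C j)
  unique-term zero    b 0<b nn C0 d e = contradiction e (ℤₚ.<⇒≢ 0<b)
  unique-term (suc n) {f} {C} b 0<b nn C0 d e with d 0 ℕ.z<s
  ... | inj₁ c with k , k<n , fk , rest ← unique-term n {f ∘ suc} {C ∘ suc} b 0<b
                    (λ k k<n → nn (suc k) (ℕ.s<s k<n)) (λ k → C0 (suc k)) (λ k k<n → d (suc k) (ℕ.s<s k<n))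
                    (≡.trans (≡.sym (ℤₚ.+-identityˡ _)) (≡.trans (cong (ℤ._+ Σ n (f ∘ suc)) (≡.sym (C0 0 c))) e)) =
    suc k , ℕ.s<s k<n , fk , λ { zero _ _ → c ; (suc j) j<n ne → rest j (ℕ.s<s⁻¹ j<n) (ne ∘ cong suc) }
  ... | inj₂ b≤f0 = 0 , ℕ.z<s , f0≡b , others
    where
    R : ℤ
    R = Σ n (f ∘ suc)
    R≡0 : R ≡ + 0
    R≡0 = ℤₚ.≤-antisym
      (≡.subst₂ ℤ._≤_ (solve 2 (λ b r → (:- b) :+ (b :+ r) := r) ≡.refl b R)
         (≡.trans (cong (ℤ._+_ (ℤ.- b)) e) (ℤₚ.+-inverseˡ b)) (ℤₚ.+-monoʳ-≤ (ℤ.- b) (ℤₚ.+-monoˡ-≤ R b≤f0)))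
      (Σ-nonneg n λ k k<n → nn (suc k) (ℕ.s<s k<n))
    f0≡b : f 0 ≡ b
    f0≡b = ≡.trans (≡.sym (ℤₚ.+-identityʳ (f 0))) (≡.trans (cong (ℤ._+_ (f 0)) (≡.sym R≡0)) e)
    others : ∀ j → j ℕ.< suc n → j ≢ 0 → C j
    others zero    _   ne = contradiction ≡.refl ne
    others (suc j) j<n _  with d (suc j) j<n
    ... | inj₁ c = c
    ... | inj₂ h = contradiction (ℤₚ.<-≤-trans 0<b (ℤₚ.≤-trans h
            (≡.subst (f (suc j) ℤ.≤_) R≡0 (term≤Σ n (λ k k<n → nn (suc k) (ℕ.s<s k<n)) j (ℕ.s<s⁻¹ j<n))))) (ℤₚ.<-irrefl ≡.refl)

  square-sum-1 : ∀ n (w : ℕ → ℤ) → Σ n (λ d → w d ℤ.* w d) ≡ + 1 →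
    ∃₂ λ d ε → d ℕ.< n × (ε ≡ + 1 ⊎ ε ≡ ℤ.- + 1) × w d ≡ ε × (∀ j → j ℕ.< n → j ≢ d → w j ≡ + 0)
  square-sum-1 n w e with d , d<n , wd , rest ← unique-term n {λ d → w d ℤ.* w d} {λ d → w d ≡ + 0} (+ 1)
      (ℤ.+<+ ℕ.z<s) (λ k _ → 0≤x*x (w k)) (λ k wk → cong (λ x → x ℤ.* x) wk) (λ k _ → x*x≡0∨1≤x*x (w k)) e =
    d , w d , d<n , x*x≡1 (w d) wd , ≡.refl , rest

  Q : ℕ → (ℕ → ℤ) → ℤ
  Q p v = + p ℤ.* Σ p (λ d → v d ℤ.* v d) ℤ.- Σ p v ℤ.* Σ p v

  Constant : ℕ → (ℕ → ℤ) → Set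
  Constant p v = ∃ λ κ → ∀ d → d ℕ.< p → v d ≡ κ

  Perturbed : ℕ → (ℕ → ℤ) → Set
  Perturbed p v = ∃₂ λ κ ε → ∃ λ d → (ε ≡ + 1 ⊎ ε ≡ ℤ.- + 1) × d ℕ.< p × v d ≡ κ ℤ.+ ε ×
    (∀ j → j ℕ.< p → j ≢ d → v j ≡ κ)

  private module Variance (q : ℕ) where
    p = suc q

    Σ-shifted : ∀ v κ → Σ p (λ d → v d ℤ.- κ) ≡ Σ p v ℤ.- + p ℤ.* κ
    Σ-shifted v κ = ≡.trans (Σ-+ p v (λ _ → ℤ.- κ)) (cong (ℤ._+_ (Σ p v))
      (≡.trans (Σ-const p (ℤ.- κ)) (≡.sym (ℤₚ.neg-distribʳ-* (+ p) κ))))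

    Σ²-shifted : ∀ v κ → Σ p (λ d → (v d ℤ.- κ) ℤ.* (v d ℤ.- κ)) ≡
      (Σ p (λ d → v d ℤ.* v d) ℤ.- + 2 ℤ.* κ ℤ.* Σ p v) ℤ.+ + p ℤ.* (κ ℤ.* κ)
    Σ²-shifted v κ =
      Σ p (λ d → (v d ℤ.- κ) ℤ.* (v d ℤ.- κ))
        ≡⟪ Σ-cong p (λ d _ → solve 2 (λ v k → (v :- k) :* (v :- k) := (v :* v :+ (:- (con (+ 2) :* k)) :* v) :+ k :* k) ≡.refl (v d) κ) ⟫
      Σ p (λ d → (v d ℤ.* v d ℤ.+ (ℤ.- (+ 2 ℤ.* κ)) ℤ.* v d) ℤ.+ κ ℤ.* κ)
        ≡⟪ ≡.trans (Σ-+ p (λ d → v d ℤ.* v d ℤ.+ (ℤ.- (+ 2 ℤ.* κ)) ℤ.* v d) (λ _ → κ ℤ.* κ))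
             (cong₂ ℤ._+_ (Σ-+ p (λ d → v d ℤ.* v d) (λ d → (ℤ.- (+ 2 ℤ.* κ)) ℤ.* v d)) (Σ-const p (κ ℤ.* κ))) ⟫
      (Σ p (λ d → v d ℤ.* v d) ℤ.+ Σ p (λ d → (ℤ.- (+ 2 ℤ.* κ)) ℤ.* v d)) ℤ.+ + p ℤ.* (κ ℤ.* κ)
        ≡⟪ cong (λ x → (Σ p (λ d → v d ℤ.* v d) ℤ.+ x) ℤ.+ + p ℤ.* (κ ℤ.* κ))
             (≡.trans (≡.sym (Σ-*ˡ p (ℤ.- (+ 2 ℤ.* κ)) v)) (≡.sym (ℤₚ.neg-distribˡ-* (+ 2 ℤ.* κ) (Σ p v)))) ⟫
      (Σ p (λ d → v d ℤ.* v d) ℤ.- + 2 ℤ.* κ ℤ.* Σ p v) ℤ.+ + p ℤ.* (κ ℤ.* κ) □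

    Q-shifted : ∀ v κ → Q p (λ d → v d ℤ.- κ) ≡ Q p v
    Q-shifted v κ = ≡.trans (cong₂ (λ a b → + p ℤ.* a ℤ.- b ℤ.* b) (Σ²-shifted v κ) (Σ-shifted v κ))
      (solve 4 (λ p a s k → p :* ((a :- con (+ 2) :* k :* s) :+ p :* (k :* k)) :- (s :- p :* k) :* (s :- p :* k)
                            := p :* a :- s :* s) ≡.refl (+ p) (Σ p (λ d → v d ℤ.* v d)) (Σ p v) κ)

    private
      Case : (ℕ → ℤ) → Set
      Case v = (Constant p v × Q p v ≡ + 0) ⊎ (+ q ℤ.≤ Q p v × (Q p v ≡ + q → Perturbed p v))

      from-square : ∀ v κ → Σ p (λ d → (v d ℤ.- κ) ℤ.* (v d ℤ.- κ)) ≡ + 1 → Perturbed p v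
      from-square v κ e = let (d , ε , d<p , ±1 , wd , rest) = square-sum-1 p (λ d → v d ℤ.- κ) e in
        κ , ε , d , ±1 , d<p , x-k≡y⇒x≡k+y (v d) κ wd ,
        λ j j<p ne → ≡.trans (x-k≡y⇒x≡k+y (v j) κ (rest j j<p ne)) (ℤₚ.+-identityʳ κ)

      -- The case Σ v = s with 0 ≤ s < p: then Q p v = s (p ∸ s) + p (Σ v² ∸ s).
      normalised : ∀ v s → s ℕ.< p → Σ p v ≡ + s → Case v
      normalised v s s<p Σv = go s s<p Σv (Σ p (λ d → v d ℤ.* v d)) ≡.refl
        (≡.subst (ℤ._≤ Σ p (λ d → v d ℤ.* v d)) Σv (Σ-mono p λ d _ → x≤x*x (v d)))
        where
        go : ∀ s → s ℕ.< p → Σ p v ≡ + s → ∀ A → Σ p (λ d → v d ℤ.* v d) ≡ A → + s ℤ.≤ A → Case v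
        go zero _ Σv (+ zero) ΣA _ = inj₁ ((+ 0 , zeros) , Q0)
          where
          zeros : ∀ d → d ℕ.< p → v d ≡ + 0
          zeros d d<p with x*x≡0∨1≤x*x (v d)
          ... | inj₁ vd = vd
          ... | inj₂ h  = contradiction (ℤₚ.≤-trans h (≡.subst (v d ℤ.* v d ℤ.≤_) ΣA (term≤Σ p (λ k _ → 0≤x*x (v k)) d d<p))) λ { (+≤+ ()) }
          Q0 : Q p v ≡ + 0
          Q0 = ≡.trans (cong₂ (λ a s → + p ℤ.* a ℤ.- s ℤ.* s) ΣA Σv) (cong (ℤ._- + 0) (ℤₚ.*-zeroʳ (+ p)))
        go zero _ Σv (+ (suc a)) ΣA _ = inj₂ (≡.subst (+ q ℤ.≤_) (≡.sym Q≡) (+≤+ (ℕₚ.<⇒≤ q<)) , λ e →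
            contradiction (ℤₚ.+-injective (≡.trans (≡.sym e) Q≡)) (ℕₚ.<⇒≢ q<))
          where
          q< : q ℕ.< p ℕ.* suc a
          q< = ℕₚ.m≤m*n p (suc a)
          Q≡ : Q p v ≡ + (p ℕ.* suc a)
          Q≡ = ≡.trans (cong₂ (λ a s → + p ℤ.* a ℤ.- s ℤ.* s) ΣA Σv) (ℤₚ.+-identityʳ (+ p ℤ.* + suc a))
        go (suc s) s<p Σv (+ a) ΣA (+≤+ s<a) = inj₂ (≡.subst (+ q ℤ.≤_) (≡.sym Q≡) (+≤+ (ℕₚ.m≤m+n q _)) , perturbed)
          where
          r b : ℕ
          r = q ℕ.∸ suc s
          b = a ℕ.∸ suc s
          q≡ : suc s ℕ.+ r ≡ q
          q≡ = ℕₚ.m+[n∸m]≡n (ℕ.s≤s⁻¹ s<p)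
          a≡ : suc s ℕ.+ b ≡ a
          a≡ = ℕₚ.m+[n∸m]≡n s<a
          Q≡ : Q p v ≡ + (q ℕ.+ (s ℕ.* r ℕ.+ p ℕ.* b))
          Q≡ = ≡.trans (cong₂ (λ a s → + p ℤ.* a ℤ.- s ℤ.* s) ΣA Σv) (≡.trans
            (cong₂ (λ q a → + suc q ℤ.* + a ℤ.- + suc s ℤ.* + suc s) (≡.sym q≡) (≡.sym a≡)) (≡.trans
            (solve 3 (λ s r b → (con (+ 1) :+ (con (+ 1) :+ s :+ r)) :* (con (+ 1) :+ s :+ b) :- (con (+ 1) :+ s) :* (con (+ 1) :+ s)
               := (con (+ 1) :+ s :+ r) :+ (s :* r :+ (con (+ 1) :+ (con (+ 1) :+ s :+ r)) :* b)) ≡.refl (+ s) (+ r) (+ b))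
            (cong (λ q → + q ℤ.+ (+ s ℤ.* + r ℤ.+ + suc q ℤ.* + b)) q≡ ⟨≡⟩
              cong (λ x → + q ℤ.+ x) (cong₂ ℤ._+_ (≡.sym (ℤₚ.pos-* s r)) (≡.sym (ℤₚ.pos-* p b))))))
            where
            infixr 1 _⟨≡⟩_
            _⟨≡⟩_ : ∀ {x y z : ℤ} → x ≡ y → y ≡ z → x ≡ z
            _⟨≡⟩_ = ≡.trans
          perturbed : Q p v ≡ + q → Perturbed p v
          perturbed e = by-case (ℕₚ.m*n≡0⇒m≡0∨n≡0 s (ℕₚ.m+n≡0⇒m≡0 (s ℕ.* r) excess))
            where
            excess : s ℕ.* r ℕ.+ p ℕ.* b ≡ 0
            excess = ℕₚ.+-cancelˡ-≡ q _ _ (≡.trans (ℤₚ.+-injective (≡.trans (≡.sym Q≡) e)) (≡.sym (ℕₚ.+-identityʳ q)))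
            b≡0 : b ≡ 0
            b≡0 = ℕₚ.m+n≡0⇒m≡0 b (ℕₚ.m+n≡0⇒n≡0 (s ℕ.* r) excess)
            ΣA′ : Σ p (λ d → v d ℤ.* v d) ≡ + suc s
            ΣA′ = ≡.trans ΣA (cong +_ (≡.trans (≡.sym a≡) (≡.trans (cong (suc s ℕ.+_) b≡0) (ℕₚ.+-identityʳ _))))
            Σw² : r ≡ 0 → Σ p (λ d → (v d ℤ.- + 1) ℤ.* (v d ℤ.- + 1)) ≡ + 1
            Σw² r≡0 = ≡.trans (Σ²-shifted v (+ 1)) (≡.trans
              (cong₂ (λ a s → (a ℤ.- + 2 ℤ.* + 1 ℤ.* s) ℤ.+ + p ℤ.* (+ 1 ℤ.* + 1)) (≡.trans ΣA′ (cong +_ s≡q)) (≡.trans Σv (cong +_ s≡q)))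
              (solve 1 (λ q → (q :- con (+ 2) :* con (+ 1) :* q) :+ (con (+ 1) :+ q) :* (con (+ 1) :* con (+ 1)) := con (+ 1)) ≡.refl (+ q)))
              where
              s≡q : suc s ≡ q
              s≡q = ≡.trans (≡.sym (ℕₚ.+-identityʳ _)) (≡.trans (cong (suc s ℕ.+_) (≡.sym r≡0)) q≡)
            by-case : s ≡ 0 ⊎ r ≡ 0 → Perturbed p v
            by-case (inj₁ s≡0) = from-square v (+ 0) (≡.trans (Σ²-shifted v (+ 0)) (≡.trans
              (solve 3 (λ p a s → (a :- con (+ 2) :* con (+ 0) :* s) :+ p :* (con (+ 0) :* con (+ 0)) := a) ≡.refl
                (+ p) (Σ p (λ d → v d ℤ.* v d)) (Σ p v))
              (≡.trans ΣA′ (cong (+_ ∘ suc) s≡0))))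
            by-case (inj₂ r≡0) = from-square v (+ 1) (Σw² r≡0)

    constant∨perturbed : ∀ v → (Constant p v × Q p v ≡ + 0) ⊎ (+ q ℤ.≤ Q p v × (Q p v ≡ + q → Perturbed p v))
    constant∨perturbed v = unshift (normalised (λ d → v d ℤ.- κ) s (ℤM.n%ℕd<d S p) (≡.trans (Σ-shifted v κ)
        (≡.trans (cong (ℤ._- + p ℤ.* κ) (ℤM.a≡a%ℕn+[a/ℕn]*n S p))
          (solve 3 (λ s k p → (s :+ k :* p) :- p :* k := s) ≡.refl (+ s) κ (+ p)))))
      where
      S κ : ℤ
      S = Σ p v
      κ = S ℤM./ℕ p
      s : ℕ
      s = S ℤM.%ℕ p
      unshift : Case (λ d → v d ℤ.- κ) → Case v
      unshift (inj₁ ((c , e) , Q0)) = inj₁ ((κ ℤ.+ c , λ d d<p → x-k≡y⇒x≡k+y (v d) κ (e d d<p)) , ≡.trans (≡.sym (Q-shifted v κ)) Q0)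
      unshift (inj₂ (q≤ , h)) = inj₂ (≡.subst (+ q ℤ.≤_) (Q-shifted v κ) q≤ , λ e → let
        (c , ε , d , ±1 , d<p , vd , rest) = h (≡.trans (Q-shifted v κ) e) in
        κ ℤ.+ c , ε , d , ±1 , d<p , ≡.trans (x-k≡y⇒x≡k+y (v d) κ vd) (≡.sym (ℤₚ.+-assoc κ c ε)) , λ j j<p ne → x-k≡y⇒x≡k+y (v j) κ (rest j j<p ne))

  constant∨perturbed : ∀ p .{{_ : NonZero p}} v →
    (Constant p v × Q p v ≡ + 0) ⊎ (+ ℕ.pred p ℤ.≤ Q p v × (Q p v ≡ + ℕ.pred p → Perturbed p v))
  constant∨perturbed (suc q) v = Variance.constant∨perturbed q v

-- (f(X) - f(1)) / (X - 1)
slope : Poly → Poly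
slope (con c) = con (+ 0)
slope X       = con (+ 1)
slope (f ⊕ g) = slope f ⊕ slope g
slope (f ⊗ g) = slope f ⊗ g ⊕ con (at1 f) ⊗ slope g

module LevelNorm (p : ℕ) (pp : Prime p) (2<p : 2 ℕ.< p) (i : ℕ) where
  open CyclotomicRing p pp i public
  private instance
    p≢0 : NonZero p
    p≢0 = prime⇒nonZero pp

  module Roots (m-1 : ℕ) (e : suc m-1 ≡ n) where
    open RootOfUnity ringℤ m-1 torsion-free X
      (trans (^≈X^ (suc m-1)) (X^-n∣ (≡.subst (n ℕD.∣_) (≡.sym e) ℕD.∣-refl)))
      (λ k 0<k k<m → regular-resp (+-congˡ (-‿cong (sym (^≈X^ k))))
        (1-X^-regular (λ n∣k → ℕₚ.<⇒≱ (≡.subst (k ℕ.<_) e k<m) (ℕD.∣⇒≤ {{ℕ.>-nonZero 0<k}} n∣k))))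
      public

  private
    1-X^⁺ : ℕ → Poly
    1-X^⁺ zero    = 1#
    1-X^⁺ (suc k) = 1# - X^ suc k

    1-X^⁺-≢0 : ∀ {k} → k ≢ 0 → 1-X^⁺ k ≡ 1# - X^ k
    1-X^⁺-≢0 {zero}  ne = contradiction ≡.refl ne
    1-X^⁺-≢0 {suc k} ne = ≡.refl

    ∏-n : ∀ m-1 → suc m-1 ≡ n → Π (suc m-1) 1-X^⁺ ≈ ιℕ (suc m-1)
    ∏-n m-1 e = trans (*-identityˡ _) (trans (Π-cong m-1 λ k _ → +-congˡ (-‿cong (sym (^≈X^ (suc k))))) ∏[1-ρ^k]≈m)
      where open Roots m-1 e

    ∏-P : ∀ m-1 → suc m-1 ≡ P → Π (suc m-1) (λ k → 1-X^⁺ (p ℕ.* k)) ≈ ιℕ (suc m-1)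
    ∏-P m-1 e = trans (*-cong (reflexive (cong 1-X^⁺ (ℕₚ.*-zeroʳ p)))
        (Π-cong m-1 λ k _ → trans (reflexive (1-X^⁺-≢0 (ℕ.≢-nonZero⁻¹ (p ℕ.* suc k) {{ℕₚ.m*n≢0 p (suc k)}})))
          (+-congˡ (-‿cong (X^-* p (suc k))))))
      (trans (*-identityˡ _) ∏[1-ρ^k]≈m)
      where
      open RootOfUnity ringℤ m-1 torsion-free (X^ p)
        (trans (sym (X^-* p (suc m-1))) (X^-n∣ (≡.subst (λ x → n ℕD.∣ p ℕ.* x) (≡.sym e) ℕD.∣-refl)))
        (λ k 0<k k<m → regular-resp (+-congˡ (-‿cong (X^-* p k)))
          (1-X^-regular (λ n∣pk → ℕₚ.<⇒≱ (≡.subst (k ℕ.<_) e k<m) (ℕD.∣⇒≤ {{ℕ.>-nonZero 0<k}} (ℕD.*-cancelˡ-∣ p n∣pk)))))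

  norm-1-X : norm (1# - X) ≡ + p
  norm-1-X = ℤₚ.*-cancelʳ-≡ (norm (1# - X)) (+ p) (+ P) {{ℕ.>-nonZero 0<P}} (ι-injective (begin
    ι (norm (1# - X) ℤ.* + P)
      ≈⟨ ι-* (norm (1# - X)) (+ P) ⟩
    ι (norm (1# - X)) * ιℕ P
      ≈⟨ *-cong (trans (sym (conjugates≈norm (1# - X))) (Πₗ-cong units λ {k} k∈ →
           reflexive (≡.sym (1-X^⁺-≢0 λ k≡0 → proj₂ (∈-units⁻ k∈) (≡.subst (p ℕD.∣_) (≡.sym k≡0) (p ℕD.∣0))))))
         (sym (≡.subst (λ m → Π m (λ k → 1-X^⁺ (p ℕ.* k)) ≈ ιℕ m) (ℕₚ.suc-pred P) (∏-P (ℕ.pred P) (ℕₚ.suc-pred P)))) ⟩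
    Πₗ units 1-X^⁺ * Π P (λ k → 1-X^⁺ (p ℕ.* k))
      ≈⟨ *-congˡ (reflexive (≡.trans (Πₗ-map (p ℕ.*_) (upTo P) 1-X^⁺) (Πₗ-upTo P (1-X^⁺ ∘ (p ℕ.*_))))) ⟨
    Πₗ units 1-X^⁺ * Πₗ (map (p ℕ.*_) (upTo P)) 1-X^⁺
      ≈⟨ Πₗ-++ units (map (p ℕ.*_) (upTo P)) 1-X^⁺ ⟨
    Πₗ (units ++ map (p ℕ.*_) (upTo P)) 1-X^⁺
      ≈⟨ trans (Πₗ-↭ upTo-↭ 1-X^⁺) (reflexive (Πₗ-upTo n 1-X^⁺)) ⟩
    Π n 1-X^⁺
      ≈⟨ ≡.subst (λ m → Π m 1-X^⁺ ≈ ιℕ m) (ℕₚ.suc-pred n) (∏-n (ℕ.pred n) (ℕₚ.suc-pred n)) ⟩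
    ιℕ n
      ≡⟨ cong ι (ℤₚ.pos-* p P) ⟩
    ι (+ p ℤ.* + P) ∎))

  1-X∣ι⇒p∣ : ∀ {c} → 1# - X ∣ ι c → p ℕD.∣ ∣ c ∣
  1-X∣ι⇒p∣ {c} (divides z e) = p∣^⇒p∣ (length units) (≡.subst (p ℕD.∣_) (abs-^ c (length units))
    (≡.subst (λ x → p ℕD.∣ ∣ x ∣) (≡.trans (≡.sym (≡.trans (norm-cong e) (≡.trans (norm-* (1# - X) z) (cong (ℤ._* norm z) norm-1-X)))) (norm-ι c))
      (≡.subst (p ℕD.∣_) (≡.sym (ℤₚ.abs-* (+ p) (norm z))) (ℕD.m∣m*n ∣ norm z ∣))))

  1-X∣p : 1# - X ∣ ιℕ p
  1-X∣p = ∣-trans (1-X∣1-X^ P) 1-ζ∣p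

  p∣⇒1-X∣ι : ∀ {c} → p ℕD.∣ ∣ c ∣ → 1# - X ∣ ι c
  p∣⇒1-X∣ι {c} h = ∣-trans 1-X∣p (ι-∣⁺ {+ p} {c} h)

  ≡at1 : ∀ f → f ≡ ι (at1 f) [mod 1# - X ]
  ≡at1 (con c) = mod-refl
  ≡at1 X       = mod-sym ∣-refl
  ≡at1 (f ⊕ g) = mod-trans (mod-+ (≡at1 f) (≡at1 g)) (mod-reflexive (sym (ι-+ (at1 f) (at1 g))))
  ≡at1 (f ⊗ g) = mod-trans (mod-* (≡at1 f) (≡at1 g)) (mod-reflexive (sym (ι-* (at1 f) (at1 g))))

  σ≡at1 : ∀ {k} → ¬ (p ℕD.∣ k) → ∀ f → σ k f ≡ ι (at1 f) [mod 1# - X ]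
  σ≡at1 {k} p∤k f = mod-weaken (1-X∣1-X^ k) (σ-∣ p∤k (≡at1 f))

  norm≡at1^ : ∀ f → ι (norm f) ≡ ι (at1 f) ^ length units [mod 1# - X ]
  norm≡at1^ f = mod-trans (mod-reflexive (sym (conjugates≈norm f)))
    (mod-Πₗ-const units (ι (at1 f)) λ k∈ → σ≡at1 (proj₂ (∈-units⁻ k∈)) f)

  p∣norm⇒p∣at1 : ∀ f → p ℕD.∣ ∣ norm f ∣ → p ℕD.∣ ∣ at1 f ∣
  p∣norm⇒p∣at1 f h = p∣^⇒p∣ (length units) (≡.subst (p ℕD.∣_) (abs-^ (at1 f) (length units))
    (1-X∣ι⇒p∣ {at1 f ℤ.^ length units} (∣-respʳ (sym (ι-^ (at1 f) (length units)))
      (mod-∣ (norm≡at1^ f) (p∣⇒1-X∣ι {norm f} h)))))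

  p∣at1⇒p∣norm : ∀ f → p ℕD.∣ ∣ at1 f ∣ → p ℕD.∣ ∣ norm f ∣
  p∣at1⇒p∣norm f h = 1-X∣ι⇒p∣ {norm f} (mod-∣ (mod-sym (norm≡at1^ f))
    (∣-trans (p∣⇒1-X∣ι {at1 f} h) (∣-^ (ι (at1 f)) (length units) (ℕₚ.n≢0⇒n>0 (λ e → length-units≢0 (cong (λ l → + l) e))))))

  slope-correct : ∀ f → f ≈ ι (at1 f) - (1# - X) * slope f
  slope-correct (con c) = sym (trans (+-congˡ (trans (-‿cong (zeroʳ _)) -0#≈0#)) (+-identityʳ _))
  slope-correct X = sym (trans (+-congˡ (-‿cong (*-identityʳ _)))
    (solve 2 (λ o x → o :- (o :- x) := x) refl 1# X))
  slope-correct (f ⊕ g) = trans (+-cong (slope-correct f) (slope-correct g)) (trans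
    (solve 5 (λ a b y s t → (a :- y :* s) :+ (b :- y :* t) := (a :+ b) :- y :* (s :+ t)) refl
      (ι (at1 f)) (ι (at1 g)) (1# - X) (slope f) (slope g))
    (+-congʳ (sym (ι-+ (at1 f) (at1 g)))))
  slope-correct (f ⊗ g) = begin
    f * g
      ≈⟨ *-congʳ (slope-correct f) ⟩
    (ι (at1 f) - (1# - X) * slope f) * g
      ≈⟨ solve 4 (λ a y s g → (a :- y :* s) :* g := a :* g :- y :* (s :* g)) refl (ι (at1 f)) (1# - X) (slope f) g ⟩
    ι (at1 f) * g - (1# - X) * (slope f * g)
      ≈⟨ +-congʳ (*-congˡ (slope-correct g)) ⟩
    ι (at1 f) * (ι (at1 g) - (1# - X) * slope g) - (1# - X) * (slope f * g)
      ≈⟨ solve 5 (λ a b y t w → a :* (b :- y :* t) :- y :* w := a :* b :- y :* (w :+ a :* t)) refl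
           (ι (at1 f)) (ι (at1 g)) (1# - X) (slope g) (slope f * g) ⟩
    ι (at1 f) * ι (at1 g) - (1# - X) * slope (f ⊗ g)
      ≈⟨ +-congʳ (ι-* (at1 f) (at1 g)) ⟨
    ι (at1 f ℤ.* at1 g) - (1# - X) * slope (f ⊗ g) ∎

  p/[1-X] : Poly
  p/[1-X] = Σ p (λ c → Σ (c ℕ.* P) X^_)

  p/[1-X]-correct : (1# - X) * p/[1-X] ≈ ιℕ p
  p/[1-X]-correct = begin
    (1# - X) * Σ p (λ c → Σ (c ℕ.* P) X^_)     ≈⟨ Σ-*ˡ p (1# - X) (λ c → Σ (c ℕ.* P) X^_) ⟩
    Σ p (λ c → (1# - X) * Σ (c ℕ.* P) X^_)     ≈⟨ Σ-cong p (λ c _ → begin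
      (1# - X) * Σ (c ℕ.* P) X^_                 ≈⟨ *-congˡ (Σ-cong (c ℕ.* P) λ k _ → ^≈X^ k) ⟨
      (1# - X) * Σ (c ℕ.* P) (X ^_)              ≈⟨ geometric X (c ℕ.* P) ⟩
      1# - X ^ (c ℕ.* P)                         ≈⟨ +-congˡ (-‿cong (^≈X^ (c ℕ.* P))) ⟩
      1# - X^ (c ℕ.* P)                          ∎) ⟩
    Σ p (λ c → 1# - X^ (c ℕ.* P))              ≈⟨ p≈Σ[1-ζ^c] ⟨
    ιℕ p                                       ∎

  p∤2 : ¬ (p ℕD.∣ 2)
  p∤2 h = ℕₚ.<⇒≱ 2<p (ℕD.∣⇒≤ h)

  p∣2x⇒p∣x : ∀ {x} → p ℕD.∣ 2 ℕ.* x → p ℕD.∣ x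
  p∣2x⇒p∣x {x} h with euclidsLemma 2 x pp h
  ... | inj₁ p∣2 = contradiction p∣2 p∤2
  ... | inj₂ p∣x = p∣x

  p∣at1-p/[1-X] : p ℕD.∣ ∣ at1 p/[1-X] ∣
  p∣at1-p/[1-X] = p∣2x⇒p∣x (≡.subst (p ℕD.∣_) (≡.trans (cong ∣_∣ (≡.sym total)) (ℤₚ.abs-* (+ 2) (at1 p/[1-X])))
      (≡.subst (p ℕD.∣_) (≡.sym (ℤₚ.abs-* (+ p) _)) (ℕD.m∣m*n _)))
    where
    at1-Σ : ∀ m F → at1 (Σ m F) ≡ ℤK.Σ m (at1 ∘ F)
    at1-Σ zero    F = ≡.refl
    at1-Σ (suc m) F = cong (ℤ._+_ (at1 (F 0))) (at1-Σ m (F ∘ suc))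
    at1-X^ : ∀ k → at1 (X^ k) ≡ + 1
    at1-X^ zero    = ≡.refl
    at1-X^ (suc k) = ≡.trans (ℤₚ.*-identityˡ _) (at1-X^ k)
    gauss : ∀ m → + 2 ℤ.* ℤK.Σ m (λ c → + c) ≡ + m ℤ.* (+ m ℤ.- + 1)
    gauss zero    = ≡.refl
    gauss (suc m) = ≡.trans (cong (ℤ._*_ (+ 2)) (ℤK.Σ-last m (λ c → + c))) (≡.trans (ℤₚ.*-distribˡ-+ (+ 2) (ℤK.Σ m (λ c → + c)) (+ m))
      (≡.trans (cong (ℤ._+ + 2 ℤ.* + m) (gauss m))
        (ℤK.solve 1 (λ m → m ℤK.:* (m ℤK.:- ℤK.con (+ 1)) ℤK.:+ ℤK.con (+ 2) ℤK.:* m ℤK.:= (ℤK.con (+ 1) ℤK.:+ m) ℤK.:* ((ℤK.con (+ 1) ℤK.:+ m) ℤK.:- ℤK.con (+ 1))) ≡.refl (+ m))))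
    total : + 2 ℤ.* at1 p/[1-X] ≡ + p ℤ.* ((+ p ℤ.- + 1) ℤ.* + P)
    total =
      + 2 ℤ.* at1 p/[1-X]
        ≡⟪ cong (ℤ._*_ (+ 2)) (≡.trans (at1-Σ p (λ c → Σ (c ℕ.* P) X^_)) (ℤK.Σ-cong p λ c _ →
             ≡.trans (at1-Σ (c ℕ.* P) X^_) (≡.trans (ℤK.Σ-cong (c ℕ.* P) (λ k _ → at1-X^ k)) (≡.trans (ℤK.Σ-const (c ℕ.* P) (+ 1))
               (≡.trans (ℤₚ.*-identityʳ _) (ℤₚ.pos-* c P)))))) ⟫
      + 2 ℤ.* ℤK.Σ p (λ c → + c ℤ.* + P)
        ≡⟪ cong (ℤ._*_ (+ 2)) (≡.sym (ℤK.Σ-*ʳ p (+ P) (λ c → + c))) ⟫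
      + 2 ℤ.* (ℤK.Σ p (λ c → + c) ℤ.* + P)
        ≡⟪ ≡.trans (≡.sym (ℤₚ.*-assoc (+ 2) (ℤK.Σ p (λ c → + c)) (+ P))) (cong (ℤ._* + P) (gauss p)) ⟫
      + p ℤ.* (+ p ℤ.- + 1) ℤ.* + P
        ≡⟪ ℤₚ.*-assoc (+ p) (+ p ℤ.- + 1) (+ P) ⟫
      + p ℤ.* ((+ p ℤ.- + 1) ℤ.* + P) □

  -- F / (1 - X), given F(1) = p k
  cofactor₁ : ℤ → Poly → Poly
  cofactor₁ k F = ι k * p/[1-X] - slope F

  module _ {F k} (F1≡pk : at1 F ≡ + p ℤ.* k) where
    cofactor₁-correct : F ≈ (1# - X) * cofactor₁ k F
    cofactor₁-correct = begin
      F
        ≈⟨ slope-correct F ⟩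
      ι (at1 F) - (1# - X) * slope F
        ≈⟨ +-congʳ (trans (reflexive (cong ι F1≡pk)) (trans (ι-* (+ p) k) (*-congʳ (sym p/[1-X]-correct)))) ⟩
      (1# - X) * p/[1-X] * ι k - (1# - X) * slope F
        ≈⟨ solve 4 (λ y w k s → y :* w :* k :- y :* s := y :* (k :* w :- s)) refl (1# - X) p/[1-X] (ι k) (slope F) ⟩
      (1# - X) * cofactor₁ k F ∎

    norm-cofactor₁ : norm F ≡ + p ℤ.* norm (cofactor₁ k F)
    norm-cofactor₁ = ≡.trans (norm-cong cofactor₁-correct)
      (≡.trans (norm-* (1# - X) (cofactor₁ k F)) (cong (ℤ._* norm (cofactor₁ k F)) norm-1-X))

    private
      p∣k*w : p ℕD.∣ ∣ k ℤ.* at1 p/[1-X] ∣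
      p∣k*w = ≡.subst (p ℕD.∣_) (≡.sym (ℤₚ.abs-* k (at1 p/[1-X]))) (ℕD.∣n⇒∣m*n ∣ k ∣ p∣at1-p/[1-X])
      abs-at1-cofactor : at1 (cofactor₁ k F) ≡ k ℤ.* at1 p/[1-X] ℤ.+ ℤ.- at1 (slope F)
      abs-at1-cofactor = cong (ℤ._+_ (k ℤ.* at1 p/[1-X])) (ℤₚ.-1*i≡-i (at1 (slope F)))

    p∣at1-cofactor₁⇒ : p ℕD.∣ ∣ at1 (cofactor₁ k F) ∣ → p ℕD.∣ ∣ at1 (slope F) ∣
    p∣at1-cofactor₁⇒ h = ≡.subst (p ℕD.∣_) (ℤₚ.∣-i∣≡∣i∣ (at1 (slope F)))
      (ℤS.∣⇒∣ᵤ {+ p} (ℤS.∣m+n∣m⇒∣n {+ p} {k ℤ.* at1 p/[1-X]} (≡.subst (ℤS._∣_ (+ p)) abs-at1-cofactor (ℤS.∣ᵤ⇒∣ h)) (ℤS.∣ᵤ⇒∣ p∣k*w)))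

    p∣at1-slope⇒ : p ℕD.∣ ∣ at1 (slope F) ∣ → p ℕD.∣ ∣ at1 (cofactor₁ k F) ∣
    p∣at1-slope⇒ h = ℤS.∣⇒∣ᵤ {+ p} (≡.subst (ℤS._∣_ (+ p)) (≡.sym abs-at1-cofactor)
      (ℤS.∣m∣n⇒∣m+n {+ p} {k ℤ.* at1 p/[1-X]} {ℤ.- at1 (slope F)} (ℤS.∣ᵤ⇒∣ p∣k*w) (ℤS.∣m⇒∣-m {+ p} {at1 (slope F)} (ℤS.∣ᵤ⇒∣ h))))

  product-split : ∀ F → Π n (λ k → σ k F) ≈ ι (norm F) * Π P (λ k → σ (p ℕ.* k) F)
  product-split F = begin
    Π n (λ k → σ k F)
      ≡⟨ Πₗ-upTo n (λ k → σ k F) ⟨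
    Πₗ (upTo n) (λ k → σ k F)
      ≈⟨ Πₗ-↭ upTo-↭ (λ k → σ k F) ⟨
    Πₗ (units ++ map (p ℕ.*_) (upTo P)) (λ k → σ k F)
      ≈⟨ Πₗ-++ units (map (p ℕ.*_) (upTo P)) (λ k → σ k F) ⟩
    conjugates F * Πₗ (map (p ℕ.*_) (upTo P)) (λ k → σ k F)
      ≈⟨ *-cong (conjugates≈norm F) (reflexive (≡.trans (Πₗ-map (p ℕ.*_) (upTo P) (λ k → σ k F)) (Πₗ-upTo P (λ k → σ (p ℕ.* k) F)))) ⟩
    ι (norm F) * Π P (λ k → σ (p ℕ.* k) F) ∎

  circulant-polynomial : ∀ m-1 → (Fin (suc m-1) → ℤ) → Poly
  circulant-polynomial m-1 a = Σ (suc m-1) (λ l → ι (a (l mod suc m-1)) * X^ l)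

  det-circulant≈ : ∀ m-1 → suc m-1 ≡ n → ∀ a →
    ι (det (suc m-1) (circulant m-1 a)) ≈ Π n (λ k → σ k (circulant-polynomial m-1 a))
  det-circulant≈ m-1 e a = trans (det-circulant a) (trans
    (Π-cong (suc m-1) λ k _ → trans (Σ-cong (suc m-1) λ l _ → *-congˡ {ι (entry a l)}
        (trans (^-congˡ l (^≈X^ k)) (trans (sym (X^-* k l)) (sym (σ-X^ k l)))))
      (reflexive (≡.sym (σ-Σ k (suc m-1) (λ l → ι (a (l mod suc m-1)) * X^ l)))))
    (reflexive (cong (λ m → Π m (λ k → σ k (circulant-polynomial m-1 a))) e)))
    where open Roots m-1 e

  multiples-of-n² : ∀ m-1 → suc m-1 ≡ n → ∀ c →
    ∃ λ a → det (suc m-1) (circulant m-1 a) ≡ + (n ℕ.* n) ℤ.* c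
  multiples-of-n² zero e c = contradiction e (ℕₚ.<⇒≢ 1<n)
  multiples-of-n² m-1@(suc m-2) e c = a , ι-injective (begin
    ι (det m (circulant m-1 a))
      ≈⟨ det-circulant a ⟩
    Π m value
      ≈⟨ *-cong value-0 (trans (Π-cong m-1 λ k k<m-1 → value-suc k k<m-1) ∏[1-ρ^k]≈m) ⟩
    (ι c * ιℕ m) * ιℕ m
      ≈⟨ solve 2 (λ c m → c :* m :* m := m :* m :* c) refl (ι c) (ιℕ m) ⟩
    ιℕ m * ιℕ m * ι c
      ≈⟨ trans (*-congʳ (trans (sym (ι-* (+ m) (+ m))) (reflexive (cong ι (≡.trans (≡.sym (ℤₚ.pos-* m m)) (cong (λ m → + (m ℕ.* m)) e)))))) (sym (ι-* (+ (n ℕ.* n)) c)) ⟩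
    ι (+ (n ℕ.* n) ℤ.* c) ∎)
    where
    open Roots m-1 e
    m : ℕ
    m = suc m-1
    b : ℕ → ℤ
    b zero          = + 1
    b (suc zero)    = ℤ.- + 1
    b (suc (suc _)) = + 0
    a : Fin m → ℤ
    a l = c ℤ.+ b (toℕ l)
    value : ℕ → Poly
    value k = Σ m (λ l → ι (entry a l) * (X ^ k) ^ l)
    entry-a : ∀ l → l ℕ.< m → entry a l ≡ c ℤ.+ b l
    entry-a l l<m = cong (λ x → c ℤ.+ b x) (≡.trans (Finₚ.toℕ-fromℕ< (m%n<n l m)) (m<n⇒m%n≡m l<m))
    Σ-b : ∀ y → Σ m (λ l → ι (b l) * y ^ l) ≈ 1# - y
    Σ-b y = begin
      ι (+ 1) * 1# + (ι (ℤ.- + 1) * (y * 1#) + Σ m-2 (λ l → ι (+ 0) * y ^ suc (suc l)))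
        ≈⟨ +-cong (*-identityʳ 1#) (+-cong (trans (*-congˡ {ι (ℤ.- + 1)} (*-identityʳ y)) (trans (*-congʳ (ι-neg (+ 1))) (-1*x≈-x y)))
             (trans (Σ-cong m-2 (λ l _ → zeroˡ (y ^ suc (suc l)))) (Σ-0 m-2))) ⟩
      1# + (- y + 0#)  ≈⟨ +-congˡ (+-identityʳ (- y)) ⟩
      1# - y           ∎
    value≈ : ∀ k → value k ≈ ι c * Σ m ((X ^ k) ^_) + (1# - X ^ k)
    value≈ k = begin
      Σ m (λ l → ι (entry a l) * (X ^ k) ^ l)
        ≈⟨ Σ-cong m (λ l l<m → trans (*-congʳ {(X ^ k) ^ l} (trans (reflexive (cong ι (entry-a l l<m))) (ι-+ c (b l)))) (distribʳ ((X ^ k) ^ l) (ι c) (ι (b l)))) ⟩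
      Σ m (λ l → ι c * (X ^ k) ^ l + ι (b l) * (X ^ k) ^ l)
        ≈⟨ Σ-+ m (λ l → ι c * (X ^ k) ^ l) (λ l → ι (b l) * (X ^ k) ^ l) ⟩
      Σ m (λ l → ι c * (X ^ k) ^ l) + Σ m (λ l → ι (b l) * (X ^ k) ^ l)
        ≈⟨ +-cong (sym (Σ-*ˡ m (ι c) ((X ^ k) ^_))) (Σ-b (X ^ k)) ⟩
      ι c * Σ m ((X ^ k) ^_) + (1# - X ^ k) ∎
    value-0 : value 0 ≈ ι c * ιℕ m
    value-0 = trans (value≈ 0) (trans (+-cong (*-congˡ {ι c} (trans (Σ-cong m (λ l _ → 1^ l)) (trans (Σ-const m 1#) (*-identityʳ (ιℕ m))))) (-‿inverseʳ 1#))
      (+-identityʳ (ι c * ιℕ m)))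
    value-suc : ∀ k → k ℕ.< m-1 → value (suc k) ≈ 1# - X ^ suc k
    value-suc k k<m-1 = trans (value≈ (suc k)) (trans (+-congʳ (trans (*-congˡ {ι c} (Σρ^kh≈0 (suc k) ℕ.z<s (ℕ.s<s k<m-1))) (zeroʳ (ι c)))) (+-identityˡ (1# - X ^ suc k)))

-- The exponent M is a representative of -1 modulo n, so that σ M is complex conjugation.
module Conjugation (p : ℕ) (pp : Prime p) (2<p : 2 ℕ.< p) (i M : ℕ) (n∣1+M : p ℕ.* p ℕ.^ i ℕD.∣ suc M) where
  open LevelNorm p pp 2<p i public
  open ℤSums hiding (Σ-mono)
  private instance
    p≢0 : NonZero p
    p≢0 = prime⇒nonZero pp

  conj : Poly → Poly
  conj = σ M

  p∤M : ¬ (p ℕD.∣ M)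
  p∤M h = p∤1 (ℕD.∣m+n∣m⇒∣n (≡.subst (p ℕD.∣_) (ℕₚ.+-comm 1 M) (ℕD.∣-trans p∣n n∣1+M)) h)

  Σ-P-periodic : ∀ {g} → Periodic g → ∀ e d →
    ℤK.Σ p (λ c → g (e ℕ.+ d ℕ.* P ℕ.+ c ℕ.* P)) ≡ ℤK.Σ p (λ c → g (e ℕ.+ c ℕ.* P))
  Σ-P-periodic {g} per e d =
    ℤK.Σ p (λ c → g (e ℕ.+ d ℕ.* P ℕ.+ c ℕ.* P))
      ≡⟪ ℤK.Σ-cong p (λ c _ → cong g (≡.trans (ℕₚ.+-assoc e _ _)
           (cong (e ℕ.+_) (≡.trans (ℕₚ.+-comm (d ℕ.* P) _) (≡.sym (ℕₚ.*-distribʳ-+ P c d)))))) ⟫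
    ℤK.Σ p (λ c → g (e ℕ.+ (c ℕ.+ d) ℕ.* P))
      ≡⟪ ℤK.Σ-shift p (λ c → g (e ℕ.+ c ℕ.* P)) (λ c → ≡.trans (cong g (≡.trans (cong (e ℕ.+_) (ℕₚ.*-distribʳ-+ P c p))
           (≡.sym (ℕₚ.+-assoc e _ _)))) (per (e ℕ.+ c ℕ.* P))) d ⟫
    ℤK.Σ p (λ c → g (e ℕ.+ c ℕ.* P)) □

  private
    -- p times the coefficient of 1 minus the sum of the coefficients of the powers of ζ: the trace divided by P.
    δ τ : ℕ → ℤ
    δ = indicator n 0
    τ e = + p ℤ.* δ e ℤ.- ℤK.Σ p (λ c → δ (e ℕ.+ c ℕ.* P))

    τ-Ann : Ann τ
    τ-Ann e =
      ℤK.Σ p (λ d → + p ℤ.* δ (e ℕ.+ d ℕ.* P) ℤ.- ℤK.Σ p (λ c → δ (e ℕ.+ d ℕ.* P ℕ.+ c ℕ.* P)))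
        ≡⟪ ℤK.Σ-+ p (λ d → + p ℤ.* δ (e ℕ.+ d ℕ.* P)) (λ d → ℤ.- ℤK.Σ p (λ c → δ (e ℕ.+ d ℕ.* P ℕ.+ c ℕ.* P))) ⟫
      ℤK.Σ p (λ d → + p ℤ.* δ (e ℕ.+ d ℕ.* P)) ℤ.+ ℤK.Σ p (λ d → ℤ.- ℤK.Σ p (λ c → δ (e ℕ.+ d ℕ.* P ℕ.+ c ℕ.* P)))
        ≡⟪ cong₂ ℤ._+_ (≡.sym (ℤK.Σ-*ˡ p (+ p) (λ d → δ (e ℕ.+ d ℕ.* P))))
             (≡.trans (ℤK.Σ-cong p (λ d _ → cong ℤ.-_ (Σ-P-periodic {δ} (indicator-periodic n 0) e d)))
               (≡.trans (ℤK.Σ-const p (ℤ.- G)) (≡.sym (ℤₚ.neg-distribʳ-* (+ p) G)))) ⟫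
      + p ℤ.* G ℤ.- + p ℤ.* G
        ≡⟪ ℤₚ.+-inverseʳ (+ p ℤ.* G) ⟫
      + 0 □
      where
      G : ℤ
      G = ℤK.Σ p (λ d → δ (e ℕ.+ d ℕ.* P))

    τ-0 : τ 0 ≡ + ℕ.pred p
    τ-0 = ≡.trans (cong₂ (λ a b → + p ℤ.* a ℤ.- b) (indicator-≡ n 0 0 (m*n%n≡0 0 n)) single)
      (≡.trans (cong (ℤ._- + 1) (ℤₚ.*-identityʳ (+ p))) (pred p))
      where
      pred : ∀ p .{{_ : NonZero p}} → + p ℤ.- + 1 ≡ + ℕ.pred p
      pred (suc q) = ≡.refl
      single : ℤK.Σ p (λ c → δ (0 ℕ.+ c ℕ.* P)) ≡ + 1
      single = ≡.trans (ℤK.Σ-single p {k = 0} (ℕ.>-nonZero⁻¹ p) (λ c c<p c≢0 → indicator-≢ n 0 (c ℕ.* P) λ e →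
          c≢0 (ℕₚ.m*n≡0⇒m≡0 c P (≡.trans (≡.sym (m<n⇒m%n≡m (ℕₚ.*-monoˡ-< P c<p))) e))))
        (indicator-≡ n 0 0 (m*n%n≡0 0 n))

    -- The exponents x + M l and x ∸ l agree modulo n.
    select : ∀ (a : ℕ → ℤ) x → ℤK.Σ n (λ l → a l ℤ.* δ (x ℕ.+ M ℕ.* l)) ≡ a (x % n)
    select a x = ≡.trans (ℤK.Σ-single n {k = x % n} (m%n<n x n) (λ l l<n l≢ →
        ≡.trans (cong (a l ℤ.*_) (indicator-≢ n 0 _ (λ e → l≢ (≡.trans (≡.sym (m<n⇒m%n≡m l<n)) (congruent l e))))) (ℤₚ.*-zeroʳ (a l))))
      (≡.trans (cong (a (x % n) ℤ.*_) (indicator-≡ n 0 _ hit)) (ℤₚ.*-identityʳ _))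
      where
      congruent : ∀ l → (x ℕ.+ M ℕ.* l) % n ≡ 0 → l % n ≡ x % n
      congruent l e = ≡.trans (≡.sym (%-remove-+ʳ l (ℕD.m%n≡0⇒n∣m (x ℕ.+ M ℕ.* l) n e)))
        (≡.trans (cong (_% n) (≡.trans (ℕₚ.+-comm l _) (≡.trans (ℕₚ.+-assoc x _ l) (cong (x ℕ.+_) (ℕₚ.+-comm (M ℕ.* l) l)))))
          (%-remove-+ʳ x (ℕD.∣m⇒∣m*n l n∣1+M)))
      hit : (x ℕ.+ M ℕ.* (x % n)) % n ≡ 0
      hit = ≡.trans (%-distribˡ-+ x (M ℕ.* (x % n)) n) (≡.trans
        (cong (λ r → (r ℕ.+ (M ℕ.* (x % n)) % n) % n) (≡.sym (m%n%n≡m%n x n)))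
        (≡.trans (≡.sym (%-distribˡ-+ (x % n) (M ℕ.* (x % n)) n)) (ℕD.n∣m⇒m%n≡0 (suc M ℕ.* (x % n)) n (ℕD.∣m⇒∣m*n (x % n) n∣1+M))))

  private
    module _ (z : Poly) where
      a v : ℕ → ℤ
      a k = coefficient k z
      v e = a (e % n)
      column : ℕ → ℕ → ℤ
      column u d = v (u ℕ.+ d ℕ.* P)

      v-periodic : Periodic v
      v-periodic e = cong a ([m+n]%n≡m%n e n)

      expanded : Poly
      expanded = Σ n (λ k → ι (a k) * X^ k)

      act-expanded : ∀ φ e → act expanded φ e ≡ ℤK.Σ n (λ k → a k ℤ.* φ (e ℕ.+ k))
      act-expanded φ e = ≡.trans (act-ΣR n (λ k → ι (a k) * X^ k) φ e)
        (ℤK.Σ-cong n λ k _ → cong (a k ℤ.*_) (act-X^ k φ e))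

      act-conj-expanded : ∀ φ e → act (conj expanded) φ e ≡ ℤK.Σ n (λ l → a l ℤ.* φ (e ℕ.+ M ℕ.* l))
      act-conj-expanded φ e = ≡.trans (cong (act (conj expanded) φ) (≡.sym (≡.trans (cong (e ℕ.+_) (ℕₚ.*-zeroʳ M)) (ℕₚ.+-identityʳ e))))
        (≡.trans (act-subst-X^ M expanded φ e 0) (act-expanded (λ m → φ (e ℕ.+ M ℕ.* m)) 0))

      inner-sum : ∀ k → ℤK.Σ n (λ l → a l ℤ.* τ (k ℕ.+ M ℕ.* l)) ≡ + p ℤ.* v k ℤ.- ℤK.Σ p (λ c → v (k ℕ.+ c ℕ.* P))
      inner-sum k =
        ℤK.Σ n (λ l → a l ℤ.* τ (k ℕ.+ M ℕ.* l))
          ≡⟪ ℤK.Σ-cong n (λ l _ → rearrange l) ⟫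
        ℤK.Σ n (λ l → + p ℤ.* (a l ℤ.* δ (k ℕ.+ M ℕ.* l)) ℤ.+ ℤ.- ℤK.Σ p (λ c → a l ℤ.* δ (k ℕ.+ c ℕ.* P ℕ.+ M ℕ.* l)))
          ≡⟪ ℤK.Σ-+ n (λ l → + p ℤ.* (a l ℤ.* δ (k ℕ.+ M ℕ.* l))) (λ l → ℤ.- ℤK.Σ p (λ c → a l ℤ.* δ (k ℕ.+ c ℕ.* P ℕ.+ M ℕ.* l))) ⟫
        ℤK.Σ n (λ l → + p ℤ.* (a l ℤ.* δ (k ℕ.+ M ℕ.* l))) ℤ.+ ℤK.Σ n (λ l → ℤ.- ℤK.Σ p (λ c → a l ℤ.* δ (k ℕ.+ c ℕ.* P ℕ.+ M ℕ.* l)))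
          ≡⟪ cong₂ ℤ._+_
               (≡.trans (≡.sym (ℤK.Σ-*ˡ n (+ p) (λ l → a l ℤ.* δ (k ℕ.+ M ℕ.* l)))) (cong (+ p ℤ.*_) (select a k)))
               (≡.trans (ℤK.Σ-neg n (λ l → ℤK.Σ p (λ c → a l ℤ.* δ (k ℕ.+ c ℕ.* P ℕ.+ M ℕ.* l))))
                 (cong ℤ.-_ (≡.trans (ℤK.Σ-comm n p (λ l c → a l ℤ.* δ (k ℕ.+ c ℕ.* P ℕ.+ M ℕ.* l)))
                   (ℤK.Σ-cong p (λ c _ → select a (k ℕ.+ c ℕ.* P)))))) ⟫
        + p ℤ.* v k ℤ.- ℤK.Σ p (λ c → v (k ℕ.+ c ℕ.* P)) □
        where
        swap : ∀ l c → k ℕ.+ M ℕ.* l ℕ.+ c ℕ.* P ≡ k ℕ.+ c ℕ.* P ℕ.+ M ℕ.* l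
        swap l c = ≡.trans (ℕₚ.+-assoc k _ _) (≡.trans (cong (k ℕ.+_) (ℕₚ.+-comm (M ℕ.* l) _)) (≡.sym (ℕₚ.+-assoc k _ _)))
        rearrange : ∀ l → a l ℤ.* τ (k ℕ.+ M ℕ.* l) ≡
          + p ℤ.* (a l ℤ.* δ (k ℕ.+ M ℕ.* l)) ℤ.+ ℤ.- ℤK.Σ p (λ c → a l ℤ.* δ (k ℕ.+ c ℕ.* P ℕ.+ M ℕ.* l))
        rearrange l = ≡.trans
          (ℤK.solve 4 (λ a p d s → a ℤK.:* (p ℤK.:* d ℤK.:- s) ℤK.:= p ℤK.:* (a ℤK.:* d) ℤK.:+ (ℤK.:- (a ℤK.:* s))) ≡.refl
            (a l) (+ p) (δ (k ℕ.+ M ℕ.* l)) (ℤK.Σ p (λ c → δ (k ℕ.+ M ℕ.* l ℕ.+ c ℕ.* P))))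
          (cong (λ s → + p ℤ.* (a l ℤ.* δ (k ℕ.+ M ℕ.* l)) ℤ.+ ℤ.- s)
            (≡.trans (ℤK.Σ-*ˡ p (a l) (λ c → δ (k ℕ.+ M ℕ.* l ℕ.+ c ℕ.* P)))
              (ℤK.Σ-cong p (λ c _ → cong (λ e → a l ℤ.* δ e) (swap l c)))))

      trace-form : act (z * conj z) τ 0 ≡ ℤK.Σ P (λ u → Q p (column u))
      trace-form =
        act (z * conj z) τ 0
          ≡⟪ at (*-cong (expansion z) (σ-cong p∤M (expansion z))) τ τ-Ann 0 ⟫
        act expanded (act (conj expanded) τ) 0
          ≡⟪ act-expanded (act (conj expanded) τ) 0 ⟫
        ℤK.Σ n (λ k → a k ℤ.* act (conj expanded) τ k)
          ≡⟪ ℤK.Σ-cong n (λ k k<n → cong₂ ℤ._*_ (cong a (≡.sym (m<n⇒m%n≡m k<n))) (≡.trans (act-conj-expanded τ k) (inner-sum k))) ⟫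
        ℤK.Σ n term
          ≡⟪ ℤK.Σ-blocks p P term ⟫
        ℤK.Σ p (λ d → ℤK.Σ P (λ u → term (d ℕ.* P ℕ.+ u)))
          ≡⟪ ℤK.Σ-comm p P (λ d u → term (d ℕ.* P ℕ.+ u)) ⟫
        ℤK.Σ P (λ u → ℤK.Σ p (λ d → term (d ℕ.* P ℕ.+ u)))
          ≡⟪ ℤK.Σ-cong P (λ u _ → block u) ⟫
        ℤK.Σ P (λ u → Q p (column u)) □
        where
        term : ℕ → ℤ
        term k = v k ℤ.* (+ p ℤ.* v k ℤ.- ℤK.Σ p (λ c → v (k ℕ.+ c ℕ.* P)))
        block : ∀ u → ℤK.Σ p (λ d → term (d ℕ.* P ℕ.+ u)) ≡ Q p (column u)
        block u =
          ℤK.Σ p (λ d → term (d ℕ.* P ℕ.+ u))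
            ≡⟪ ℤK.Σ-cong p (λ d _ → ≡.trans (cong term (ℕₚ.+-comm (d ℕ.* P) u)) (≡.trans
                 (cong (λ s → w d ℤ.* (+ p ℤ.* w d ℤ.- s)) (Σ-P-periodic {v} v-periodic u d))
                 (ℤK.solve 3 (λ w p s → w ℤK.:* (p ℤK.:* w ℤK.:- s) ℤK.:= p ℤK.:* (w ℤK.:* w) ℤK.:+ (ℤK.:- s) ℤK.:* w) ≡.refl (w d) (+ p) S))) ⟫
          ℤK.Σ p (λ d → + p ℤ.* (w d ℤ.* w d) ℤ.+ (ℤ.- S) ℤ.* w d)
            ≡⟪ ℤK.Σ-+ p (λ d → + p ℤ.* (w d ℤ.* w d)) (λ d → (ℤ.- S) ℤ.* w d) ⟫
          ℤK.Σ p (λ d → + p ℤ.* (w d ℤ.* w d)) ℤ.+ ℤK.Σ p (λ d → (ℤ.- S) ℤ.* w d)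
            ≡⟪ cong₂ ℤ._+_ (≡.sym (ℤK.Σ-*ˡ p (+ p) (λ d → w d ℤ.* w d)))
                 (≡.trans (≡.sym (ℤK.Σ-*ˡ p (ℤ.- S) w)) (≡.sym (ℤₚ.neg-distribˡ-* S S))) ⟫
          Q p w □
          where
          w : ℕ → ℤ
          w = column u
          S : ℤ
          S = ℤK.Σ p w

      by-columns : z ≈ Σ P (λ u → X^ u * Σ p (λ d → ι (column u d) * X^ (d ℕ.* P)))
      by-columns = begin
        z
          ≈⟨ expansion z ⟩
        Σ n (λ k → ι (a k) * X^ k)
          ≈⟨ Σ-cong n (λ k k<n → *-congʳ {X^ k} (reflexive (cong (ι ∘ a) (≡.sym (m<n⇒m%n≡m k<n))))) ⟩
        Σ n (λ k → ι (v k) * X^ k)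
          ≈⟨ Σ-blocks p P (λ k → ι (v k) * X^ k) ⟩
        Σ p (λ d → Σ P (λ u → ι (v (d ℕ.* P ℕ.+ u)) * X^ (d ℕ.* P ℕ.+ u)))
          ≈⟨ Σ-comm p P (λ d u → ι (v (d ℕ.* P ℕ.+ u)) * X^ (d ℕ.* P ℕ.+ u)) ⟩
        Σ P (λ u → Σ p (λ d → ι (v (d ℕ.* P ℕ.+ u)) * X^ (d ℕ.* P ℕ.+ u)))
          ≈⟨ Σ-cong P (λ u _ → trans (Σ-cong p (λ d _ → begin
               ι (v (d ℕ.* P ℕ.+ u)) * X^ (d ℕ.* P ℕ.+ u)
                 ≡⟨ cong (λ e → ι (v e) * X^ e) (ℕₚ.+-comm (d ℕ.* P) u) ⟩
               ι (column u d) * X^ (u ℕ.+ d ℕ.* P)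
                 ≈⟨ *-congˡ {ι (column u d)} (X^-+ u (d ℕ.* P)) ⟩
               ι (column u d) * (X^ u * X^ (d ℕ.* P))
                 ≈⟨ solve 3 (λ a x y → a :* (x :* y) := x :* (a :* y)) refl (ι (column u d)) (X^ u) (X^ (d ℕ.* P)) ⟩
               X^ u * (ι (column u d) * X^ (d ℕ.* P)) ∎))
             (sym (Σ-*ˡ p (X^ u) (λ d → ι (column u d) * X^ (d ℕ.* P))))) ⟩
        Σ P (λ u → X^ u * Σ p (λ d → ι (column u d) * X^ (d ℕ.* P))) ∎

      constant-column : ∀ u → Constant p (column u) → Σ p (λ d → ι (column u d) * X^ (d ℕ.* P)) ≈ 0#
      constant-column u (κ , h) = begin
        Σ p (λ d → ι (column u d) * X^ (d ℕ.* P))   ≈⟨ Σ-cong p (λ d d<p → *-congʳ {X^ (d ℕ.* P)} (reflexive (cong ι (h d d<p)))) ⟩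
        Σ p (λ d → ι κ * X^ (d ℕ.* P))              ≈⟨ Σ-*ˡ p (ι κ) (λ d → X^ (d ℕ.* P)) ⟨
        ι κ * Σ p (λ d → X^ (d ℕ.* P))              ≈⟨ trans (*-congˡ Σζ^c≈0) (zeroʳ _) ⟩
        0#                                          ∎

      perturbed-column : ∀ u → Perturbed p (column u) →
        ∃₂ λ d ε → (ε ≡ + 1 ⊎ ε ≡ ℤ.- + 1) × Σ p (λ d → ι (column u d) * X^ (d ℕ.* P)) ≈ ι ε * X^ (d ℕ.* P)
      perturbed-column u (κ , ε , d₀ , ±1 , d₀<p , hit , miss) = d₀ , ε , ±1 , x-y≈0⇒x≈y (begin
        Σ p F - ι ε * X^ (d₀ ℕ.* P)
          ≈⟨ +-congʳ (trans (+-congˡ vanishing) (+-identityʳ _)) ⟨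
        Σ p F + Σ p (λ d → - (ι κ * X^ (d ℕ.* P))) - ι ε * X^ (d₀ ℕ.* P)
          ≈⟨ +-congʳ (Σ-+ p F (λ d → - (ι κ * X^ (d ℕ.* P)))) ⟨
        Σ p (λ d → F d - ι κ * X^ (d ℕ.* P)) - ι ε * X^ (d₀ ℕ.* P)
          ≈⟨ +-congʳ (Σ-single p d₀<p λ d d<p d≢ → trans (+-congʳ (*-congʳ (reflexive (cong ι (miss d d<p d≢))))) (-‿inverseʳ _)) ⟩
        (F d₀ - ι κ * X^ (d₀ ℕ.* P)) - ι ε * X^ (d₀ ℕ.* P)
          ≈⟨ +-congʳ (+-congʳ (*-congʳ (trans (reflexive (cong ι hit)) (ι-+ κ ε)))) ⟩
        ((ι κ + ι ε) * Y - ι κ * Y) - ι ε * Y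
          ≈⟨ solve 3 (λ k e y → ((k :+ e) :* y :- k :* y) :- e :* y := con (+ 0)) refl (ι κ) (ι ε) Y ⟩
        0# ∎)
        where
        F : ℕ → Poly
        F d = ι (column u d) * X^ (d ℕ.* P)
        Y : Poly
        Y = X^ (d₀ ℕ.* P)
        vanishing : Σ p (λ d → - (ι κ * X^ (d ℕ.* P))) ≈ 0#
        vanishing = trans (Σ-neg p (λ d → ι κ * X^ (d ℕ.* P)))
          (trans (-‿cong (trans (sym (Σ-*ˡ p (ι κ) (λ d → X^ (d ℕ.* P)))) (trans (*-congˡ Σζ^c≈0) (zeroʳ _)))) -0#≈0#)

  -- An element of absolute value 1 has trace form p - 1, which forces all but one column to be constant.
  root-of-unity : ∀ z → z * conj z ≈ 1# → ∃₂ λ r ε → (ε ≡ + 1 ⊎ ε ≡ ℤ.- + 1) × z ≈ ι ε * X^ r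
  root-of-unity z zz̄≈1 =
    let (u , u<P , Qu , rest) = unique-term P {λ u → Q p (column z u)} {λ u → Constant p (column z u) × Q p (column z u) ≡ + 0}
           (+ ℕ.pred p) 0<p-1 nonneg (λ _ → proj₂) dichotomy
           (≡.trans (≡.sym (trace-form z)) (≡.trans (at zz̄≈1 τ τ-Ann 0) (≡.trans (ℤₚ.*-identityˡ (τ 0)) τ-0)))
    in conclude u u<P (λ j j<P j≢u → proj₁ (rest j j<P j≢u)) (perturbed u Qu)
    where
    0<p-1 : + 0 ℤ.< + ℕ.pred p
    0<p-1 = ℤ.+<+ (ℕₚ.pred-mono-< 1<p)
    dichotomy : ∀ u → u ℕ.< P → (Constant p (column z u) × Q p (column z u) ≡ + 0) ⊎ + ℕ.pred p ℤ.≤ Q p (column z u)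
    dichotomy u _ with constant∨perturbed p (column z u)
    ... | inj₁ c       = inj₁ c
    ... | inj₂ (b , _) = inj₂ b
    nonneg : ∀ u → u ℕ.< P → + 0 ℤ.≤ Q p (column z u)
    nonneg u u<P with dichotomy u u<P
    ... | inj₁ (_ , e) = ℤₚ.≤-reflexive (≡.sym e)
    ... | inj₂ b       = ℤₚ.≤-trans (ℤₚ.<⇒≤ 0<p-1) b
    perturbed : ∀ u → Q p (column z u) ≡ + ℕ.pred p → Perturbed p (column z u)
    perturbed u e with constant∨perturbed p (column z u)
    ... | inj₁ (_ , e′) = contradiction (≡.trans (≡.sym e′) e) (ℤₚ.<⇒≢ 0<p-1)
    ... | inj₂ (_ , h)  = h e
    conclude : ∀ u → u ℕ.< P → (∀ j → j ℕ.< P → j ≢ u → Constant p (column z j)) → Perturbed p (column z u) →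
      ∃₂ λ r ε → (ε ≡ + 1 ⊎ ε ≡ ℤ.- + 1) × z ≈ ι ε * X^ r
    conclude u u<P others pert = let (d , ε , ±1 , e) = perturbed-column z u pert in
      u ℕ.+ d ℕ.* P , ε , ±1 , (begin
        z
          ≈⟨ by-columns z ⟩
        Σ P (λ u → X^ u * Σ p (λ d → ι (column z u d) * X^ (d ℕ.* P)))
          ≈⟨ Σ-single P u<P (λ j j<P j≢u → trans (*-congˡ {X^ j} (constant-column z j (others j j<P j≢u))) (zeroʳ (X^ j))) ⟩
        X^ u * Σ p (λ d → ι (column z u d) * X^ (d ℕ.* P))
          ≈⟨ *-congˡ {X^ u} e ⟩
        X^ u * (ι ε * X^ (d ℕ.* P))
          ≈⟨ solve 3 (λ x e y → x :* (e :* y) := e :* (x :* y)) refl (X^ u) (ι ε) (X^ (d ℕ.* P)) ⟩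
        ι ε * (X^ u * X^ (d ℕ.* P))
          ≈⟨ *-congˡ {ι ε} (X^-+ u (d ℕ.* P)) ⟨
        ι ε * X^ (u ℕ.+ d ℕ.* P) ∎)

∃-prime-divisor : ∀ g → g ≢ 0 → g ≢ 1 → ∃ λ q → Prime q × q ℕD.∣ g
∃-prime-divisor g g≢0 g≢1 with factorise g {{ℕ.≢-nonZero g≢0}}
... | record { factors = [] ; isFactorisation = e } = contradiction e g≢1
... | record { factors = q ∷ qs ; isFactorisation = e ; factorsPrime = pq ∷ _ } =
  q , pq , ≡.subst (q ℕD.∣_) (≡.sym e) (ℕD.m∣m*n _)

n<m^n : ∀ {m} n → 1 ℕ.< m → n ℕ.< m ℕ.^ n
n<m^n zero    1<m = ℕ.z<s
n<m^n {m} (suc n) 1<m = ℕₚ.≤-trans (ℕ.s≤s (n<m^n n 1<m))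
  (ℕₚ.≤-trans (ℕₚ.≤-reflexive (ℕₚ.+-comm 1 (m ℕ.^ n))) (ℕₚ.≤-trans (ℕₚ.+-monoʳ-≤ (m ℕ.^ n) (ℕₚ.m^n>0 m {{ℕ.>-nonZero (ℕₚ.<-trans ℕ.z<s 1<m)}} n))
    (ℕₚ.≤-trans (ℕₚ.≤-reflexive (cong (m ℕ.^ n ℕ.+_) (≡.sym (ℕₚ.+-identityʳ _)))) (ℕₚ.*-monoˡ-≤ (m ℕ.^ n) 1<m))))

module Dichotomy (p : ℕ) (pp : Prime p) (2<p : 2 ℕ.< p) (i M : ℕ) (n∣1+M : p ℕ.* p ℕ.^ i ℕD.∣ suc M) where
  open Conjugation p pp 2<p i M n∣1+M public

  normℕ : Poly → ℕ
  normℕ f = ∣ norm f ∣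

  normℕ-* : ∀ f g → normℕ (f * g) ≡ normℕ f ℕ.* normℕ g
  normℕ-* f g = ≡.trans (cong ∣_∣ (norm-* f g)) (ℤₚ.abs-* (norm f) (norm g))

  normℕ-cong : ∀ {f g} → f ≈ g → normℕ f ≡ normℕ g
  normℕ-cong e = cong ∣_∣ (norm-cong e)

  normℕ-ι : ∀ c → normℕ (ιℕ c) ≡ c ℕ.^ length units
  normℕ-ι c = ≡.trans (cong ∣_∣ (norm-ι (+ c))) (abs-^ (+ c) (length units))

  normℕ-^ : ∀ f k → normℕ (f ^ k) ≡ normℕ f ℕ.^ k
  normℕ-^ f zero    = ≡.trans (normℕ-ι 1) (ℕₚ.^-zeroˡ (length units))
  normℕ-^ f (suc k) = ≡.trans (normℕ-* f (f ^ k)) (cong (normℕ f ℕ.*_) (normℕ-^ f k))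

  ιℕ-∣⁻ : ∀ {a b} → ιℕ a ∣ ι b → a ℕD.∣ ∣ b ∣
  ιℕ-∣⁻ {a} {b} = ι-∣⇒∣ {+ a} {b}

  ∣-normℕ : ∀ f → f ∣ ιℕ (normℕ f)
  ∣-normℕ f = ∣-trans (∣-norm f) (ι-∣⁺ {norm f} {+ normℕ f} (ℕD.∣-refl {normℕ f}))

  mod-normℕ : ∀ {d f g} → f ≡ g [mod ιℕ d ] → d ℕD.∣ normℕ f → d ℕD.∣ normℕ g
  mod-normℕ {d} {f} {g} h d∣ = ιℕ-∣⁻ {d} {norm g} (mod-∣ (mod-norm {+ d} {f} {g} h) (ι-∣⁺ {+ d} {norm f} d∣))

  regular-normℕ : ∀ {f} → normℕ f ≢ 0 → Regular f
  regular-normℕ {f} h = regular-∣ (∣-normℕ f) (torsion-free (+ normℕ f) (h ∘ ℤₚ.+-injective))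

  conj-conj : ∀ f → conj (conj f) ≈ f
  conj-conj f = trans (σ-σ M M f) (trans (σ-cong-% f M²≡1) (σ-1 f))
    where
    M²≡1 : (M ℕ.* M) % n ≡ 1 % n
    M²≡1 = ≡.trans (≡.sym (%-remove-+ˡ (M ℕ.* M) n∣1+M)) (%-remove-+ʳ 1 (ℕD.∣m⇒∣m*n M n∣1+M))

  conj-cong : ∀ {f g} → f ≈ g → conj f ≈ conj g
  conj-cong = σ-cong p∤M

  module AtPrime {q} (pq : Prime q) (p∤q : ¬ (p ℕD.∣ q)) where
    module ℙ = PrimePower q pq
    private instance
      q≢0 : NonZero q
      q≢0 = prime⇒nonZero pq

    f Q : ℕ
    f = order p∤q
    Q = q ℕ.^ f

    frobenius : ∀ g → g ^ q ≡ σ q g [mod ιℕ q ]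
    frobenius (con c) = fermat pq c
    frobenius X       = mod-reflexive (^≈X^ q)
    frobenius (g ⊕ h) = mod-trans ([x+y]^q≡x^q+y^q pq g h) (mod-+ (frobenius g) (frobenius h))
    frobenius (g ⊗ h) = mod-trans (mod-reflexive (^-distrib-* g h q)) (mod-* (frobenius g) (frobenius h))

    frobenius-^ : ∀ k g → g ^ (q ℕ.^ k) ≡ σ (q ℕ.^ k) g [mod ιℕ q ]
    frobenius-^ zero    g = mod-reflexive (trans (*-identityʳ g) (sym (σ-1 g)))
    frobenius-^ (suc k) g = mod-trans (mod-reflexive (trans (^-congʳ g (ℕₚ.*-comm q (q ℕ.^ k))) (sym (^-assocʳ g (q ℕ.^ k) q))))
      (mod-trans (mod-^ (frobenius-^ k g) q) (mod-trans (frobenius (σ (q ℕ.^ k) g)) (mod-reflexive (σ-σ q (q ℕ.^ k) g))))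

    g^Q≡g : ∀ g → g ^ Q ≡ g [mod ιℕ q ]
    g^Q≡g g = mod-trans (frobenius-^ f g) (mod-reflexive (trans (σ-cong-% g (q^order≡1 p∤q)) (σ-1 g)))

    f<Q : f ℕ.< Q
    f<Q = n<m^n f ℙ.1<p

    nilpotent⇒∣ : ∀ {g} k → k ℕ.≤ Q → ιℕ q ∣ g ^ k → ιℕ q ∣ g
    nilpotent⇒∣ {g} k k≤Q h = mod-∣ (g^Q≡g g) (∣-respʳ
      (trans (sym (^-homo-* g k (Q ℕ.∸ k))) (^-congʳ g (ℕₚ.m+[n∸m]≡n k≤Q))) (∣-*ʳ (g ^ (Q ℕ.∸ k)) h))

    Q′ : ℕ
    Q′ = Q ℕ.∸ 2

    Q≡ : suc (suc Q′) ≡ Q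
    Q≡ = ℕₚ.m+[n∸m]≡n (ℕₚ.≤-trans (ℕ.s≤s (0<order p∤q)) f<Q)

    -- support α is 1 at the primes above q not dividing α and 0 at those dividing α.
    support : Poly → Poly
    support α = α ^ suc Q′

    α*support≡α : ∀ α → α * support α ≡ α [mod ιℕ q ]
    α*support≡α α = mod-trans (mod-reflexive (^-congʳ α Q≡)) (g^Q≡g α)

    support-idempotent : ∀ α → support α * support α ≡ support α [mod ιℕ q ]
    support-idempotent α = mod-trans
      (mod-reflexive (solve 3 (λ a s t → s :* (a :* t) := (a :* s) :* t) refl α (support α) (α ^ Q′)))
      (mod-* (α*support≡α α) mod-refl)

    idempotent-^ : ∀ {a} → a * a ≡ a [mod ιℕ q ] → ∀ k → a ^ suc k ≡ a [mod ιℕ q ]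
    idempotent-^ h zero    = mod-reflexive (*-identityʳ _)
    idempotent-^ h (suc k) = mod-trans (mod-* mod-refl (idempotent-^ h k)) h

    idempotent-^q : ∀ {a} → a * a ≡ a [mod ιℕ q ] → ∀ k → a ^ (q ℕ.^ k) ≡ a [mod ιℕ q ]
    idempotent-^q {a} h k = ≡.subst (λ m → a ^ m ≡ a [mod ιℕ q ]) (ℕₚ.m+[n∸m]≡n (ℕₚ.m^n>0 q k)) (idempotent-^ h (q ℕ.^ k ℕ.∸ 1))

    lift : ∀ k {x y} → x ≡ y [mod ιℕ q ] → x ^ (q ℕ.^ k) ≡ y ^ (q ℕ.^ k) [mod ιℕ q ^ suc k ]
    lift zero    h = ∣-respˡ (sym (*-identityʳ (ιℕ q))) (mod-^ h 1)
    lift (suc k) {x} {y} h = mod-trans (mod-reflexive (sym (expand x))) (mod-trans (mod-lift q k (lift k h)) (mod-reflexive (expand y)))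
      where
      expand : ∀ x → (x ^ (q ℕ.^ k)) ^ q ≈ x ^ (q ℕ.^ suc k)
      expand x = trans (^-assocʳ x (q ℕ.^ k) q) (^-congʳ x (ℕₚ.*-comm (q ℕ.^ k) q))

    complement-∣ : ∀ {α e} → e ≡ support α [mod ιℕ q ] → ιℕ q ∣ (1# - e) * α
    complement-∣ {α} {e} h = ∣-respʳ (begin
        - (α * e - α)          ≈⟨ -‿cong (+-congˡ (-‿cong (sym (*-identityʳ α)))) ⟩
        - (α * e - α * 1#)     ≈⟨ solve 3 (λ a e o → :- (a :* e :- a :* o) := (o :- e) :* a) refl α e 1# ⟩
        (1# - e) * α           ∎)
      (∣-neg (mod-trans (mod-* (mod-refl {x = α}) h) (α*support≡α α)))

    q∣norm-support : ∀ {α} → q ℕD.∣ normℕ α → q ℕD.∣ normℕ (support α)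
    q∣norm-support {α} h = ≡.subst (q ℕD.∣_) (≡.sym (normℕ-^ α (suc Q′))) (ℕD.∣m⇒∣m*n _ h)

    -- With e an idempotent modulo a power of q, cofactor e is divisible by q exactly where e vanishes.
    cofactor : Poly → Poly
    cofactor e = e + ιℕ q * (1# - e)

    cofactor≡e : ∀ e → cofactor e ≡ e [mod ιℕ q ]
    cofactor≡e e = ∣-respʳ (solve 2 (λ e w → w := (e :+ w) :- e) refl e (ιℕ q * (1# - e))) (∣-*ʳ _ ∣-refl)

    q∣norm-cofactor : ∀ {α e} → e ≡ support α [mod ιℕ q ] → q ℕD.∣ normℕ α → q ℕD.∣ normℕ (cofactor e)
    q∣norm-cofactor {α} {e} h q∣ = mod-normℕ {q} {support α} {cofactor e}
      (mod-sym (mod-trans (cofactor≡e e) h)) (q∣norm-support q∣)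

    -- Primes above q have residue degree f, hence norm q^f.
    q^f∣norm : ∀ α → q ℕD.∣ normℕ α → Q ℕD.∣ normℕ α
    q^f∣norm α q∣ = ιℕ-∣⁻ {Q} {norm α} (∣-respˡ (sym (ιℕ-^ q f)) (mod-∣ (mod-sym norm-α≡)
        (∣-*ʳ (ι (norm x)) q^f∣norm-c)))
      where
      a e c D : Poly
      a = support α
      e = a ^ (q ℕ.^ f)
      c = cofactor e
      D = ιℕ q ^ suc f
      e≡a : e ≡ a [mod ιℕ q ]
      e≡a = idempotent-^q (support-idempotent α) f
      ee≡e : e * e ≡ e [mod D ]
      ee≡e = mod-trans (mod-reflexive (sym (^-distrib-* a a (q ℕ.^ f)))) (lift f (support-idempotent α))
      γ : Poly
      γ = _∣_.quotient (complement-∣ {α} {e} e≡a)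
      x : Poly
      x = e * α + (1# - e) * γ
      cx≡α : c * x ≡ α [mod D ]
      cx≡α = ∣-respʳ (sym (begin
          c * x - α
            ≈⟨ solve 5 (λ e q o a g → (e :+ q :* (o :- e)) :* (e :* a :+ (o :- e) :* g) :- a
                 := (e :* e) :* a :+ (o :* e :- e :* e) :* g :+ q :* (o :* e :- e :* e) :* a :+ (o :- e) :* (o :- e) :* (q :* g) :- a)
                 refl e (ιℕ q) 1# α γ ⟩
          e * e * α + (1# * e - e * e) * γ + ιℕ q * (1# * e - e * e) * α + (1# - e) * (1# - e) * (ιℕ q * γ) - α
            ≈⟨ +-cong (+-cong (+-cong (+-congˡ (*-congʳ (+-congʳ (*-identityˡ e)))) (*-congʳ (*-congˡ (+-congʳ (*-identityˡ e)))))
                 (*-cong (complement² ) (sym (_∣_.equality (complement-∣ {α} {e} e≡a))))) refl ⟩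
          e * e * α + (e - e * e) * γ + ιℕ q * (e - e * e) * α + ((1# - e) + (e * e - e)) * ((1# - e) * α) - α
            ≈⟨ +-congˡ (-‿cong (*-identityˡ α)) ⟨
          e * e * α + (e - e * e) * γ + ιℕ q * (e - e * e) * α + ((1# - e) + (e * e - e)) * ((1# - e) * α) - 1# * α
            ≈⟨ solve 6 (λ e s q o a g → s :* a :+ (e :- s) :* g :+ q :* (e :- s) :* a :+ ((o :- e) :+ (s :- e)) :* ((o :- e) :* a) :- o :* a
                 := (s :- e) :* (a :- g :- q :* a :+ (o :- e) :* a) :+ (e :+ (o :- e) :* (o :- e) :- o) :* a)
                 refl e (e * e) (ιℕ q) 1# α γ ⟩
          (e * e - e) * (α - γ - ιℕ q * α + (1# - e) * α) + (e + (1# - e) * (1# - e) - 1#) * α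
            ≈⟨ +-congˡ (*-congʳ (trans (+-congʳ (+-congˡ complement²))
                 (solve 3 (λ e o s → (e :+ ((o :- e) :+ (s :- e))) :- o := s :- e) refl e 1# (e * e)))) ⟩
          (e * e - e) * (α - γ - ιℕ q * α + (1# - e) * α) + (e * e - e) * α ∎))
        (∣-+ (∣-*ʳ _ ee≡e) (∣-*ʳ α ee≡e))
        where
        complement² : (1# - e) * (1# - e) ≈ (1# - e) + (e * e - e)
        complement² = begin
          (1# - e) * (1# - e)           ≈⟨ solve 2 (λ o e → (o :- e) :* (o :- e) := (o :* (o :- e)) :+ (e :* e :- o :* e)) refl 1# e ⟩
          1# * (1# - e) + (e * e - 1# * e) ≈⟨ +-cong (*-identityˡ _) (+-congˡ (-‿cong (*-identityˡ e))) ⟩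
          (1# - e) + (e * e - e)        ∎
      norm-α≡ : ι (norm α) ≡ ι (norm c) * ι (norm x) [mod ιℕ q ^ f ]
      norm-α≡ = mod-weaken (∣-respʳ (*-comm _ (ιℕ q)) (∣-*ʳ (ιℕ q) ∣-refl)) (mod-trans
        (∣-respˡ (ιℕ-^ q (suc f)) (mod-norm {+ (q ℕ.^ suc f)} {α} {c * x} (∣-respˡ (sym (ιℕ-^ q (suc f))) (mod-sym cx≡α))))
        (mod-reflexive (trans (reflexive (cong ι (norm-* c x))) (ι-* (norm c) (norm x)))))
      σe≡e : σ q e ≡ e [mod D ]
      σe≡e = mod-trans (mod-reflexive (reflexive (σ-^ q a (q ℕ.^ f))))
        (lift f (mod-trans (mod-sym (frobenius a)) (idempotent-^q′)))
        where
        idempotent-^q′ : a ^ q ≡ a [mod ιℕ q ]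
        idempotent-^q′ = mod-trans (mod-reflexive (^-congʳ a (≡.sym (ℕₚ.*-identityʳ q)))) (idempotent-^q (support-idempotent α) 1)
      σc≡c : ∀ j → σ (q ℕ.^ j) c ≡ c [mod D ]
      σc≡c zero    = mod-reflexive (σ-1 c)
      σc≡c (suc j) = mod-trans (mod-reflexive (sym (σ-σ q (q ℕ.^ j) c))) (mod-trans
        (∣-respˡ (reflexive (σ-^ q (ιℕ q) (suc f))) (σ-∣ p∤q (σc≡c j)))
        (mod-+ σe≡e (mod-* (mod-refl {x = ιℕ q}) (mod-+ (mod-refl {x = 1#}) (mod-neg σe≡e)))))
      reps : List ℕ
      reps = proj₁ (units-↭-orbits p∤q)
      y : Poly
      y = Πₗ reps (λ r → σ r c)
      orbit-product : ∀ {r} → r ∈ units → Πₗ (orbit p∤q r) (λ k → σ k c) ≡ σ r c ^ f [mod D ]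
      orbit-product {r} r∈ = mod-trans
        (mod-reflexive (reflexive (≡.trans (Πₗ-map (λ j → (r ℕ.* q ℕ.^ j) % n) (upTo f) (λ k → σ k c)) ≡.refl)))
        (mod-trans (mod-Πₗ-const (upTo f) (σ r c) (λ {j} _ → mod-trans
            (mod-reflexive (trans (σ-cong-% c (m%n%n≡m%n (r ℕ.* q ℕ.^ j) n)) (sym (σ-σ r (q ℕ.^ j) c))))
            (∣-respˡ (reflexive (σ-^ r (ιℕ q) (suc f))) (σ-∣ (proj₂ (∈-units⁻ r∈)) (σc≡c j)))))
          (mod-reflexive (^-congʳ (σ r c) (length-upTo f))))
      orbits-product : ∀ rs → (∀ {r} → r ∈ rs → r ∈ units) →
        Πₗ (concat (map (orbit p∤q) rs)) (λ k → σ k c) ≡ Πₗ rs (λ r → σ r c) ^ f [mod D ]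
      orbits-product []       _  = mod-reflexive (sym (1^ f))
      orbits-product (r ∷ rs) ∈u = mod-trans (mod-reflexive (Πₗ-++ (orbit p∤q r) _ (λ k → σ k c)))
        (mod-trans (mod-* (orbit-product (∈u (here ≡.refl))) (orbits-product rs (∈u ∘ there)))
          (mod-reflexive (sym (^-distrib-* (σ r c) (Πₗ rs (λ r → σ r c)) f))))
      norm-c≡y^f : ι (norm c) ≡ y ^ f [mod D ]
      norm-c≡y^f = mod-trans (mod-reflexive (trans (sym (conjugates≈norm c))
          (Πₗ-↭ (proj₂ (proj₂ (units-↭-orbits p∤q))) (λ k → σ k c))))
        (orbits-product reps (proj₁ (proj₂ (units-↭-orbits p∤q))))
      q∣y : ιℕ q ∣ y
      q∣y = nilpotent⇒∣ f (ℕₚ.<⇒≤ f<Q) (mod-∣ (mod-weaken (∣-^ (ιℕ q) (suc f) ℕ.z<s) norm-c≡y^f)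
        (ι-∣⁺ {+ q} {norm c} (q∣norm-cofactor {α} {e} e≡a q∣)))
      q^f∣norm-c : ιℕ q ^ f ∣ ι (norm c)
      q^f∣norm-c = mod-∣ (mod-sym (mod-weaken (∣-respʳ (*-comm _ (ιℕ q)) (∣-*ʳ (ιℕ q) ∣-refl)) norm-c≡y^f)) (^-pres-∣ q∣y f)

    module Even (h : ℕ) (f≡h+h : f ≡ h ℕ.+ h) where
      conj≡^ : ∀ g → conj g ≡ g ^ (q ℕ.^ h) [mod ιℕ q ]
      conj≡^ g = mod-sym (mod-trans (frobenius-^ h g) (mod-reflexive (σ-cong-% g q^h≡M)))
        where
        q^h≡M : (q ℕ.^ h) % n ≡ M % n
        q^h≡M = ≡.trans (≡.sym (%-remove-+ʳ (q ℕ.^ h) n∣1+M)) (≡.trans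
          (cong (_% n) (≡.trans (≡.sym (ℕₚ.+-assoc (q ℕ.^ h) 1 M)) ≡.refl)) (%-remove-+ˡ M (q^h≡-1 p∤q 2<p h f≡h+h)))

      -- Multiplying by a real element and dividing by q removes each prime above q once.
      descent : ∀ v α → ¬ (q ℕ.^ suc v ℕD.∣ normℕ α) → ∃ λ β → ¬ (q ℕD.∣ normℕ β) × α * conj β ≈ conj α * β
      descent v α q^v∤ with q ℕD.∣? normℕ α
      ... | no q∤   = α , q∤ , *-comm α (conj α)
      descent zero    α q∤   | yes q∣ = contradiction (≡.subst (ℕD._∣ normℕ α) (≡.sym (ℕₚ.*-identityʳ q)) q∣) q∤
      descent (suc v) α q^v∤ | yes q∣ = proj₁ rec , proj₁ (proj₂ rec) , conclusion
        where
        a b e τ c α′ : Poly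
        a = support α
        b = a * conj a
        e = b ^ q
        τ = (1# - e) + ιℕ q * e
        c = cofactor e
        b≡a : b ≡ a [mod ιℕ q ]
        b≡a = mod-trans (mod-* (mod-refl {x = a}) (mod-trans (conj≡^ a) (idempotent-^q (support-idempotent α) h))) (support-idempotent α)
        bb≡b : b * b ≡ b [mod ιℕ q ]
        bb≡b = mod-trans (mod-* b≡a b≡a) (mod-trans (support-idempotent α) (mod-sym b≡a))
        e≡a : e ≡ a [mod ιℕ q ]
        e≡a = mod-trans (mod-reflexive (^-congʳ b (≡.sym (ℕₚ.*-identityʳ q)))) (mod-trans (idempotent-^q bb≡b 1) b≡a)
        ee≡e : ιℕ q * ιℕ q ∣ e * e - e
        ee≡e = ∣-respˡ (*-congˡ (*-identityʳ (ιℕ q))) (mod-trans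
          (mod-reflexive (trans (sym (^-distrib-* b b q)) (^-congʳ (b * b) (≡.sym (ℕₚ.*-identityʳ q)))))
          (mod-trans (lift 1 bb≡b) (mod-reflexive (^-congʳ b (ℕₚ.*-identityʳ q)))))
        w : Poly
        w = _∣_.quotient ee≡e
        s : Poly
        s = (ιℕ q + ιℕ q) * w - w - ιℕ q * ιℕ q * w
        τ*c : τ * c ≈ ιℕ q * (1# + ιℕ q * s)
        τ*c = begin
          τ * c
            ≈⟨ solve 3 (λ e q o → ((o :- e) :+ q :* e) :* (e :+ q :* (o :- e))
                 := (q :* (o :* o) :+ (q :+ q) :* (e :* e :- o :* e)) :- (e :* e :- o :* e) :- q :* q :* (e :* e :- o :* e)) refl e (ιℕ q) 1# ⟩
          (ιℕ q * (1# * 1#) + (ιℕ q + ιℕ q) * (e * e - 1# * e)) - (e * e - 1# * e) - ιℕ q * ιℕ q * (e * e - 1# * e)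
            ≈⟨ +-cong (+-cong (+-cong (*-congˡ (*-identityˡ 1#)) (*-congˡ E)) (-‿cong E)) (-‿cong (*-congˡ E)) ⟩
          (ιℕ q * 1# + (ιℕ q + ιℕ q) * (ιℕ q * ιℕ q * w)) - ιℕ q * ιℕ q * w - ιℕ q * ιℕ q * (ιℕ q * ιℕ q * w)
            ≈⟨ solve 3 (λ q o w → (q :* o :+ (q :+ q) :* (q :* q :* w)) :- q :* q :* w :- q :* q :* (q :* q :* w)
                 := q :* (o :+ q :* ((q :+ q) :* w :- w :- q :* q :* w))) refl (ιℕ q) 1# w ⟩
          ιℕ q * (1# + ιℕ q * s) ∎
          where
          E : e * e - 1# * e ≈ ιℕ q * ιℕ q * w
          E = trans (+-congˡ (-‿cong (*-identityˡ e))) (_∣_.equality ee≡e)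
        conj-e : conj e ≈ e
        conj-e = trans (reflexive (σ-^ M b q)) (^-congˡ q (trans (*-congˡ (conj-conj a)) (*-comm (conj a) a)))
        conj-τ : conj τ ≈ τ
        conj-τ = +-cong (+-congˡ (-‿cong conj-e)) (*-congˡ conj-e)
        q∣τα : ιℕ q ∣ τ * α
        q∣τα = ∣-respʳ (sym (distribʳ α (1# - e) (ιℕ q * e)))
          (∣-+ (complement-∣ {α} {e} e≡a) (∣-*ʳ α (∣-*ʳ e ∣-refl)))
        α′ = _∣_.quotient q∣τα
        τα≈qα′ : τ * α ≈ ιℕ q * α′
        τα≈qα′ = _∣_.equality q∣τα
        U L A T A′ T′ : ℕ
        U = normℕ (1# + ιℕ q * s)
        L = normℕ (ιℕ q)
        A = normℕ α
        T = normℕ τ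
        A′ = normℕ α′
        T′ = normℕ c
        q∤U : ¬ (q ℕD.∣ U)
        q∤U q∣U = ℙ.p∤1 (≡.subst (q ℕD.∣_) (≡.trans (normℕ-ι 1) (ℕₚ.^-zeroˡ (length units)))
          (mod-normℕ {q} {1# + ιℕ q * s} {1#} (∣-respʳ (solve 2 (λ o w → w := (o :+ w) :- o) refl 1# (ιℕ q * s)) (∣-*ʳ s ∣-refl)) q∣U))
        L≢0 : L ≢ 0
        L≢0 e = ℕ.≢-nonZero⁻¹ (q ℕ.^ length units) {{ℕₚ.m^n≢0 q (length units)}} (≡.trans (≡.sym (normℕ-ι q)) e)
        TT′ : T ℕ.* T′ ≡ L ℕ.* U
        TT′ = ≡.trans (≡.sym (normℕ-* τ c)) (≡.trans (normℕ-cong τ*c) (normℕ-* (ιℕ q) _))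
        TA : T ℕ.* A ≡ L ℕ.* A′
        TA = ≡.trans (≡.sym (normℕ-* τ α)) (≡.trans (normℕ-cong τα≈qα′) (normℕ-* (ιℕ q) α′))
        UA : U ℕ.* A ≡ A′ ℕ.* T′
        UA = ℕₚ.*-cancelˡ-≡ (U ℕ.* A) (A′ ℕ.* T′) L {{ℕ.≢-nonZero L≢0}} (
          L ℕ.* (U ℕ.* A)      ≡⟪ ≡.sym (ℕₚ.*-assoc L U A) ⟫
          L ℕ.* U ℕ.* A        ≡⟪ cong (ℕ._* A) (≡.sym TT′) ⟫
          T ℕ.* T′ ℕ.* A       ≡⟪ ≡.trans (cong (ℕ._* A) (ℕₚ.*-comm T T′)) (ℕₚ.*-assoc T′ T A) ⟫
          T′ ℕ.* (T ℕ.* A)     ≡⟪ cong (T′ ℕ.*_) TA ⟫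
          T′ ℕ.* (L ℕ.* A′)    ≡⟪ ≡.trans (ℕₚ.*-comm T′ _) (ℕₚ.*-assoc L A′ T′) ⟫
          L ℕ.* (A′ ℕ.* T′)    □)
        q^v∤A′ : ¬ (q ℕ.^ suc v ℕD.∣ A′)
        q^v∤A′ h = q^v∤ (ℙ.p^a∣xy⇒p^a∣y (suc (suc v)) q∤U (≡.subst₂ ℕD._∣_ (ℕₚ.*-comm (q ℕ.^ suc v) q) (≡.sym UA)
          (ℕD.*-pres-∣ h (q∣norm-cofactor {α} {e} e≡a q∣))))
        rec : ∃ λ β → ¬ (q ℕD.∣ normℕ β) × α′ * conj β ≈ conj α′ * β
        rec = descent v α′ q^v∤A′
        β : Poly
        β = proj₁ rec
        τ-regular : Regular τ
        τ-regular = regular-normℕ {τ} λ T≡0 → q∤U (≡.subst (q ℕD.∣_) (≡.sym (U≡0 T≡0)) (q ℕD.∣0))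
          where
          U≡0 : T ≡ 0 → U ≡ 0
          U≡0 T≡0 = ℕₚ.m*n≡0⇒m≡0 U L {{ℕ.≢-nonZero L≢0}}
            (≡.trans (ℕₚ.*-comm U L) (≡.trans (≡.sym TT′) (cong (ℕ._* T′) T≡0)))
        ταˉ : τ * conj α ≈ ιℕ q * conj α′
        ταˉ = trans (*-congʳ (sym conj-τ)) (conj-cong τα≈qα′)
        conclusion : α * conj β ≈ conj α * β
        conclusion = regular-cancelˡ τ-regular (begin
          τ * (α * conj β)          ≈⟨ *-assoc τ α (conj β) ⟨
          τ * α * conj β            ≈⟨ *-congʳ τα≈qα′ ⟩
          ιℕ q * α′ * conj β        ≈⟨ *-assoc (ιℕ q) α′ (conj β) ⟩
          ιℕ q * (α′ * conj β)      ≈⟨ *-congˡ (proj₂ (proj₂ rec)) ⟩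
          ιℕ q * (conj α′ * β)      ≈⟨ *-assoc (ιℕ q) (conj α′) β ⟨
          ιℕ q * conj α′ * β        ≈⟨ *-congʳ ταˉ ⟨
          τ * conj α * β            ≈⟨ *-assoc τ (conj α) β ⟩
          τ * (conj α * β)          ∎)

      coprime-multiple : ∀ α → normℕ α ≢ 0 → ∃ λ m → ¬ (q ℕD.∣ m) × conj α ∣ ιℕ m * α
      coprime-multiple α A≢0 = let (β , q∤ , e) = descent (normℕ α) α large in
        normℕ β , q∤ , ∣-trans (divides (β * _∣_.quotient (β̄∣ β)) (begin
          ιℕ (normℕ β) * α                                ≈⟨ *-congʳ (_∣_.equality (β̄∣ β)) ⟩
          conj β * _∣_.quotient (β̄∣ β) * α                ≈⟨ solve 3 (λ b z a → b :* z :* a := a :* b :* z) refl (conj β) _ α ⟩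
          α * conj β * _∣_.quotient (β̄∣ β)                ≈⟨ trans (*-congʳ e) (*-assoc (conj α) β _) ⟩
          conj α * (β * _∣_.quotient (β̄∣ β))              ∎)) ∣-refl
        where
        β̄∣ : ∀ β → conj β ∣ ιℕ (normℕ β)
        β̄∣ β = σ-∣ p∤M (∣-normℕ β)
        large : ¬ (q ℕ.^ suc (normℕ α) ℕD.∣ normℕ α)
        large h = ℕₚ.<⇒≱ (ℕₚ.<-trans (ℕₚ.n<1+n _) (n<m^n (suc (normℕ α)) ℙ.1<p)) (ℕD.∣⇒≤ {{ℕ.≢-nonZero A≢0}} h)

  Good : ℕ → Set
  Good N = ∃₂ λ q a → Prime q × a % 2 ≡ 1 × n ℕD.∣ q ℕ.^ a ℕ.∸ 1 × q ℕ.^ a ℕD.∣ N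

  private
    local : ∀ u → ¬ (p ℕD.∣ normℕ u) → ∀ {q} → Prime q → q ℕD.∣ normℕ u →
      Good (normℕ u) ⊎ ∃ λ m → ¬ (q ℕD.∣ m) × conj u ∣ ιℕ m * u
    local u p∤N {q} pq q∣N = by-parity (even∨odd (order p∤q))
      where
      p∤q : ¬ (p ℕD.∣ q)
      p∤q p∣q = p∤N (ℕD.∣-trans p∣q q∣N)
      by-parity : (∃ λ h → order p∤q ≡ h ℕ.+ h) ⊎ order p∤q % 2 ≡ 1 → _
      by-parity (inj₁ (h , e)) = inj₂ (AtPrime.Even.coprime-multiple pq p∤q h e u
        (λ N≡0 → p∤N (≡.subst (p ℕD.∣_) (≡.sym N≡0) (p ℕD.∣0))))
      by-parity (inj₂ odd)     = inj₁ (q , order p∤q , pq , odd , n∣q^order∸1 p∤q , AtPrime.q^f∣norm pq p∤q u q∣N)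

    ∣-combine : ∀ {α u} d x y a b → α ∣ ιℕ a * u → α ∣ ιℕ b * u → d ℕ.+ y ℕ.* b ≡ x ℕ.* a → α ∣ ιℕ d * u
    ∣-combine {α} {u} d x y a b α∣a α∣b e = ∣-respʳ (begin
        ιℕ x * (ιℕ a * u) - ιℕ y * (ιℕ b * u)
          ≈⟨ solve 5 (λ x a y b u → x :* (a :* u) :- y :* (b :* u) := (x :* a :- y :* b) :* u) refl (ιℕ x) (ιℕ a) (ιℕ y) (ιℕ b) u ⟩
        (ιℕ x * ιℕ a - ιℕ y * ιℕ b) * u
          ≈⟨ *-congʳ (+-cong (sym (trans (reflexive (cong ι (≡.trans (cong +_ e) (ℤₚ.pos-* x a)))) (ι-* (+ x) (+ a)))) refl) ⟩
        (ιℕ (d ℕ.+ y ℕ.* b) - ιℕ y * ιℕ b) * u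
          ≈⟨ *-congʳ (+-congʳ (trans (ι-+ (+ d) (+ (y ℕ.* b))) (+-congˡ (trans (reflexive (cong ι (ℤₚ.pos-* y b))) (ι-* (+ y) (+ b)))))) ⟩
        ((ιℕ d + ιℕ y * ιℕ b) - ιℕ y * ιℕ b) * u
          ≈⟨ *-congʳ (solve 2 (λ d w → (d :+ w) :- w := d) refl (ιℕ d) (ιℕ y * ιℕ b)) ⟩
        ιℕ d * u ∎)
      (∣-+ (∣-*ˡ (ιℕ x) α∣a) (∣-neg (∣-*ˡ (ιℕ y) α∣b)))

    gcd-multiple : ∀ {α u} a b → α ∣ ιℕ a * u → α ∣ ιℕ b * u → α ∣ ιℕ (gcd a b) * u
    gcd-multiple {α} {u} a b α∣a α∣b with Bézout.identity (gcd-GCD a b)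
    ... | Bézout.+- x y e = ∣-combine (gcd a b) x y a b α∣a α∣b e
    ... | Bézout.-+ x y e = ∣-combine (gcd a b) y x b a α∣b α∣a e

    global : ∀ u → ¬ (p ℕD.∣ normℕ u) → ∀ g → g ≢ 0 → g ℕD.∣ normℕ u → conj u ∣ ιℕ g * u →
      Good (normℕ u) ⊎ conj u ∣ u
    global u p∤N = <-rec _ step
      where
      step : ∀ g → (∀ {g′} → g′ ℕ.< g → g′ ≢ 0 → g′ ℕD.∣ normℕ u → conj u ∣ ιℕ g′ * u → Good (normℕ u) ⊎ conj u ∣ u) →
        g ≢ 0 → g ℕD.∣ normℕ u → conj u ∣ ιℕ g * u → Good (normℕ u) ⊎ conj u ∣ u
      step g rec g≢0 g∣N ū∣gu with g ℕ.≟ 1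
      ... | yes ≡.refl = inj₂ (∣-respʳ (*-identityˡ u) ū∣gu)
      ... | no g≢1 = prime-step (∃-prime-divisor g g≢0 g≢1)
        where
        prime-step : (∃ λ q → Prime q × q ℕD.∣ g) → Good (normℕ u) ⊎ conj u ∣ u
        prime-step (q , pq , q∣g) with local u p∤N pq (ℕD.∣-trans q∣g g∣N)
        ... | inj₁ good = inj₁ good
        ... | inj₂ (m , q∤m , ū∣mu) = rec smaller g′≢0 (ℕD.∣-trans (gcd[m,n]∣m g m) g∣N) (gcd-multiple {conj u} {u} g m ū∣gu ū∣mu)
          where
          g′≢0 : gcd g m ≢ 0
          g′≢0 e = g≢0 (ℕD.0∣⇒≡0 (≡.subst (ℕD._∣ g) e (gcd[m,n]∣m g m)))
          smaller : gcd g m ℕ.< g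
          smaller = ℕₚ.≤∧≢⇒< (ℕD.∣⇒≤ {{ℕ.≢-nonZero g≢0}} (gcd[m,n]∣m g m))
            (λ e → q∤m (ℕD.∣-trans (≡.subst (q ℕD.∣_) (≡.sym e) q∣g) (gcd[m,n]∣n g m)))

  good∨real : ∀ u → ¬ (p ℕD.∣ normℕ u) → Good (normℕ u) ⊎ ∃₂ λ r ε → (ε ≡ + 1 ⊎ ε ≡ ℤ.- + 1) × u ≈ ι ε * X^ r * conj u
  good∨real u p∤N = conclude (global u p∤N (normℕ u) N≢0 ℕD.∣-refl (∣-*ʳ u (σ-∣ p∤M (∣-normℕ u))))
    where
    N≢0 : normℕ u ≢ 0
    N≢0 e = p∤N (≡.subst (p ℕD.∣_) (≡.sym e) (p ℕD.∣0))
    conclude : Good (normℕ u) ⊎ conj u ∣ u → Good (normℕ u) ⊎ ∃₂ λ r ε → (ε ≡ + 1 ⊎ ε ≡ ℤ.- + 1) × u ≈ ι ε * X^ r * conj u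
    conclude (inj₁ good) = inj₁ good
    conclude (inj₂ (divides z u≈ūz)) = inj₂ (let (r , ε , ±1 , e) = root-of-unity z zz̄≈1 in
        r , ε , ±1 , trans u≈ūz (trans (*-comm (conj u) z) (*-congʳ e)))
      where
      ū≈uz̄ : conj u ≈ u * conj z
      ū≈uz̄ = trans (conj-cong u≈ūz) (*-congʳ (conj-conj u))
      zz̄≈1 : z * conj z ≈ 1#
      zz̄≈1 = regular-cancelˡ (regular-normℕ {u} N≢0) (begin
        u * (z * conj z)      ≈⟨ solve 3 (λ u z y → u :* (z :* y) := (u :* y) :* z) refl u z (conj z) ⟩
        u * conj z * z        ≈⟨ *-congʳ ū≈uz̄ ⟨
        conj u * z            ≈⟨ u≈ūz ⟨
        u                     ≈⟨ *-identityʳ u ⟨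
        u * 1#                ∎)

-- With X^M = 1/X, this is F(X) + X^r F(1/X).
symmetrise : ℕ → ℕ → Poly → Poly
symmetrise M r F = F ⊕ X^ r ⊗ subst (X^ M) F

at1-symmetrise : ∀ M r F → at1 (symmetrise M r F) ≡ + 2 ℤ.* at1 F
at1-symmetrise M r F = ≡.trans (cong₂ (λ a b → at1 F ℤ.+ a ℤ.* b) (at1-X^ r) (at1-subst F))
  (ℤK.solve 1 (λ x → x ℤK.:+ ℤK.con (+ 1) ℤK.:* x ℤK.:= ℤK.con (+ 2) ℤK.:* x) ≡.refl (at1 F))
  where
  at1-X^ : ∀ k → at1 (X^ k) ≡ + 1
  at1-X^ zero    = ≡.refl
  at1-X^ (suc k) = ≡.trans (ℤₚ.*-identityˡ _) (at1-X^ k)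
  at1-subst : ∀ f → at1 (subst (X^ M) f) ≡ at1 f
  at1-subst (con c) = ≡.refl
  at1-subst X       = at1-X^ M
  at1-subst (f ⊕ g) = cong₂ ℤ._+_ (at1-subst f) (at1-subst g)
  at1-subst (f ⊗ g) = cong₂ ℤ._*_ (at1-subst f) (at1-subst g)

-- d divides every sum of coefficients of f over the exponents in a residue class modulo N.
FoldedDivisible : ℕ → ℕ → Poly → Set
FoldedDivisible N d f = ∀ g → (∀ e → g (e ℕ.+ N) ≡ g e) → (+ d) ℤS.∣ act f g 0

module Antisymmetry (p : ℕ) (pp : Prime p) (2<p : 2 ℕ.< p) (i M : ℕ) (n∣1+M : p ℕ.* p ℕ.^ i ℕD.∣ suc M) where
  open Dichotomy p pp 2<p i M n∣1+M public
  private instance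
    p≢0 : NonZero p
    p≢0 = prime⇒nonZero pp

  private
    χ : ℕ → ℤ
    χ e = truth (e % n ℕ.<? P)

    χ-periodic : Periodic χ
    χ-periodic e = cong (λ r → truth (r ℕ.<? P)) ([m+n]%n≡m%n e n)

    truth-yes : ∀ {A : Set} (d : Dec A) → A → truth d ≡ + 1
    truth-yes (yes _) a = ≡.refl
    truth-yes (no ¬a) a = contradiction a ¬a

    truth-no : ∀ {A : Set} (d : Dec A) → ¬ A → truth d ≡ + 0
    truth-no (yes a) ¬a = contradiction a ¬a
    truth-no (no _)  ¬a = ≡.refl

    Σχ≡1 : ∀ e → ℤK.Σ p (λ c → χ (e ℕ.+ c ℕ.* P)) ≡ + 1
    Σχ≡1 e = ≡.trans
      (ℤK.Σ-cong p λ c _ → cong (λ e → χ (e ℕ.+ c ℕ.* P)) (m≡m%n+[m/n]*n e P))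
      (≡.trans (Σ-P-periodic {χ} χ-periodic (e % P) (e / P)) (small (m%n<n e P)))
      where
      small : ∀ {e} → e ℕ.< P → ℤK.Σ p (λ c → χ (e ℕ.+ c ℕ.* P)) ≡ + 1
      small {e} e<P = ≡.trans (ℤK.Σ-single p {k = 0} (ℕ.>-nonZero⁻¹ p) others)
        (truth-yes (_ ℕ.<? P) (≡.subst (ℕ._< P) (≡.sym (≡.trans (cong (_% n) (ℕₚ.+-identityʳ e)) (m<n⇒m%n≡m (ℕₚ.<-trans e<P P<n)))) e<P))
        where
        others : ∀ c → c ℕ.< p → c ≢ 0 → χ (e ℕ.+ c ℕ.* P) ≡ + 0
        others c c<p c≢0 = truth-no (_ ℕ.<? P) (ℕₚ.≤⇒≯ (≡.subst (P ℕ.≤_) (≡.sym (m<n⇒m%n≡m bound))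
            (ℕₚ.≤-trans (ℕₚ.m≤n*m P c {{ℕ.≢-nonZero c≢0}}) (ℕₚ.m≤n+m (c ℕ.* P) e))))
          where
          bound : e ℕ.+ c ℕ.* P ℕ.< n
          bound = ℕₚ.<-≤-trans (ℕₚ.+-monoˡ-< (c ℕ.* P) e<P) (ℕₚ.*-monoˡ-≤ P c<p)

    -- A P-periodic g is the sum of the p translates of its n-periodic restriction to a block of length P.
    module Block (g : ℕ → ℤ) (g-periodic : ∀ e → g (e ℕ.+ P) ≡ g e) where
      block : ℕ → ℤ
      block e = g e ℤ.* χ e

      g-periodic-* : ∀ c e → g (e ℕ.+ c ℕ.* P) ≡ g e
      g-periodic-* zero    e = cong g (ℕₚ.+-identityʳ e)
      g-periodic-* (suc c) e = ≡.trans (cong g (≡.sym (ℕₚ.+-assoc e P _))) (≡.trans (g-periodic-* c (e ℕ.+ P)) (g-periodic e))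

      block-periodic : Periodic block
      block-periodic e = cong₂ ℤ._*_ (g-periodic-* p e) (χ-periodic e)

      shifted : ℕ → ℕ → ℤ
      shifted c e = block (e ℕ.+ c ℕ.* P)

      shifted-periodic : ∀ c → Periodic (shifted c)
      shifted-periodic c e = ≡.trans (cong block (≡.trans (ℕₚ.+-assoc e n _)
        (≡.trans (cong (e ℕ.+_) (ℕₚ.+-comm n _)) (≡.sym (ℕₚ.+-assoc e _ n))))) (block-periodic (e ℕ.+ c ℕ.* P))

      sum-of-shifts : ∀ f → act f g 0 ≡ ℤK.Σ p (λ c → act f (shifted c) 0)
      sum-of-shifts f = ≡.trans (act-cong f (λ e → ≡.sym (≡.trans
          (ℤK.Σ-cong p (λ c _ → cong (ℤ._* χ (e ℕ.+ c ℕ.* P)) (g-periodic-* c e)))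
          (≡.trans (≡.sym (ℤK.Σ-*ˡ p (g e) (λ c → χ (e ℕ.+ c ℕ.* P)))) (≡.trans (cong (g e ℤ.*_) (Σχ≡1 e)) (ℤₚ.*-identityʳ (g e)))))) 0)
        (act-Σ f p shifted 0)

  ∣-ℤΣ : ∀ {d : ℤ} m {f} → (∀ k → k ℕ.< m → d ℤS.∣ f k) → d ℤS.∣ ℤK.Σ m f
  ∣-ℤΣ {d} zero h = ℤS.divides (+ 0) (≡.sym (ℤₚ.*-zeroˡ d))
  ∣-ℤΣ (suc m) h = ℤS.∣m∣n⇒∣m+n (h 0 ℕ.z<s) (∣-ℤΣ m λ k k<m → h (suc k) (ℕ.s<s k<m))

  folded-descend : ∀ {d f} → FoldedDivisible n d f → FoldedDivisible P d f
  folded-descend {d} {f} div g per = ≡.subst (+ d ℤS.∣_) (≡.sym (sum-of-shifts f))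
    (∣-ℤΣ p λ c _ → div (shifted c) (shifted-periodic c))
    where open Block g per

  -- If f(ω) = 0 then all p translates contribute equally.
  folded-descend-root : ∀ {d f} → f ≈ 0# → FoldedDivisible n d f → FoldedDivisible P (p ℕ.* d) f
  folded-descend-root {d} {f} f≈0 div g per = ≡.subst₂ ℤS._∣_ (≡.sym (ℤₚ.pos-* p d)) (≡.sym total)
      (ℤS.*-monoʳ-∣ (+ p) (div block block-periodic))
    where
    open Block g per
    constant : ∀ c → act f (shifted c) 0 ≡ act f block 0
    constant zero    = act-cong f (λ e → cong block (ℕₚ.+-identityʳ e)) 0
    constant (suc c) = ≡.trans (≡.sym (ℤₚ.i-j≡0⇒i≡j _ _ (≡.trans (≡.sym difference-act)
        (at f≈0 (difference (shifted c)) (difference-Ann {shifted c} (shifted-periodic c)) 0)))) (constant c)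
      where
      difference-act : act f (difference (shifted c)) 0 ≡ act f (shifted c) 0 ℤ.- act f (shifted (suc c)) 0
      difference-act = ≡.trans (act-+ f (shifted c) (λ e → ℤ.- shifted c (e ℕ.+ P)) 0) (cong (ℤ._+_ (act f (shifted c) 0))
        (≡.trans (act-cong f (λ e → ≡.trans (cong (ℤ.-_ ∘ block) (ℕₚ.+-assoc e P _)) (≡.sym (ℤₚ.-1*i≡-i (shifted (suc c) e)))) 0)
          (≡.trans (act-* f (ℤ.- + 1) (shifted (suc c)) 0) (ℤₚ.-1*i≡-i _))))
    total : act f g 0 ≡ + p ℤ.* act f block 0
    total = ≡.trans (sum-of-shifts f) (≡.trans (ℤK.Σ-cong p (λ c _ → constant c)) (ℤK.Σ-const p (act f block 0)))

  folded⇒∣ : ∀ {d f} → FoldedDivisible n d f → ιℕ d ∣ f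
  folded⇒∣ {d} {f} div = ∣-respʳ (sym (expansion f)) (∣-Σ n λ k _ → ∣-*ʳ (X^ k)
    (ι-∣⁺ {+ d} {coefficient k f} (ℤS.∣⇒∣ᵤ (div (indicator n k) (indicator-periodic n k)))))

  module _ {F k} (F1≡pk : at1 F ≡ + p ℤ.* k) (p∤slope : ¬ (p ℕD.∣ ∣ at1 (slope F) ∣)) where
    private
      u : Poly
      u = cofactor₁ k F
      p∤u1 : ¬ (p ℕD.∣ ∣ at1 u ∣)
      p∤u1 h = p∤slope (p∣at1-cofactor₁⇒ {F} {k} F1≡pk h)

    p∤norm-cofactor₁ : ¬ (p ℕD.∣ normℕ u)
    p∤norm-cofactor₁ h = p∤u1 (p∣norm⇒p∣at1 u h)

    private
      F≈ : F ≈ (1# - X) * u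
      F≈ = cofactor₁-correct {F} {k} F1≡pk

      X*X^M≈1 : X * X^ M ≈ 1#
      X*X^M≈1 = X^-n∣ {suc M} n∣1+M

    good∨antisymmetric : Good (normℕ u) ⊎ ∃ λ r → symmetrise M r F ≈ 0#
    good∨antisymmetric = conclude (good∨real u p∤norm-cofactor₁)
      where
      conclude : Good (normℕ u) ⊎ (∃₂ λ r ε → (ε ≡ + 1 ⊎ ε ≡ ℤ.- + 1) × u ≈ ι ε * X^ r * conj u) →
        Good (normℕ u) ⊎ ∃ λ r → symmetrise M r F ≈ 0#
      conclude (inj₁ good) = inj₁ good
      conclude (inj₂ (r , _ , inj₁ ≡.refl , e)) = inj₂ (suc r , (begin
          F + X^ suc r * conj F
            ≈⟨ +-cong (trans F≈ (*-congˡ e)) (*-congˡ (conj-cong F≈)) ⟩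
          (1# - X) * (ι (+ 1) * X^ r * ū) + X * X^ r * ((1# - X^ M) * ū)
            ≈⟨ solve 5 (λ o x y r u → (o :- x) :* (con (+ 1) :* r :* u) :+ x :* r :* ((o :- y) :* u)
                 := r :* (o :* u) :- (x :* y) :* (r :* u) :+ x :* r :* (o :* u :- u)) refl 1# X (X^ M) (X^ r) ū ⟩
          X^ r * (1# * ū) - X * X^ M * (X^ r * ū) + X * X^ r * (1# * ū - ū)
            ≈⟨ +-cong (+-cong (*-congˡ (*-identityˡ ū)) (-‿cong (trans (*-congʳ X*X^M≈1) (*-identityˡ _))))
                 (*-congˡ (trans (+-congʳ (*-identityˡ ū)) (-‿inverseʳ ū))) ⟩
          X^ r * ū - X^ r * ū + X * X^ r * 0#
            ≈⟨ trans (+-cong (-‿inverseʳ _) (zeroʳ _)) (+-identityʳ 0#) ⟩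
          0# ∎))
        where
        ū : Poly
        ū = conj u
      conclude (inj₂ (r , _ , inj₂ ≡.refl , e)) = contradiction (p∣2x⇒p∣x (≡.subst (p ℕD.∣_) (ℤₚ.abs-* (+ 2) (at1 u))
          (1-X∣ι⇒p∣ {+ 2 ℤ.* at1 u} (∣-respʳ twice (mod-trans (mod-sym (≡at1 u)) (mod-trans (mod-reflexive e)
            (mod-* (mod-* mod-refl (mod-sym (1-X∣1-X^ r))) (σ≡at1 p∤M u))))))))
          p∤u1
        where
        twice : ι (at1 u) - ι (ℤ.- + 1) * 1# * ι (at1 u) ≈ ι (+ 2 ℤ.* at1 u)
        twice = trans (+-congˡ (-‿cong (*-congʳ (*-identityʳ (ι (ℤ.- + 1))))))
          (trans (solve 1 (λ a → a :- con (ℤ.- + 1) :* a := con (+ 2) :* a) refl (ι (at1 u))) (sym (ι-* (+ 2) (at1 u))))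

    private
      cancel-norm : ∀ b y → ιℕ (p ℕ.^ suc b) ∣ ιℕ (normℕ u) * y → ιℕ (p ℕ.^ suc b) ∣ y
      cancel-norm b y h = ∣-respʳ (begin
          ιℕ a * (ιℕ N * y) - ιℕ d * (ιℕ c * y)
            ≈⟨ solve 5 (λ a N y d c → a :* (N :* y) :- d :* (c :* y) := (a :* N :- c :* d) :* y) refl (ιℕ a) (ιℕ N) y (ιℕ d) (ιℕ c) ⟩
          (ιℕ a * ιℕ N - ιℕ c * ιℕ d) * y
            ≈⟨ *-congʳ (+-congʳ (trans (sym (ι-* (+ a) (+ N))) (trans (reflexive (cong ι (≡.trans (≡.sym (ℤₚ.pos-* a N)) (cong +_ aN≡))))
                 (trans (ι-+ (+ 1) (+ (c ℕ.* d))) (+-congˡ (trans (reflexive (cong ι (ℤₚ.pos-* c d))) (ι-* (+ c) (+ d)))))))) ⟩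
          (1# + ιℕ c * ιℕ d - ιℕ c * ιℕ d) * y
            ≈⟨ *-congʳ (solve 2 (λ o w → (o :+ w) :- w := o) refl 1# (ιℕ c * ιℕ d)) ⟩
          1# * y  ≈⟨ *-identityˡ y ⟩
          y       ∎)
          (∣-+ (∣-*ˡ (ιℕ a) h) (∣-neg (∣-*ʳ _ ∣-refl)))
        where
        N d a c : ℕ
        N = normℕ u
        module B = Modulus b
        d = B.n
        a = proj₁ (B.∃-inverse {N} p∤norm-cofactor₁)
        c = (a ℕ.* N) / d
        aN≡ : a ℕ.* N ≡ 1 ℕ.+ c ℕ.* d
        aN≡ = ≡.trans (m≡m%n+[m/n]*n (a ℕ.* N) d) (cong (ℕ._+ c ℕ.* d)
          (≡.trans (proj₂ (B.∃-inverse {N} p∤norm-cofactor₁)) (m<n⇒m%n≡m B.1<n)))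

      -- Subtracting the two symmetrisations and cancelling conj u, whose norm is prime to p, leaves (1 - X^d)(1 - X).
      twist-∣ : ∀ b r s → ιℕ (p ℕ.^ suc b) ∣ symmetrise M s F → symmetrise M r F ≈ 0# →
        ιℕ (p ℕ.^ suc b) ∣ (1# - X^ (s ℕ.+ M ℕ.* r)) * (1# - X)
      twist-∣ b r s hs hr = ∣-respʳ unit-multiple (∣-*ˡ (X * X^ (M ℕ.* r)) (cancel-norm b ((X^ s - X^ r) * (1# - X^ M))
          (∣-respʳ (begin
            symmetrise M s F * z
              ≈⟨ trans (*-congʳ (solve 4 (λ f s r g → f :+ s :* g := (f :+ r :* g) :+ (s :- r) :* g) refl F (X^ s) (X^ r) (conj F)))
                   (*-congʳ (trans (+-congʳ hr) (+-identityˡ _))) ⟩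
            (X^ s - X^ r) * conj F * z
              ≈⟨ *-congʳ (*-congˡ (conj-cong F≈)) ⟩
            (X^ s - X^ r) * ((1# - X^ M) * ū) * z
              ≈⟨ solve 4 (λ a b u z → a :* (b :* u) :* z := (u :* z) :* (a :* b)) refl (X^ s - X^ r) (1# - X^ M) ū z ⟩
            ū * z * ((X^ s - X^ r) * (1# - X^ M))
              ≈⟨ *-congʳ (_∣_.equality ū∣N) ⟨
            ιℕ (normℕ u) * ((X^ s - X^ r) * (1# - X^ M)) ∎)
            (∣-*ʳ z hs))))
        where
        ū : Poly
        ū = conj u
        ū∣N : ū ∣ ιℕ (normℕ u)
        ū∣N = σ-∣ p∤M (∣-normℕ u)
        z : Poly
        z = _∣_.quotient ū∣N
        X^Mr*X^r : X^ (M ℕ.* r) * X^ r ≈ 1#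
        X^Mr*X^r = trans (sym (X^-+ (M ℕ.* r) r)) (X^-n∣ (≡.subst (n ℕD.∣_) (ℕₚ.+-comm r (M ℕ.* r)) (ℕD.∣m⇒∣m*n r n∣1+M)))
        unit-multiple : X * X^ (M ℕ.* r) * ((X^ s - X^ r) * (1# - X^ M)) ≈ (1# - X^ (s ℕ.+ M ℕ.* r)) * (1# - X)
        unit-multiple = begin
          X * X^ (M ℕ.* r) * ((X^ s - X^ r) * (1# - X^ M))
            ≈⟨ solve 6 (λ x m s r o y → x :* m :* ((s :- r) :* (o :- y)) := (s :* m :- m :* r) :* (x :* o :- x :* y)) refl
                 X (X^ (M ℕ.* r)) (X^ s) (X^ r) 1# (X^ M) ⟩
          (X^ s * X^ (M ℕ.* r) - X^ (M ℕ.* r) * X^ r) * (X * 1# - X * X^ M)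
            ≈⟨ *-cong (+-cong (sym (X^-+ s (M ℕ.* r))) (-‿cong X^Mr*X^r)) (+-cong (*-identityʳ X) (-‿cong X*X^M≈1)) ⟩
          (X^ (s ℕ.+ M ℕ.* r) - 1#) * (X - 1#)
            ≈⟨ solve 3 (λ d o x → (d :- o) :* (x :- o) := (o :- d) :* (o :- x)) refl (X^ (s ℕ.+ M ℕ.* r)) 1# X ⟩
          (1# - X^ (s ℕ.+ M ℕ.* r)) * (1# - X) ∎

      φ-value : ∀ φ k → act ((1# - ζ) * (1# - X)) φ k ≡
        (φ k ℤ.- φ (suc k)) ℤ.- (φ (k ℕ.+ P) ℤ.- φ (suc (k ℕ.+ P)))
      φ-value φ k = ≡.trans
        (cong (λ b → (+ 1 ℤ.* act (1# - X) φ k) ℤ.+ (ℤ.- + 1) ℤ.* b) (act-X^ P (act (1# - X) φ) k))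
        (ℤK.solve 4 (λ a b c d →
          ℤK.con (+ 1) ℤK.:* (ℤK.con (+ 1) ℤK.:* a ℤK.:+ ℤK.con (ℤ.- + 1) ℤK.:* b) ℤK.:+
          ℤK.con (ℤ.- + 1) ℤK.:* (ℤK.con (+ 1) ℤK.:* c ℤK.:+ ℤK.con (ℤ.- + 1) ℤK.:* d)
          ℤK.:= (a ℤK.:- b) ℤK.:- (c ℤK.:- d)) ≡.refl (φ k) (φ (suc k)) (φ (k ℕ.+ P)) (φ (suc (k ℕ.+ P))))

      value-∣ : ∀ {d} k → ιℕ d ∣ (1# - ζ) * (1# - X) → d ℕD.∣ ∣ act ((1# - ζ) * (1# - X)) λ₀ k ∣
      value-∣ {d} k (divides z e) = ≡.subst (d ℕD.∣_) (cong ∣_∣ (≡.sym (at e λ₀ λ₀-Ann k)))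
        (≡.subst (d ℕD.∣_) (≡.sym (ℤₚ.abs-* (+ d) (act z λ₀ k))) (ℕD.m∣m*n _))

    -- For p = 3 and i = 0, (1 - ζ)(1 - X) = (1 - X)² is divisible by 3 but not by 9.
    Separated : ℕ → Set
    Separated b = suc (2 ℕ.* P) ℕ.< n ⊎ (p ≡ 3 × i ≡ 0 × 1 ℕ.≤ b)

    private
      λ₀≡0 : ∀ e → 0 ℕ.< e → e ℕ.+ P ℕ.< n → λ₀ e ≡ + 0
      λ₀≡0 e 0<e e+P<n = cong₂ ℤ._-_ (δ≡0 e 0<e (ℕₚ.≤-<-trans (ℕₚ.m≤m+n e P) e+P<n)) (δ≡0 (e ℕ.+ P) (ℕₚ.<-≤-trans 0<e (ℕₚ.m≤m+n e P)) e+P<n)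
        where
        δ≡0 : ∀ e → 0 ℕ.< e → e ℕ.< n → indicator n 0 e ≡ + 0
        δ≡0 e 0<e e<n = indicator-≢ n 0 e (λ h → ℕₚ.<⇒≢ 0<e (≡.sym (≡.trans (≡.sym (m<n⇒m%n≡m e<n)) h)))

    ∤-1-ζ : ∀ b → Separated b → ¬ (ιℕ (p ℕ.^ suc b) ∣ (1# - ζ) * (1# - X))
    ∤-1-ζ b (inj₁ 2P+1<n) h = p∤1 (ℕD.∣-trans (ℕD.m∣m*n (p ℕ.^ b)) (≡.subst (λ v → p ℕ.^ suc b ℕD.∣ ∣ v ∣) value (value-∣ {p ℕ.^ suc b} 0 h)))
      where
      P+P : P ℕ.+ P ≡ 2 ℕ.* P
      P+P = cong (P ℕ.+_) (≡.sym (ℕₚ.+-identityʳ P))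
      value : act ((1# - ζ) * (1# - X)) λ₀ 0 ≡ + 1
      value = ≡.trans (φ-value λ₀ 0) (≡.trans
        (cong₂ ℤ._-_ (cong₂ ℤ._-_ λ₀-0 (λ₀≡0 1 ℕ.z<s (ℕₚ.≤-<-trans (ℕ.s≤s (ℕₚ.≤-trans (ℕₚ.m≤m+n P P) (ℕₚ.≤-reflexive P+P))) 2P+1<n)))
          (cong₂ ℤ._-_ (λ₀≡0 P 0<P (ℕₚ.≤-<-trans (ℕₚ.≤-trans (ℕₚ.≤-reflexive P+P) (ℕₚ.n≤1+n _)) 2P+1<n))
            (λ₀≡0 (suc P) ℕ.z<s (ℕₚ.≤-<-trans (ℕ.s≤s (ℕₚ.≤-reflexive P+P)) 2P+1<n)))) ≡.refl)
    ∤-1-ζ b (inj₂ (p≡3 , i≡0 , 1≤b)) h = ℕₚ.<⇒≱ 3<9 (ℕD.∣⇒≤ (ℕD.∣-trans 9∣ (≡.subst (λ v → p ℕ.^ suc b ℕD.∣ ∣ v ∣) value (value-∣ {p ℕ.^ suc b} 1 h))))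
      where
      3<9 : 3 ℕ.< 9
      3<9 = ℕ.s≤s (ℕ.s≤s (ℕ.s≤s (ℕ.s≤s ℕ.z≤n)))
      P≡1 : P ≡ 1
      P≡1 = cong (p ℕ.^_) i≡0
      n≡3 : n ≡ 3
      n≡3 = cong₂ ℕ._*_ p≡3 P≡1
      9∣ : 9 ℕD.∣ p ℕ.^ suc b
      9∣ = ≡.subst (λ x → 9 ℕD.∣ x ℕ.^ suc b) (≡.sym p≡3) (≡.subst (λ b → 9 ℕD.∣ 3 ℕ.^ suc b) (ℕₚ.m+[n∸m]≡n 1≤b)
        (≡.subst (9 ℕD.∣_) (ℕₚ.*-assoc 3 3 (3 ℕ.^ (b ℕ.∸ 1))) (ℕD.m∣m*n (3 ℕ.^ (b ℕ.∸ 1)))))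
      δ : ℕ → ℤ → Set
      δ e v = indicator n 0 e ≡ v
      miss : ∀ e → 0 ℕ.< e → e ℕ.< n → indicator n 0 e ≡ + 0
      miss e 0<e e<n = indicator-≢ n 0 e (λ h → ℕₚ.<⇒≢ 0<e (≡.sym (≡.trans (≡.sym (m<n⇒m%n≡m e<n)) h)))
      hit : ∀ d → indicator n 0 (d ℕ.+ n) ≡ indicator n 0 d
      hit d = indicator-periodic n 0 d
      δ1 : δ 1 (+ 0)
      δ1 = miss 1 ℕ.z<s 1<n
      δ2 : δ 2 (+ 0)
      δ2 = miss 2 ℕ.z<s (≡.subst (2 ℕ.<_) (≡.sym n≡3) (ℕₚ.n<1+n 2))
      δ3 : δ 3 (+ 1)
      δ3 = ≡.trans (cong (indicator n 0) (≡.sym n≡3)) (indicator-≡ n 0 n (≡.trans (cong (_% n) (≡.sym (ℕₚ.*-identityˡ n))) (m*n%n≡0 1 n)))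
      δ4 : δ 4 (+ 0)
      δ4 = ≡.trans (cong (λ x → indicator n 0 (1 ℕ.+ x)) (≡.sym n≡3)) (≡.trans (hit 1) δ1)
      λ₀-value : ∀ e {v w} → δ e v → δ (suc e) w → λ₀ e ≡ v ℤ.- w
      λ₀-value e hv hw = cong₂ ℤ._-_ hv (≡.trans (cong (indicator n 0) (≡.trans (cong (e ℕ.+_) P≡1) (ℕₚ.+-comm e 1))) hw)
      value : act ((1# - ζ) * (1# - X)) λ₀ 1 ≡ + 3
      value = ≡.trans (φ-value λ₀ 1) (≡.trans (cong (λ q → (λ₀ 1 ℤ.- λ₀ 2) ℤ.- (λ₀ (1 ℕ.+ q) ℤ.- λ₀ (suc (1 ℕ.+ q)))) P≡1)
        (cong₂ ℤ._-_ (cong₂ ℤ._-_ (λ₀-value 1 δ1 δ2) (λ₀-value 2 δ2 δ3)) (cong₂ ℤ._-_ (λ₀-value 2 δ2 δ3) (λ₀-value 3 δ3 δ4))))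

    antisymmetry-unique : ∀ b r s → Separated b → FoldedDivisible n (p ℕ.^ suc b) (symmetrise M s F) →
      symmetrise M r F ≈ 0# → symmetrise M s F ≈ 0#
    antisymmetry-unique b r s sep div hr with n ℕD.∣? (s ℕ.+ M ℕ.* r)
    ... | yes n∣d = trans (+-congˡ (*-congʳ X^s≈X^r)) hr
      where
      X^s≈X^r : X^ s ≈ X^ r
      X^s≈X^r = begin
        X^ s                                ≈⟨ *-identityʳ _ ⟨
        X^ s * 1#                           ≈⟨ *-congˡ (X^-n∣ {M ℕ.* r ℕ.+ r} (≡.subst (n ℕD.∣_) (ℕₚ.+-comm r (M ℕ.* r)) (ℕD.∣m⇒∣m*n r n∣1+M))) ⟨
        X^ s * X^ (M ℕ.* r ℕ.+ r)           ≈⟨ X^-+ s (M ℕ.* r ℕ.+ r) ⟨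
        X^ (s ℕ.+ (M ℕ.* r ℕ.+ r))          ≡⟨ cong X^_ (ℕₚ.+-assoc s (M ℕ.* r) r) ⟨
        X^ (s ℕ.+ M ℕ.* r ℕ.+ r)            ≈⟨ X^-+ (s ℕ.+ M ℕ.* r) r ⟩
        X^ (s ℕ.+ M ℕ.* r) * X^ r           ≈⟨ trans (*-congʳ (X^-n∣ n∣d)) (*-identityˡ _) ⟩
        X^ r                                ∎
    ... | no n∤d = contradiction (∣-trans (twist-∣ b r s (folded⇒∣ {p ℕ.^ suc b} div) hr)
            (*-pres-∣ (1-X^k∣1-ζ n∤d) ∣-refl)) (∤-1-ζ b sep)

open import Data.Nat using (_+_; _*_; _∸_; _^_; _≤_; _<_; _%_)

InS⇒det : ∀ {n d} → InS n d → ∃₂ λ k (e : suc k ≡ n) → ∃ λ a → det (suc k) (circulant k a) ≡ d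
InS⇒det {suc k} (a , e) = k , ≡.refl , a , e

det⇒InS : ∀ {n d} k → suc k ≡ n → (∃ λ a → det (suc k) (circulant k a) ≡ d) → InS n d
det⇒InS k ≡.refl h = h

module Factors (p : ℕ) (pp : Prime p) (2<p : 2 < p) where
  module L (i : ℕ) = LevelNorm p pp 2<p i
  open PrimePower p pp
  private instance
    p≢0 : NonZero p
    p≢0 = prime⇒nonZero pp

  -- The product of f over all p^s-th roots of unity.
  fullNorm : ℕ → Poly → ℤ
  fullNorm zero    F = at1 F
  fullNorm (suc i) F = L.norm i F ℤ.* fullNorm i F

  private
    subst-X^p-cong : ∀ i {f g} → L._≈_ i f g → L._≈_ (suc i) (subst (X^ p) f) (subst (X^ p) g)
    subst-X^p-cong i {f} {g} e = mk λ φ a k →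
      act (subst (X^ p) f) φ k                ≡⟪ cong (act (subst (X^ p) f) φ) (≡.sym (k+p0 k)) ⟫
      act (subst (X^ p) f) φ (k + p * 0)      ≡⟪ act-subst-X^ p f φ k 0 ⟫
      act f (λ m → φ (k + p * m)) 0           ≡⟪ L.at {i} e (λ m → φ (k + p * m)) (dilated φ a k) 0 ⟫
      act g (λ m → φ (k + p * m)) 0           ≡⟪ ≡.sym (act-subst-X^ p g φ k 0) ⟫
      act (subst (X^ p) g) φ (k + p * 0)      ≡⟪ cong (act (subst (X^ p) g) φ) (k+p0 k) ⟫
      act (subst (X^ p) g) φ k                □
      where
      open Annihilator p (p ^ suc i) using (mk)
      k+p0 : ∀ k → k + p * 0 ≡ k
      k+p0 k = ≡.trans (cong (_+_ k) (ℕₚ.*-zeroʳ p)) (ℕₚ.+-identityʳ k)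
      dilated : ∀ φ → L.Ann (suc i) φ → ∀ k → L.Ann i (λ m → φ (k + p * m))
      dilated φ a k m = ≡.trans (ℤK.Σ-cong p λ c _ → cong φ (rearrange c)) (a (k + p * m))
        where
        rearrange : ∀ c → k + p * (m + c * p ^ i) ≡ k + p * m + c * p ^ suc i
        rearrange c = ≡.trans (cong (_+_ k) (≡.trans (ℕₚ.*-distribˡ-+ p m _) (cong (_+_ (p * m))
            (≡.trans (≡.sym (ℕₚ.*-assoc p c _)) (≡.trans (cong (_* p ^ i) (ℕₚ.*-comm p c)) (ℕₚ.*-assoc c p _))))))
          (≡.sym (ℕₚ.+-assoc k (p * m) _))

    subst-Π : ∀ i g m F → subst g (L.Π i m F) ≡ L.Π i m (subst g ∘ F)
    subst-Π i g zero    F = ≡.refl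
    subst-Π i g (suc m) F = cong (subst g (F 0) ⊗_) (subst-Π i g m (F ∘ suc))

  product≈fullNorm : ∀ i F → L._≈_ i (L.Π i (L.n i) (λ k → L.σ i k F)) (con (fullNorm (suc i) F))
  product≈fullNorm i F = L.trans i (L.product-split i F)
      (L.trans i (L.*-congˡ i {con (L.norm i F)} (lower i)) (L.sym i (L.ι-* i (L.norm i F) (fullNorm i F))))
    where
    lower : ∀ i → L._≈_ i (L.Π i (L.P i) (λ k → L.σ i (p * k) F)) (con (fullNorm i F))
    lower zero = L.trans 0 (L.*-identityʳ 0 _) (L.trans 0 (L.reflexive 0 (cong (λ k → L.σ 0 k F) (ℕₚ.*-zeroʳ p))) (σ0 F))
      where
      σ0 : ∀ f → L._≈_ 0 (L.σ 0 0 f) (con (at1 f))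
      σ0 (con c) = L.refl 0
      σ0 X       = L.refl 0
      σ0 (f ⊕ g) = L.trans 0 (L.+-cong 0 (σ0 f) (σ0 g)) (L.sym 0 (L.ι-+ 0 (at1 f) (at1 g)))
      σ0 (f ⊗ g) = L.trans 0 (L.*-cong 0 (σ0 f) (σ0 g)) (L.sym 0 (L.ι-* 0 (at1 f) (at1 g)))
    lower (suc i) = L.trans (suc i)
      (L.Π-cong (suc i) (L.n i) λ k _ → L.sym (suc i) (L.σ-σ (suc i) p k F))
      (L.trans (suc i) (L.reflexive (suc i) (≡.sym (subst-Π i (X^ p) (L.n i) (λ k → L.σ i k F))))
        (subst-X^p-cong i (product≈fullNorm i F)))

  InS⇒fullNorm : ∀ i {d} → InS (p ^ suc i) d → ∃ λ F → d ≡ fullNorm (suc i) F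
  InS⇒fullNorm i h with k , e , a , det≡d ← InS⇒det h =
    L.circulant-polynomial i k a ,
    ≡.trans (≡.sym det≡d) (L.ι-injective i (L.trans i (L.det-circulant≈ i k e a) (product≈fullNorm i (L.circulant-polynomial i k a))))

  p^2t∣⇒InS : ∀ i c → InS (p ^ suc i) (+ (p ^ (2 * suc i)) ℤ.* c)
  p^2t∣⇒InS i c = ≡.subst (λ x → InS n (+ x ℤ.* c)) (≡.sym (≡.trans (cong (λ x → p ^ (suc i + x)) (ℕₚ.+-identityʳ (suc i))) (ℕₚ.^-distribˡ-+-* p (suc i) (suc i))))
    (det⇒InS (ℕ.pred n) (ℕₚ.suc-pred n) (L.multiples-of-n² i (ℕ.pred n) (ℕₚ.suc-pred n) c))
    where
    n = p ^ suc i
    instance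
      n≢0 : NonZero n
      n≢0 = ℕₚ.m^n≢0 p (suc i)

  -- Compatible choices of g prime powers for the levels from s upwards, whose product divides B.
  Selection : ℕ → ℕ → ℕ → Set
  Selection s g B = ∀ c → c ≤ s → ∃ λ (q : Fin g → ℕ) → ∃ λ (a : Fin g → ℕ) →
    ((l : Fin g) → Prime (q l) × a l % 2 ≡ 1 × p ^ (c + toℕ l + 1) ℕD.∣ q l ^ a l ∸ 1) ×
    prodFinℕ g (λ l → q l ^ a l) ℕD.∣ B

  p^-mono-∣ : ∀ {a b} → a ≤ b → p ^ a ℕD.∣ p ^ b
  p^-mono-∣ {a} {b} a≤b = ≡.subst (p ^ a ℕD.∣_) (≡.trans (≡.sym (ℕₚ.^-distribˡ-+-* p a (b ∸ a))) (cong (p ^_) (ℕₚ.m+[n∸m]≡n a≤b)))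
    (ℕD.m∣m*n (p ^ (b ∸ a)))

  Selection-skip : ∀ {s g B} N → Selection (suc s) g B → Selection s g (N * B)
  Selection-skip N sel c c≤s with q , a , h , d ← sel c (ℕₚ.m≤n⇒m≤1+n c≤s) = q , a , h , ℕD.∣n⇒∣m*n N d

  Selection-cons : ∀ {s g B N q a} → Prime q → a % 2 ≡ 1 → p ^ suc s ℕD.∣ q ^ a ∸ 1 → q ^ a ℕD.∣ N →
    Selection (suc s) g B → Selection s (suc g) (N * B)
  Selection-cons {s} {g} {q = q} {a} pq odd p^∣ q^a∣N sel c c≤s with qs , as , h , d ← sel (suc c) (ℕ.s≤s c≤s) =
    (λ { zero → q ; (suc l) → qs l }) , (λ { zero → a ; (suc l) → as l }) ,
    (λ { zero → pq , odd , ℕD.∣-trans (p^-mono-∣ (≡.subst (_≤ suc s) (≡.sym (≡.trans (cong (_+ 1) (ℕₚ.+-identityʳ c)) (ℕₚ.+-comm c 1))) (ℕ.s≤s c≤s))) p^∣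
       ; (suc l) → proj₁ (h l) , proj₁ (proj₂ (h l)) ,
           ≡.subst (λ x → p ^ (x + 1) ℕD.∣ qs l ^ as l ∸ 1) (≡.sym (ℕₚ.+-suc c (toℕ l))) (proj₂ (proj₂ (h l))) }) ,
    ℕD.*-pres-∣ q^a∣N d

  Selection-drop : ∀ {s g B} → Selection s (suc g) B → Selection s g B
  Selection-drop sel c c≤s with q , a , h , d ← sel c c≤s =
    q ∘ suc , a ∘ suc ,
    (λ l → proj₁ (h (suc l)) , proj₁ (proj₂ (h (suc l))) ,
      ℕD.∣-trans (p^-mono-∣ (ℕₚ.+-monoˡ-≤ 1 (ℕₚ.+-monoʳ-≤ c (ℕₚ.n≤1+n (toℕ l))))) (proj₂ (proj₂ (h (suc l))))) ,
    ℕD.∣-trans (ℕD.n∣m*n (q zero ^ a zero)) d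

  Selection-trim : ∀ {s w g B} → w ≤ g → Selection s g B → Selection s w B
  Selection-trim {s} {w} {B = B} w≤g sel = go (ℕₚ.≤⇒≤′ w≤g) sel
    where
    go : ∀ {g} → w ℕ.≤′ g → Selection s g B → Selection s w B
    go (ℕ.≤′-reflexive ≡.refl) sel = sel
    go (ℕ.≤′-step w≤′g)        sel = go w≤′g (Selection-drop sel)

  module Descent (t : ℕ) (F : Poly) (k : ℤ) (F1≡pk : at1 F ≡ + p ℤ.* k) (p∤slope : ¬ (p ℕD.∣ ∣ at1 (slope F) ∣)) where
    M : ℕ
    M = ℕ.pred (p ^ t)

    n∣1+M : ∀ {s} → s < t → p * p ^ s ℕD.∣ suc M
    n∣1+M {s} s<t = ≡.subst (p ^ suc s ℕD.∣_) (≡.sym (ℕₚ.suc-pred (p ^ t) {{ℕₚ.m^n≢0 p t}})) (p^-mono-∣ s<t)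

    module A {s} (s<t : s < t) = Antisymmetry p pp 2<p s M (n∣1+M s<t)

    cofactorNorm : ℕ → ℕ
    cofactorNorm s = ∣ L.norm s (L.cofactor₁ s k F) ∣

    cofactorProduct : ℕ → ℕ
    cofactorProduct zero    = 1
    cofactorProduct (suc s) = cofactorNorm s * cofactorProduct s

    -- Among the levels s, ..., t - 1 there are b antisymmetric ones and g carrying a good prime power.
    record State (s : ℕ) : Set where
      field
        b g B r     : ℕ
        count       : b + g + s ≡ t
        total       : B * cofactorProduct s ≡ cofactorProduct t
        divisible   : FoldedDivisible (p ^ s) (p ^ b) (symmetrise M r F)
        selection   : Selection s g B
    open State public

    initial : State t
    initial = record
      { b = 0 ; g = 0 ; B = 1 ; r = 0 ; count = ≡.refl ; total = ℕₚ.*-identityˡ _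
      ; divisible = λ h _ → trivial h 0
      ; selection = λ c _ → (λ ()) , (λ ()) , (λ ()) , ℕD.∣-refl }
      where
      trivial : ∀ h r → + 1 ℤS.∣ act (symmetrise M r F) h 0
      trivial h r = ℤS.divides (act (symmetrise M r F) h 0) (≡.sym (ℤₚ.*-identityʳ _))

    total-step : ∀ {s} (st : State (suc s)) → (cofactorNorm s * B st) * cofactorProduct s ≡ cofactorProduct t
    total-step {s} st = ≡.trans (cong (_* cofactorProduct s) (ℕₚ.*-comm (cofactorNorm s) (B st)))
      (≡.trans (ℕₚ.*-assoc (B st) (cofactorNorm s) _) (total st))

    step : ∀ {s} (s<t : s < t) (st : State (suc s)) → (∀ b′ → b st ≡ suc b′ → A.Separated s<t {F} {k} F1≡pk p∤slope b′) → State s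
    step {s} s<t st sep = by-cases (A.good∨antisymmetric s<t {F} {k} F1≡pk p∤slope)
      where
      rotate : ∀ {x} → x + suc s ≡ t → suc x + s ≡ t
      rotate {x} e = ≡.trans (≡.sym (ℕₚ.+-suc x s)) e
      antisymmetric : ∀ r′ → FoldedDivisible (p ^ suc s) (p ^ b st) (symmetrise M r′ F) →
        A._≈_ s<t (symmetrise M r′ F) (con (+ 0)) → State s
      antisymmetric r′ div root = record
        { b = suc (b st) ; g = g st ; B = cofactorNorm s * B st ; r = r′
        ; count = rotate (count st) ; total = total-step st
        ; divisible = A.folded-descend-root s<t {p ^ b st} {symmetrise M r′ F} root div
        ; selection = Selection-skip {B = B st} (cofactorNorm s) (selection st) }
      with-count : ∀ b′ → b st ≡ b′ → ∀ r′ → A._≈_ s<t (symmetrise M r′ F) (con (+ 0)) → State s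
      with-count zero b≡0 r′ root = antisymmetric r′
        (≡.subst (λ b → FoldedDivisible (p ^ suc s) (p ^ b) (symmetrise M r′ F)) (≡.sym b≡0)
          (λ h _ → ℤS.divides (act (symmetrise M r′ F) h 0) (≡.sym (ℤₚ.*-identityʳ _)))) root
      with-count (suc b′) b≡ r′ root = antisymmetric (r st) (divisible st)
        (A.antisymmetry-unique s<t {F} {k} F1≡pk p∤slope b′ r′ (r st) (sep b′ b≡)
          (≡.subst (λ b → FoldedDivisible (p ^ suc s) (p ^ b) (symmetrise M (r st) F)) b≡ (divisible st)) root)
      by-cases : A.Good s<t (cofactorNorm s) ⊎ (∃ λ r′ → A._≈_ s<t (symmetrise M r′ F) (con (+ 0))) → State s
      by-cases (inj₁ (q , a , pq , odd , n∣ , q^a∣)) = record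
        { b = b st ; g = suc (g st) ; B = cofactorNorm s * B st ; r = r st
        ; count = ≡.trans (cong (_+ s) (ℕₚ.+-suc (b st) (g st))) (rotate (count st))
        ; total = total-step st
        ; divisible = A.folded-descend s<t {p ^ b st} {symmetrise M (r st) F} (divisible st)
        ; selection = Selection-cons {B = B st} {q = q} {a} pq odd n∣ q^a∣ (selection st) }
      by-cases (inj₂ (r′ , root)) = with-count (b st) ≡.refl r′ root

    descend : ∀ d s → d + s ≡ t → (∀ {s′} → s ≤ s′ → suc (2 * p ^ s′) < p * p ^ s′) → State s
    descend zero    s ≡.refl sep = initial
    descend (suc d) s e sep = step (≡.subst (s <_) e (ℕₚ.m<n+m s ℕ.z<s))
      (descend d (suc s) (≡.trans (ℕₚ.+-suc d s) e) (λ h → sep (ℕₚ.<⇒≤ h))) (λ _ _ → inj₁ (sep ℕₚ.≤-refl))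

    fullNorm-abs : ∀ s → ∣ fullNorm s F ∣ ≡ ∣ at1 F ∣ * (p ^ s * cofactorProduct s)
    fullNorm-abs zero    = ≡.sym (ℕₚ.*-identityʳ _)
    fullNorm-abs (suc s) =
      ∣ L.norm s F ℤ.* fullNorm s F ∣
        ≡⟪ ≡.trans (ℤₚ.abs-* (L.norm s F) (fullNorm s F)) (cong₂ _*_
             (≡.trans (cong ∣_∣ (L.norm-cofactor₁ s {F} {k} F1≡pk)) (ℤₚ.abs-* (+ p) (L.norm s (L.cofactor₁ s k F)))) (fullNorm-abs s)) ⟫
      p * cofactorNorm s * (∣ at1 F ∣ * (p ^ s * cofactorProduct s))
        ≡⟪ solve 5 (λ p c a q d → p :* c :* (a :* (q :* d)) := a :* (p :* q :* (c :* d))) ≡.refl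
             p (cofactorNorm s) ∣ at1 F ∣ (p ^ s) (cofactorProduct s) ⟫
      ∣ at1 F ∣ * (p ^ suc s * cofactorProduct (suc s)) □
      where open +-*-Solver

    p∤cofactorProduct : ∀ s → s ≤ t → ¬ (p ℕD.∣ cofactorProduct s)
    p∤cofactorProduct zero    _   = p∤1
    p∤cofactorProduct (suc s) s<t = p∤* (A.p∤norm-cofactor₁ s<t {F} {k} F1≡pk p∤slope) (p∤cofactorProduct s (ℕₚ.<⇒≤ s<t))

    p^b∣F1 : ∀ {s} (st : State s) → p ^ b st ℕD.∣ ∣ at1 F ∣
    p^b∣F1 st = p^a∣xy⇒p^a∣y (b st) (L.p∤2 0) (≡.subst (p ^ b st ℕD.∣_) (≡.trans (cong ∣_∣ (≡.trans (act-one (symmetrise M (r st) F) 0) (at1-symmetrise M (r st) F))) (ℤₚ.abs-* (+ 2) (at1 F)))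
      (ℤS.∣⇒∣ᵤ (divisible st (λ _ → + 1) (λ _ → ≡.refl))))

    B∣ : ∀ {s} (st : State s) → B st ℕD.∣ cofactorProduct t
    B∣ {s} st = ≡.subst (B st ℕD.∣_) (total st) (ℕD.m∣m*n (cofactorProduct s))

  p∣at1 : ∀ F s → p ℕD.∣ ∣ fullNorm s F ∣ → p ℕD.∣ ∣ at1 F ∣
  p∣at1 F zero    h = h
  p∣at1 F (suc s) h with euclidsLemma ∣ L.norm s F ∣ ∣ fullNorm s F ∣ pp (≡.subst (p ℕD.∣_) (ℤₚ.abs-* (L.norm s F) (fullNorm s F)) h)
  ... | inj₁ h′ = L.p∣norm⇒p∣at1 s F h′
  ... | inj₂ h′ = p∣at1 F s h′

  Conclusion : ℤ → ℕ → ℕ → Set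
  Conclusion m w c = ∃ λ (q : Fin w → ℕ) → ∃ λ (a : Fin w → ℕ) →
    ((l : Fin w) → Prime (q l) × a l % 2 ≡ 1 × p ^ (c + toℕ l + 1) ℕD.∣ q l ^ a l ∸ 1) ×
    prodFinℕ w (λ l → q l ^ a l) ℕD.∣ ∣ m ∣

  module Main (t e : ℕ) (e<t : e < t) (F : Poly) (m : ℤ) (p∤m : ¬ (p ℕD.∣ ∣ m ∣))
    (norm≡ : fullNorm t F ≡ + (p ^ (t + e)) ℤ.* m) where

    private
      abs-norm : ∣ fullNorm t F ∣ ≡ p ^ (t + e) * ∣ m ∣
      abs-norm = ≡.trans (cong ∣_∣ norm≡) (ℤₚ.abs-* (+ (p ^ (t + e))) m)

      F1∣ : (+ p) ℤS.∣ at1 F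
      F1∣ = ℤS.∣ᵤ⇒∣ (p∣at1 F t (≡.subst (p ℕD.∣_) (≡.sym abs-norm)
        (ℕD.∣m⇒∣m*n ∣ m ∣ (≡.subst (ℕD._∣ p ^ (t + e)) (ℕₚ.*-identityʳ p) (p^-mono-∣ {1} (ℕₚ.≤-trans (ℕₚ.≤-trans (ℕ.s≤s ℕ.z≤n) e<t) (ℕₚ.m≤m+n t e)))))))

      k : ℤ
      k = ℤS._∣_.quotient F1∣

      F1≡pk : at1 F ≡ + p ℤ.* k
      F1≡pk = ≡.trans (ℤS._∣_.equality F1∣) (ℤₚ.*-comm k (+ p))

      -- Otherwise every level contributes p², and the norm is divisible by p^(2t+1).
      p∤slope : ¬ (p ℕD.∣ ∣ at1 (slope F) ∣)
      p∤slope h = ℕₚ.<⇒≱ (ℕₚ.+-monoʳ-< t e<t) (ℕₚ.≤-trans (ℕₚ.n≤1+n (t + t)) (^-∣-cancel (suc (t + t)) (t + e) (≡.subst (p ^ suc (t + t) ℕD.∣_) abs-norm (high t)) p∤m))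
        where
        level : ∀ s → p * p ℕD.∣ ∣ L.norm s F ∣
        level s = ≡.subst (p * p ℕD.∣_) (≡.sym (≡.trans (cong ∣_∣ (L.norm-cofactor₁ s {F} {k} F1≡pk)) (ℤₚ.abs-* (+ p) _)))
          (ℕD.*-monoʳ-∣ p (L.p∣at1⇒p∣norm s (L.cofactor₁ s k F) (L.p∣at1-slope⇒ s {F} {k} F1≡pk h)))
        high : ∀ s → p ^ suc (s + s) ℕD.∣ ∣ fullNorm s F ∣
        high zero    = ≡.subst (ℕD._∣ ∣ at1 F ∣) (≡.sym (ℕₚ.*-identityʳ p)) (ℤS.∣⇒∣ᵤ F1∣)
        high (suc s) = ≡.subst₂ ℕD._∣_
          (≡.trans (ℕₚ.*-assoc p p _) (cong (λ x → p * (p * (p ^ x))) (≡.sym (ℕₚ.+-suc s s))))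
          (≡.sym (ℤₚ.abs-* (L.norm s F) (fullNorm s F))) (ℕD.*-pres-∣ (level s) (high s))

    open Descent t F k F1≡pk p∤slope public

    private
      W : ℕ
      W = cofactorProduct t

      F1*W : ∣ at1 F ∣ * W ≡ p ^ e * ∣ m ∣
      F1*W = ℕₚ.*-cancelˡ-≡ _ _ (p ^ t) {{ℕₚ.m^n≢0 p t}} (
        p ^ t * (∣ at1 F ∣ * W)    ≡⟪ ≡.trans (≡.sym (ℕₚ.*-assoc (p ^ t) ∣ at1 F ∣ W)) (≡.trans (cong (_* W) (ℕₚ.*-comm (p ^ t) ∣ at1 F ∣)) (ℕₚ.*-assoc ∣ at1 F ∣ (p ^ t) W)) ⟫
        ∣ at1 F ∣ * (p ^ t * W)    ≡⟪ ≡.trans (≡.sym (fullNorm-abs t)) abs-norm ⟫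
        p ^ (t + e) * ∣ m ∣        ≡⟪ ≡.trans (cong (_* ∣ m ∣) (ℕₚ.^-distribˡ-+-* p t e)) (ℕₚ.*-assoc (p ^ t) (p ^ e) ∣ m ∣) ⟫
        p ^ t * (p ^ e * ∣ m ∣)    □)

    b≤e : ∀ {s} (st : State s) → b st ≤ e
    b≤e st = ^-∣-cancel (b st) e (≡.subst (p ^ b st ℕD.∣_) F1*W (ℕD.∣m⇒∣m*n W (p^b∣F1 st))) p∤m

    W∣m : W ℕD.∣ ∣ m ∣
    W∣m with ℕD.divides k₀ F1≡ ← p^a∣xy⇒p^a∣y e (p∤cofactorProduct t ℕₚ.≤-refl)
               (≡.subst (p ^ e ℕD.∣_) (≡.trans (≡.sym F1*W) (ℕₚ.*-comm ∣ at1 F ∣ W)) (ℕD.m∣m*n ∣ m ∣)) =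
      ℕD.divides k₀ (ℕₚ.*-cancelˡ-≡ _ _ (p ^ e) {{ℕₚ.m^n≢0 p e}} (
        p ^ e * ∣ m ∣          ≡⟪ ≡.sym F1*W ⟫
        ∣ at1 F ∣ * W          ≡⟪ cong (_* W) (≡.trans F1≡ (ℕₚ.*-comm k₀ (p ^ e))) ⟫
        p ^ e * k₀ * W         ≡⟪ ℕₚ.*-assoc (p ^ e) k₀ W ⟫
        p ^ e * (k₀ * W)       □))

    choose : ∀ {s} (st : State s) w c → w ≤ g st → c ≤ s → Conclusion m w c
    choose st w c w≤g c≤s with q , a , h , d ← Selection-trim {B = B st} w≤g (selection st) c c≤s =
      q , a , h , ℕD.∣-trans d (ℕD.∣-trans (B∣ st) W∣m)

    private
      t∸e≤g : (st : State 0) → t ∸ e ≤ g st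
      t∸e≤g st = ℕₚ.≤-trans (ℕₚ.∸-monoʳ-≤ t (b≤e st)) (ℕₚ.≤-reflexive
        (≡.trans (cong (_∸ b st) (≡.trans (≡.sym (count st)) (ℕₚ.+-identityʳ _))) (ℕₚ.m+n∸m≡n (b st) (g st))))

      separated : ∀ s → 5 ≤ p ⊎ 1 ≤ s → suc (2 * p ^ s) < p * p ^ s
      separated s (inj₁ 5≤p) = ℕₚ.<-≤-trans (ℕₚ.≤-<-trans (ℕₚ.+-monoˡ-≤ (2 * P) (ℕₚ.m^n>0 p s)) (ℕₚ.*-monoˡ-< P {{ℕₚ.m^n≢0 p s}} {3} {5} (ℕ.s≤s (ℕ.s≤s (ℕ.s≤s (ℕ.s≤s ℕ.z≤n)))))) (ℕₚ.*-monoˡ-≤ P 5≤p)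
        where P = p ^ s
      separated s (inj₂ 1≤s) = ℕₚ.<-≤-trans (ℕₚ.+-monoˡ-< (2 * P) 1<P) (ℕₚ.*-monoˡ-≤ P 2<p)
        where
        P = p ^ s
        1<P : 1 < P
        1<P = ℕₚ.<-≤-trans 1<p (ℕD.∣⇒≤ {{ℕₚ.m^n≢0 p s}} (≡.subst (ℕD._∣ P) (ℕₚ.*-identityʳ p) (p^-mono-∣ 1≤s)))

      0<t : 0 < t
      0<t = ℕₚ.≤-trans (ℕ.s≤s ℕ.z≤n) e<t

      state₁ : State 1
      state₁ = descend (t ∸ 1) 1 (ℕₚ.m∸n+n≡m 0<t) (λ {s′} h → separated s′ (inj₂ h))

      count₁ : b state₁ + g state₁ ≡ t ∸ 1
      count₁ = ≡.trans (≡.sym (ℕₚ.m+n∸n≡m (b state₁ + g state₁) 1)) (cong (_∸ 1) (count state₁))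

    conclusion-p≥5 : 5 ≤ p → Conclusion m (t ∸ e) 0
    conclusion-p≥5 5≤p = choose state₀ (t ∸ e) 0 (t∸e≤g state₀) ℕ.z≤n
      where
      state₀ : State 0
      state₀ = descend t 0 (ℕₚ.+-identityʳ t) (λ {s′} _ → separated s′ (inj₁ 5≤p))

    conclusion-p≡3 : p ≡ 3 → 1 < e → Conclusion m (t ∸ e) 0
    conclusion-p≡3 p≡3 1<e = by-count (b state₁) ≡.refl
      where
      finish : State 0 → Conclusion m (t ∸ e) 0
      finish st = choose st (t ∸ e) 0 (t∸e≤g st) ℕ.z≤n
      by-count : ∀ b′ → b state₁ ≡ b′ → Conclusion m (t ∸ e) 0
      by-count zero          b≡ = finish (step 0<t state₁ (λ b′ e → contradiction (≡.trans (≡.sym e) b≡) λ ()))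
      by-count (suc zero)    b≡ = choose state₁ (t ∸ e) 0 (ℕₚ.≤-trans (ℕₚ.∸-monoʳ-≤ t 1<e) (ℕₚ.≤-reflexive
        (≡.trans (≡.sym (ℕₚ.∸-+-assoc t 1 1)) (≡.trans (cong (_∸ 1) (≡.sym count₁)) (cong (λ b → (b + g state₁) ∸ 1) b≡))))) ℕ.z≤n
      by-count (suc (suc b)) b≡ = finish (step 0<t state₁ (λ b′ e →
        inj₂ (p≡3 , ≡.refl , ≡.subst (1 ≤_) (ℕₚ.suc-injective (≡.trans (≡.sym b≡) e)) (ℕ.s≤s ℕ.z≤n))))

    conclusion-e≡1 : e ≡ 1 → Conclusion m (t ∸ 2) 1
    conclusion-e≡1 e≡1 = choose state₁ (t ∸ 2) 1 t∸2≤g ℕₚ.≤-refl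
      where
      t∸2≤g : t ∸ 2 ≤ g state₁
      t∸2≤g = ℕₚ.≤-trans (ℕₚ.≤-reflexive (≡.trans (≡.sym (ℕₚ.∸-+-assoc t 1 1)) (cong (_∸ 1) (≡.sym count₁))))
        (ℕₚ.≤-trans (ℕₚ.∸-monoʳ-≤ (b state₁ + g state₁) (≡.subst (b state₁ ≤_) e≡1 (b≤e state₁)))
          (ℕₚ.≤-reflexive (ℕₚ.m+n∸m≡n (b state₁) (g state₁))))

  conclusions : ∀ t e → e < t → ∀ F m → ¬ (p ℕD.∣ ∣ m ∣) → fullNorm t F ≡ + (p ^ (t + e)) ℤ.* m →
    (5 ≤ p → Conclusion m (t ∸ e) 0) × (p ≡ 3 → 1 < e → Conclusion m (t ∸ e) 0) × (e ≡ 1 → Conclusion m (t ∸ 2) 1)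
  conclusions t e e<t F m p∤m norm≡ = conclusion-p≥5 , conclusion-p≡3 , conclusion-e≡1
    where open Main t e e<t F m p∤m norm≡

prime-powers∤1 : ∀ {w} → 0 < w → (q a : Fin w → ℕ) → (∀ l → Prime (q l)) → (∀ l → a l % 2 ≡ 1) →
  ¬ (prodFinℕ w (λ l → q l ^ a l) ℕD.∣ 1)
prime-powers∤1 {suc w} _ q a prime odd d = go (a zero) (odd zero) (ℕD.∣-trans (ℕD.m∣m*n _) d)
  where
  go : ∀ a → a % 2 ≡ 1 → q zero ^ a ℕD.∣ 1 → ⊥
  go (suc a) _ d = PrimePower.p∤1 (q zero) (prime zero) (ℕD.∣-trans (ℕD.m∣m*n (q zero ^ a)) d)

theorem1p1 : (p t : ℕ) → Prime p → ((5 ≤ p × 2 ≤ t) ⊎ (p ≡ 3 × 3 ≤ t)) →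
    ((k : ℤ) → InS (p ^ t) (+ (p ^ (2 * t)) ℤ.* k))
    × ((j : ℕ) → t + 1 ≤ j → j ≤ 2 * t ∸ 1 → ¬ InS (p ^ t) (+ (p ^ j)))
    × ((j : ℕ) (m : ℤ) → t + 1 ≤ j → j ≤ 2 * t ∸ 1 → ¬ (+ p ℤD.∣ m) →
    InS (p ^ t) (+ (p ^ j) ℤ.* m) →
    (((5 ≤ p ⊎ (p ≡ 3 × t + 1 < j)) →
    ∃ λ (q : Fin (2 * t ∸ j) → ℕ) → ∃ λ (a : Fin (2 * t ∸ j) → ℕ) →
    ((i : Fin (2 * t ∸ j)) →
    Prime (q i) × a i % 2 ≡ 1 × (p ^ (toℕ i + 1)) ℕD.∣ (q i ^ a i ∸ 1))
    × (+ prodFinℕ (2 * t ∸ j) (λ i → q i ^ a i)) ℤD.∣ m)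
    × ((p ≡ 3 × j ≡ t + 1) →
    ∃ λ (q : Fin (t ∸ 2) → ℕ) → ∃ λ (a : Fin (t ∸ 2) → ℕ) →
    ((i : Fin (t ∸ 2)) →
    Prime (q i) × a i % 2 ≡ 1 × (3 ^ (toℕ i + 2)) ℕD.∣ (q i ^ a i ∸ 1))
    × (+ prodFinℕ (t ∸ 2) (λ i → q i ^ a i)) ℤD.∣ m)))
theorem1p1 p zero pp (inj₁ (_ , ()))
theorem1p1 p zero pp (inj₂ (_ , ()))
theorem1p1 p t@(suc i) pp hyp = p^2t∣⇒InS i , excluded , (λ j m t<j → divisors (j ∸ t) j (ℕₚ.m+[n∸m]≡n (ℕₚ.≤-trans (ℕₚ.m≤m+n t 1) t<j)) m t<j)
  where
  2<p : 2 < p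
  2<p = [ hyp ]
    where
    [_] : (5 ≤ p × 2 ≤ t) ⊎ (p ≡ 3 × 3 ≤ t) → 2 < p
    [ inj₁ (5≤p , _) ] = ℕₚ.≤-trans (ℕ.s≤s (ℕ.s≤s (ℕ.s≤s ℕ.z≤n))) 5≤p
    [ inj₂ (≡.refl , _) ] = ℕₚ.≤-refl
  open Factors p pp 2<p

  LargePart SmallPart : ℕ → ℤ → Set
  LargePart j m = ∃ λ (q : Fin (2 * t ∸ j) → ℕ) → ∃ λ (a : Fin (2 * t ∸ j) → ℕ) →
    ((i : Fin (2 * t ∸ j)) →
    Prime (q i) × a i % 2 ≡ 1 × (p ^ (toℕ i + 1)) ℕD.∣ (q i ^ a i ∸ 1))
    × (+ prodFinℕ (2 * t ∸ j) (λ i → q i ^ a i)) ℤD.∣ m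
  SmallPart j m = ∃ λ (q : Fin (t ∸ 2) → ℕ) → ∃ λ (a : Fin (t ∸ 2) → ℕ) →
    ((i : Fin (t ∸ 2)) →
    Prime (q i) × a i % 2 ≡ 1 × (3 ^ (toℕ i + 2)) ℕD.∣ (q i ^ a i ∸ 1))
    × (+ prodFinℕ (t ∸ 2) (λ i → q i ^ a i)) ℤD.∣ m

  <2t : ∀ {j} → j ≤ 2 * t ∸ 1 → j < 2 * t
  <2t h = ℕ.s≤s h

  divisors : ∀ e j → t + e ≡ j → ∀ m → t + 1 ≤ j → j ≤ 2 * t ∸ 1 → ¬ (+ p ℤD.∣ m) → InS (p ^ t) (+ (p ^ j) ℤ.* m) →
    ((5 ≤ p ⊎ (p ≡ 3 × t + 1 < j)) → LargePart j m) × ((p ≡ 3 × j ≡ t + 1) → SmallPart j m)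
  divisors e .(t + e) ≡.refl m t<j j<2t p∤m inS = large , small
    where
    e<t : e < t
    e<t = ℕₚ.+-cancelˡ-< t e t (≡.subst (t + e <_) (cong (λ x → t + x) (ℕₚ.+-identityʳ t)) (<2t j<2t))
    results : (5 ≤ p → Conclusion m (t ∸ e) 0) × (p ≡ 3 → 1 < e → Conclusion m (t ∸ e) 0) × (e ≡ 1 → Conclusion m (t ∸ 2) 1)
    results = conclusions t e e<t (proj₁ (InS⇒fullNorm i inS)) m p∤m (≡.sym (proj₂ (InS⇒fullNorm i inS)))
    width : t ∸ e ≡ 2 * t ∸ (t + e)
    width = ≡.sym (≡.trans (ℕₚ.[m+n]∸[m+o]≡n∸o t (t + 0) e) (cong (_∸ e) (ℕₚ.+-identityʳ t)))
    large : 5 ≤ p ⊎ (p ≡ 3 × t + 1 < t + e) → LargePart (t + e) m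
    large (inj₁ 5≤p)           = ≡.subst (λ w → Conclusion m w 0) width (proj₁ results 5≤p)
    large (inj₂ (p≡3 , t+1<j)) = ≡.subst (λ w → Conclusion m w 0) width (proj₁ (proj₂ results) p≡3 (ℕₚ.+-cancelˡ-< t 1 e t+1<j))
    small : p ≡ 3 × t + e ≡ t + 1 → SmallPart (t + e) m
    small (p≡3 , j≡t+1) = rebase (proj₂ (proj₂ results) (ℕₚ.+-cancelˡ-≡ t e 1 j≡t+1))
      where
      rebase : Conclusion m (t ∸ 2) 1 → SmallPart (t + e) m
      rebase (q , a , h , d) = q , a , (λ l → proj₁ (h l) , proj₁ (proj₂ (h l)) ,
        ≡.subst₂ (λ x y → x ^ y ℕD.∣ q l ^ a l ∸ 1) p≡3 (≡.sym (ℕₚ.+-suc (toℕ l) 1)) (proj₂ (proj₂ (h l)))) , d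

  excluded : ∀ j → t + 1 ≤ j → j ≤ 2 * t ∸ 1 → ¬ InS (p ^ t) (+ (p ^ j))
  excluded j t<j j<2t inS = absurd hyp (ℕₚ.m≤n⇒m<n∨m≡n t<j)
    where
    parts : ((5 ≤ p ⊎ (p ≡ 3 × t + 1 < j)) → LargePart j (+ 1)) × ((p ≡ 3 × j ≡ t + 1) → SmallPart j (+ 1))
    parts = divisors (j ∸ t) j (ℕₚ.m+[n∸m]≡n (ℕₚ.≤-trans (ℕₚ.m≤m+n t 1) t<j)) (+ 1) t<j j<2t (PrimePower.p∤1 p pp)
      (≡.subst (InS (p ^ t)) (≡.sym (ℤₚ.*-identityʳ (+ (p ^ j)))) inS)
    refute-large : LargePart j (+ 1) → ⊥
    refute-large (q , a , h , d) =
      prime-powers∤1 (ℕₚ.m<n⇒0<n∸m (<2t j<2t)) q a (λ l → proj₁ (h l)) (λ l → proj₁ (proj₂ (h l))) d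
    absurd : (5 ≤ p × 2 ≤ t) ⊎ (p ≡ 3 × 3 ≤ t) → t + 1 < j ⊎ t + 1 ≡ j → ⊥
    absurd (inj₁ (5≤p , _)) _ = refute-large (proj₁ parts (inj₁ 5≤p))
    absurd (inj₂ (p≡3 , _)) (inj₁ t+1<j) = refute-large (proj₁ parts (inj₂ (p≡3 , t+1<j)))
    absurd (inj₂ (p≡3 , 3≤t)) (inj₂ t+1≡j) = refute-small (proj₂ parts (p≡3 , ≡.sym t+1≡j))
      where
      refute-small : SmallPart j (+ 1) → ⊥
      refute-small (q , a , h , d) =
        prime-powers∤1 (ℕₚ.m<n⇒0<n∸m 3≤t) q a (λ l → proj₁ (h l)) (λ l → proj₁ (proj₂ (h l))) d
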